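{- Let $t\in\mathbf{Z}$, $m\in\mathbf{N}\cup\{\infty\}$, $q>1$ a power of $p$, and let $k$ be an $\underline{\mathcal{L}_m}$-algebra. On the set $k^{m+1}$ of tuples $(a_i)_{0\le i\le m}$ (sequences indexed by $\mathbf{N}$ if $m=\infty$), define $a+b:=(Q^{+(t)}_{i,q}(a,b))_i$ and $ab:=(Q^{\times(t)}_{i,q}(a,b))_i$. These operations make $k^{m+1}$ into an $\mathcal{L}^{(t)}_{m,q}$-algebra $W^{(t)}_{m,q}(k)$ whose structure map sends $\omega_j\mapsto(\omega_j,0,0,\dots)$ and $\pi\mapsto(0,1,0,\dots)$. With morphisms acting coordinatewise, the $W^{(t)}_{m,q}(k)$ form a functor $W^{(t)}_{m,q}:\mathsf{Alg}_{\underline{\mathcal{L}_m}}\to\mathsf{Alg}_{\mathcal{L}^{(t)}_{m,q}}$ which sends perfect $\underline{\mathcal{L}_m}$-algebras into $\mathsf{CRP}_{\mathcal{L}^{(t)}_{m,q}}$; in particular affine space $\mathbf{A}^{m+1}_{\underline{\mathcal{L}_m}}$ acquires the structure of an $\mathcal{L}^{(t)}_{m,q}$-algebra scheme.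
   Context: Fix a prime $p$. For $t\in\mathbf{Z}$, $m\in\mathbf{N}\cup\{\infty\}$, $q>1$ a power of $p$, let $\mathcal{L}^{(t)}_{m,q}:=\mathbf{Z}[\omega_i^{q^{ -\infty}}\mid1\le i\le m][[\pi]]/(p-\sum_{i=1}^m\omega_i^{q^t}\pi^i,\pi^{m+1})$ (with $\pi^{\infty+1}:=0$), and $\underline{\mathcal{L}_m}:=\mathbf{F}_p[\omega_i\mid1\le i\le m]^{\mathrm{pf}}$ (perfection); write $\underline{\mathcal{L}}:=\underline{\mathcal{L}_\infty}$ and $\mathcal{L}^{(t)}_q:=\mathcal{L}^{(t)}_{\infty,q}$. Arithmetic polynomials: for $\ast\in\{+,\times\}$, $Q^{\ast(t)}_{i,q}$ are the unique elements of $\underline{\mathcal{L}}[X_i^{p^{ -\infty}},Y_i^{p^{ -\infty}}\mid i\in\mathbf{N}]$ with $\sum_iX_i^{q^{ -i}}\pi^i\ast\sum_iY_i^{q^{ -i}}\pi^i=\sum_i[Q^{\ast(t)}_{i,q}(X,Y)^{q^{ -i}}]\pi^i$ in the $\pi$-adic completion of $\mathcal{L}^{(t)}_q[X_i^{p^{ -\infty}},Y_i^{p^{ -\infty}}]$, where $[-]$ is the multiplicative section from the (perfect) residue ring. It is known that $Q^{\ast(t)}_{n,q}\in\mathbf{F}_p[\omega_1^{q^t},\dots,\omega_n^{q^t};X_0,\dots,X_n;Y_0,\dots,Y_n]$, so for $n\le m$ it is a polynomial with coefficients in $\underline{\mathcal{L}_m}$. For a ring $R$ with an image of $\pi$, $\mathsf{CRP}_R$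 is the category of $R$-algebras $B$ that are $\pi B$-adically complete, with $B/\pi B$ a perfect $\mathbf{F}_p$-algebra, and with $\pi R\otimes_RB\to B$ injective. -}

module Defs where

open import Level using (Level; _⊔_; 0ℓ) renaming (suc to lsuc)
open import Algebra.Bundles using (CommutativeRing; RawRing)
open import Algebra.Core using (Op₁; Op₂)
open import Algebra.Structures using (IsCommutativeRing)
open import Algebra.Morphism.Structures
  using (module RingMorphisms)
open import Algebra.Module.Bundles using (LeftModule)
import Algebra.Definitions.RawSemiring as RawSemiringDefs
import Algebra.Properties.Ring as RingProperties
import Algebra.Properties.CommutativeSemigroup as CSemigroupProperties
open import Data.Empty using (⊥)
open import Data.Integer.Base using (ℤ; +_; -[1+_])
open import Data.Integer.Properties using () renaming (+-*-commutativeRing to ℤ-ring)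
open import Data.Nat.Base as ℕ using (ℕ; zero; suc; z≤n; s≤s)
import Data.Nat.Properties as ℕₚ
open import Data.Product.Base using (Σ-syntax; _×_; _,_; proj₁)
open import Data.Sum.Base using (_⊎_; inj₁; inj₂)
open import Function.Bundles using (Func)
open import Function.Definitions using (Injective; Bijective)
open import Relation.Binary.Bundles using (Setoid)
open import Relation.Binary.Core using (Rel)
open import Relation.Nullary.Decidable.Core using (yes; no)
open import Relation.Nullary.Construct.Add.Supremum using (_⁺; ⊤⁺; [_])
open import Relation.Binary.Construct.Add.Supremum.NonStrict ℕ._≤_
  using (_≤⁺_; _≤⊤⁺; ≤⁺-trans; ≤⁺-dec)
open import Relation.Unary using (Pred)
import Relation.Binary.Reasoning.Setoid as SetoidReasoning

open CommutativeRing using (rawRing) renaming (Carrier to ∣_∣)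
open RingMorphisms using (IsRingHomomorphism)

private
  variable
    a b c d g r s ℓ ℓ₁ ℓ₂ ℓ₃ : Level

infixr 8 pow
pow : (R : CommutativeRing c ℓ) → ∣ R ∣ → ℕ → ∣ R ∣
pow R = RawSemiringDefs._^_ (RawRing.rawSemiring (rawRing R))
syntax pow R x n = x ^⟨ R ⟩ n

multiple : (R : CommutativeRing c ℓ) → ℕ → ∣ R ∣ → ∣ R ∣
multiple R = RawSemiringDefs._×_ (RawRing.rawSemiring (rawRing R))

module Presentation (R : CommutativeRing c ℓ) (G : Set g) where

  private module R = CommutativeRing R

  infixl 6 _⊕_
  infixl 7 _⊛_

  data Term : Set (c ⊔ g) where
    con     : R.Carrier → Term
    gen     : G → Term
    _⊕_ _⊛_ : Term → Term → Term
    ⊝_      : Term → Term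

  infixr 8 _⊛^_
  _⊛^_ : Term → ℕ → Term
  x ⊛^ zero  = con R.1#
  x ⊛^ suc n = x ⊛ (x ⊛^ n)

  eval : (S : CommutativeRing a b) →
         (R.Carrier → ∣ S ∣) → (G → ∣ S ∣) → Term → ∣ S ∣
  eval S φ ρ = go
    where
    module S = CommutativeRing S
    go : Term → S.Carrier
    go (con x) = φ x
    go (gen x) = ρ x
    go (x ⊕ y) = go x S.+ go y
    go (x ⊛ y) = go x S.* go y
    go (⊝ x)   = S.- go x

  module _ (_~_ : Rel Term r) where

    infix 4 _≋_

    -- The least congruence containing _~_ for which the terms form a
    -- commutative ring and con is a ring homomorphism.
    data _≋_ : Rel Term (c ⊔ ℓ ⊔ g ⊔ r) where
      relation    : ∀ {x y} → x ~ y → x ≋ y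
      ≋-refl      : ∀ {x} → x ≋ x
      ≋-sym       : ∀ {x y} → x ≋ y → y ≋ x
      ≋-trans     : ∀ {x y z} → x ≋ y → y ≋ z → x ≋ z
      ⊕-cong      : ∀ {x y u v} → x ≋ y → u ≋ v → x ⊕ u ≋ y ⊕ v
      ⊛-cong      : ∀ {x y u v} → x ≋ y → u ≋ v → x ⊛ u ≋ y ⊛ v
      ⊝-cong      : ∀ {x y} → x ≋ y → ⊝ x ≋ ⊝ y
      con-cong    : ∀ {x y} → x R.≈ y → con x ≋ con y
      con-+       : ∀ x y → con (x R.+ y) ≋ con x ⊕ con y
      con-*       : ∀ x y → con (x R.* y) ≋ con x ⊛ con y
      ⊕-assoc     : ∀ x y z → (x ⊕ y) ⊕ z ≋ x ⊕ (y ⊕ z)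
      ⊕-comm      : ∀ x y → x ⊕ y ≋ y ⊕ x
      ⊕-identityˡ : ∀ x → con R.0# ⊕ x ≋ x
      ⊝-inverseˡ  : ∀ x → ⊝ x ⊕ x ≋ con R.0#
      ⊛-assoc     : ∀ x y z → (x ⊛ y) ⊛ z ≋ x ⊛ (y ⊛ z)
      ⊛-comm      : ∀ x y → x ⊛ y ≋ y ⊛ x
      ⊛-identityˡ : ∀ x → con R.1# ⊛ x ≋ x
      ⊛-distribˡ  : ∀ x y z → x ⊛ (y ⊕ z) ≋ x ⊛ y ⊕ x ⊛ z

    presented : CommutativeRing (c ⊔ g) (c ⊔ ℓ ⊔ g ⊔ r)
    presented = record
      { Carrier = Term
      ; _≈_     = _≋_
      ; _+_     = _⊕_
      ; _*_     = _⊛_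
      ; -_      = ⊝_
      ; 0#      = con R.0#
      ; 1#      = con R.1#
      ; isCommutativeRing = record
        { isRing = record
          { +-isAbelianGroup = record
            { isGroup = record
              { isMonoid = record
                { isSemigroup = record
                  { isMagma = record
                    { isEquivalence = record
                      { refl = ≋-refl ; sym = ≋-sym ; trans = ≋-trans }
                    ; ∙-cong = ⊕-cong
                    }
                  ; assoc = ⊕-assoc
                  }
                ; identity = ⊕-identityˡ
                           , λ x → ≋-trans (⊕-comm _ _) (⊕-identityˡ x)
                }
              ; inverse = ⊝-inverseˡ
                        , λ x → ≋-trans (⊕-comm _ _) (⊝-inverseˡ x)
              ; ⁻¹-cong = ⊝-cong
              }
            ; comm = ⊕-comm
            }
          ; *-cong = ⊛-cong
          ; *-assoc = ⊛-assoc
          ; *-identity = ⊛-identityˡ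
                       , λ x → ≋-trans (⊛-comm _ _) (⊛-identityˡ x)
          ; distrib = ⊛-distribˡ
                    , λ x y z → ≋-trans (⊛-comm _ _)
                        (≋-trans (⊛-distribˡ x y z)
                          (⊕-cong (⊛-comm _ _) (⊛-comm _ _)))
          }
        ; *-comm = ⊛-comm
        }
      }

Polynomials : CommutativeRing c ℓ → Set g → CommutativeRing (c ⊔ g) (c ⊔ ℓ ⊔ g)
Polynomials R V = presented {r = 0ℓ} (λ _ _ → ⊥)
  where open Presentation R V

-- R[v^{b^{-∞}} | v ∈ V]; the generator (v , n) is v^{b^{-n}}.
module RootPolynomials (base : ℕ) (R : CommutativeRing c ℓ) (V : Set g) where
  open Presentation R (V × ℕ) public

  data RootRelation : Rel Term (c ⊔ g) where
    root : ∀ v n → RootRelation (gen (v , suc n) ⊛^ base) (gen (v , n))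

  ring : CommutativeRing (c ⊔ g) (c ⊔ ℓ ⊔ g)
  ring = presented RootRelation

-- The perfection of a ring A of characteristic p, i.e. the colimit of
-- A → A → A → ⋯ along the Frobenius x ↦ x^p.  The generator (n , x) is the
-- image of x in the n-th copy of A, that is, x^{p^{-n}}.
module Perfection (p : ℕ) (A : CommutativeRing c ℓ) where
  open Presentation ℤ-ring (ℕ × ∣ A ∣) public
  private module A = CommutativeRing A

  data PerfectionRelation : Rel Term (c ⊔ ℓ) where
    resp      : ∀ n {x y} → x A.≈ y → PerfectionRelation (gen (n , x)) (gen (n , y))
    additive  : ∀ n x y → PerfectionRelation (gen (n , x A.+ y)) (gen (n , x) ⊕ gen (n , y))
    multiplicative : ∀ n x y → PerfectionRelation (gen (n , x A.* y)) (gen (n , x) ⊛ gen (n , y))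
    unital    : ∀ n → PerfectionRelation (gen (n , A.1#)) (con (+ 1))
    frobenius : ∀ n x → PerfectionRelation (gen (suc n , x ^⟨ A ⟩ p)) (gen (n , x))

  ring : CommutativeRing c (c ⊔ ℓ)
  ring = presented PerfectionRelation

module Quotient (R : CommutativeRing c ℓ) (S : Pred ∣ R ∣ s) where

  open CommutativeRing R
  open RingProperties (CommutativeRing.ring R)
  private module +P = CSemigroupProperties +-commutativeSemigroup
  open SetoidReasoning setoid

  data Ideal : Pred Carrier (c ⊔ ℓ ⊔ s) where
    generator : ∀ {x} → S x → Ideal x
    zero∈     : Ideal 0#
    sum∈      : ∀ {x y} → Ideal x → Ideal y → Ideal (x + y)
    multiple∈ : ∀ r {x} → Ideal x → Ideal (r * x)
    resp∈     : ∀ {x y} → x ≈ y → Ideal x → Ideal y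

  infix 4 _≈/_
  _≈/_ : Rel Carrier (c ⊔ ℓ ⊔ s)
  x ≈/ y = Ideal (x - y)

  neg∈ : ∀ {x} → Ideal x → Ideal (- x)
  neg∈ {x} i = resp∈ (-1*x≈-x x) (multiple∈ (- 1#) i)

  ≈⇒≈/ : ∀ {x y} → x ≈ y → x ≈/ y
  ≈⇒≈/ {x} {y} x≈y = resp∈ (sym (trans (+-congʳ x≈y) (-‿inverseʳ y))) zero∈

  ≈/-sym : ∀ {x y} → x ≈/ y → y ≈/ x
  ≈/-sym {x} {y} i = resp∈ (begin
    - (x - y)     ≈⟨ -‿+-comm x (- y) ⟨
    - x - - y     ≈⟨ +-congˡ (-‿involutive y) ⟩
    - x + y       ≈⟨ +-comm (- x) y ⟩
    y - x         ∎) (neg∈ i)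

  ≈/-trans : ∀ {x y z} → x ≈/ y → y ≈/ z → x ≈/ z
  ≈/-trans {x} {y} {z} i j = resp∈ (begin
    (x - y) + (y - z)   ≈⟨ +-assoc x (- y) (y - z) ⟩
    x + (- y + (y - z)) ≈⟨ +-congˡ (+-assoc (- y) y (- z)) ⟨
    x + ((- y + y) - z) ≈⟨ +-congˡ (+-congʳ (-‿inverseˡ y)) ⟩
    x + (0# - z)        ≈⟨ +-congˡ (+-identityˡ (- z)) ⟩
    x - z               ∎) (sum∈ i j)

  +-cong/ : ∀ {x y u v} → x ≈/ y → u ≈/ v → x + u ≈/ y + v
  +-cong/ {x} {y} {u} {v} i j = resp∈ (begin
    (x - y) + (u - v)     ≈⟨ +P.interchange x (- y) u (- v) ⟩
    (x + u) + (- y - v)   ≈⟨ +-congˡ (-‿+-comm y v) ⟩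
    (x + u) - (y + v)     ∎) (sum∈ i j)

  *-cong/ : ∀ {x y u v} → x ≈/ y → u ≈/ v → x * u ≈/ y * v
  *-cong/ {x} {y} {u} {v} i j = ≈/-trans
    (resp∈ (begin
      u * (x - y)      ≈⟨ x[y-z]≈xy-xz u x y ⟩
      u * x - u * y    ≈⟨ +-cong (*-comm u x) (-‿cong (*-comm u y)) ⟩
      x * u - y * u    ∎) (multiple∈ u i))
    (resp∈ (x[y-z]≈xy-xz y u v) (multiple∈ y j))

  neg-cong/ : ∀ {x y} → x ≈/ y → - x ≈/ - y
  neg-cong/ {x} {y} i = resp∈ (sym (-‿+-comm x (- y))) (neg∈ i)

  quotient : CommutativeRing c (c ⊔ ℓ ⊔ s)
  quotient = record
    { Carrier = Carrier
    ; _≈_     = _≈/_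
    ; _+_     = _+_
    ; _*_     = _*_
    ; -_      = -_
    ; 0#      = 0#
    ; 1#      = 1#
    ; isCommutativeRing = record
      { isRing = record
        { +-isAbelianGroup = record
          { isGroup = record
            { isMonoid = record
              { isSemigroup = record
                { isMagma = record
                  { isEquivalence = record
                    { refl = ≈⇒≈/ refl ; sym = ≈/-sym ; trans = ≈/-trans }
                  ; ∙-cong = +-cong/
                  }
                ; assoc = λ x y z → ≈⇒≈/ (+-assoc x y z)
                }
              ; identity = (λ x → ≈⇒≈/ (+-identityˡ x)) , λ x → ≈⇒≈/ (+-identityʳ x)
              }
            ; inverse = (λ x → ≈⇒≈/ (-‿inverseˡ x)) , λ x → ≈⇒≈/ (-‿inverseʳ x)
            ; ⁻¹-cong = neg-cong/
            }
          ; comm = λ x y → ≈⇒≈/ (+-comm x y)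
          }
        ; *-cong = *-cong/
        ; *-assoc = λ x y z → ≈⇒≈/ (*-assoc x y z)
        ; *-identity = (λ x → ≈⇒≈/ (*-identityˡ x)) , λ x → ≈⇒≈/ (*-identityʳ x)
        ; distrib = (λ x y z → ≈⇒≈/ (distribˡ x y z)) , λ x y z → ≈⇒≈/ (distribʳ x y z)
        }
      ; *-comm = λ x y → ≈⇒≈/ (*-comm x y)
      }
    }

infixl 7 _/⟨_⟩
_/⟨_⟩ : (R : CommutativeRing c ℓ) → ∣ R ∣ → CommutativeRing c (c ⊔ ℓ)
R /⟨ x ⟩ = Quotient.quotient R (CommutativeRing._≈_ R x)

infixl 7 _/⟨_⨾_⟩
_/⟨_⨾_⟩ : (R : CommutativeRing c ℓ) → (x y : ∣ R ∣) → CommutativeRing c (c ⊔ ℓ)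
R /⟨ x ⨾ y ⟩ = Quotient.quotient R (λ z → x ≈ z ⊎ y ≈ z)
  where open CommutativeRing R

-- The π-adic completion lim R / πⁿR
module Completion (R : CommutativeRing c ℓ) (π : ∣ R ∣) where

  private
    module R = CommutativeRing R

  module Mod (n : ℕ) = CommutativeRing (R /⟨ π ^⟨ R ⟩ n ⟩)

  record Limit : Set (c ⊔ ℓ) where
    field
      seq      : ℕ → R.Carrier
      coherent : ∀ n → Mod._≈_ n (seq (suc n)) (seq n)
  open Limit public

  infix 4 _≈^_
  _≈^_ : Rel Limit (c ⊔ ℓ)
  x ≈^ y = ∀ n → Mod._≈_ n (seq x n) (seq y n)

  completion : CommutativeRing (c ⊔ ℓ) (c ⊔ ℓ)
  completion = record
    { Carrier = Limit
    ; _≈_     = _≈^_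
    ; _+_     = λ x y → record
      { seq      = λ n → seq x n R.+ seq y n
      ; coherent = λ n → Mod.+-cong n (coherent x n) (coherent y n) }
    ; _*_     = λ x y → record
      { seq      = λ n → seq x n R.* seq y n
      ; coherent = λ n → Mod.*-cong n (coherent x n) (coherent y n) }
    ; -_      = λ x → record
      { seq      = λ n → R.- seq x n
      ; coherent = λ n → Mod.-‿cong n (coherent x n) }
    ; 0#      = record { seq = λ _ → R.0# ; coherent = λ n → Mod.refl n }
    ; 1#      = record { seq = λ _ → R.1# ; coherent = λ n → Mod.refl n }
    ; isCommutativeRing = record
      { isRing = record
        { +-isAbelianGroup = record
          { isGroup = record
            { isMonoid = record
              { isSemigroup = record
                { isMagma = record
                  { isEquivalence = record
                    { refl  = λ n → Mod.refl n
                    ; sym   = λ i n → Mod.sym n (i n)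
                    ; trans = λ i j n → Mod.trans n (i n) (j n)
                    }
                  ; ∙-cong = λ i j n → Mod.+-cong n (i n) (j n)
                  }
                ; assoc = λ x y z n → Mod.+-assoc n (seq x n) (seq y n) (seq z n)
                }
              ; identity = (λ x n → Mod.+-identityˡ n (seq x n))
                         , λ x n → Mod.+-identityʳ n (seq x n)
              }
            ; inverse = (λ x n → Mod.-‿inverseˡ n (seq x n))
                      , λ x n → Mod.-‿inverseʳ n (seq x n)
            ; ⁻¹-cong = λ i n → Mod.-‿cong n (i n)
            }
          ; comm = λ x y n → Mod.+-comm n (seq x n) (seq y n)
          }
        ; *-cong = λ i j n → Mod.*-cong n (i n) (j n)
        ; *-assoc = λ x y z n → Mod.*-assoc n (seq x n) (seq y n) (seq z n)
        ; *-identity = (λ x n → Mod.*-identityˡ n (seq x n))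
                     , λ x n → Mod.*-identityʳ n (seq x n)
        ; distrib = (λ x y z n → Mod.distribˡ n (seq x n) (seq y n) (seq z n))
                  , λ x y z n → Mod.distribʳ n (seq x n) (seq y n) (seq z n)
        }
      ; *-comm = λ x y n → Mod.*-comm n (seq x n) (seq y n)
      }
    }

  diagonal : R.Carrier → Limit
  diagonal x = record { seq = λ _ → x ; coherent = λ n → Mod.refl n }

  -- The convergent series Σᵢ xᵢ πⁱ
  series : (ℕ → Limit) → Limit
  series x = record
    { seq      = λ n → partial n n
    ; coherent = λ n → Mod.trans n
        (Mod.+-cong n (below n n) (last n))
        (Mod.+-identityʳ n (partial n n))
    }
    where
    -- Σ_{i<k} xᵢ πⁱ modulo πⁿ
    partial : ℕ → ℕ → R.Carrier
    partial n zero    = R.0#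
    partial n (suc k) = partial n k R.+ seq (x k) n R.* π ^⟨ R ⟩ k

    below : ∀ n k → Mod._≈_ n (partial (suc n) k) (partial n k)
    below n zero    = Mod.refl n
    below n (suc k) = Mod.+-cong n (below n k)
      (Mod.*-cong n (coherent (x k) n) (Mod.refl n))

    last : ∀ n → Mod._≈_ n (seq (x n) (suc n) R.* π ^⟨ R ⟩ n) R.0#
    last n = resp∈
      (R.sym (R.trans (R.+-congˡ -0#≈0#) (R.+-identityʳ _)))
      (multiple∈ _ (generator R.refl))
      where
      open RingProperties R.ring using (-0#≈0#)
      open Quotient R (R._≈_ (π ^⟨ R ⟩ n)) using (generator; multiple∈; resp∈)

module PowerSeries (R : CommutativeRing c ℓ) where

  open CommutativeRing R
  open SetoidReasoning setoid
  private module +P = CSemigroupProperties +-commutativeSemigroup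

  Series : Set c
  Series = ℕ → Carrier

  constant : Carrier → Series
  constant x zero    = x
  constant x (suc _) = 0#

  private
    tail : Series → Series
    tail f n = f (suc n)

  -- The n-th coefficient Σ_{i+j=n} fᵢ gⱼ, by recursion on n
  infixl 7 _⋆_
  _⋆_ : Series → Series → Series
  (f ⋆ g) zero    = f 0 * g 0
  (f ⋆ g) (suc n) = f 0 * g (suc n) + (tail f ⋆ g) n

  private
    infix 4 _≐_
    _≐_ : Rel Series ℓ
    f ≐ g = ∀ n → f n ≈ g n

    ⋆-cong : ∀ {f f′ g g′} → f ≐ f′ → g ≐ g′ → f ⋆ g ≐ f′ ⋆ g′
    ⋆-cong p q zero    = *-cong (p 0) (q 0)
    ⋆-cong p q (suc n) = +-cong (*-cong (p 0) (q (suc n)))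
      (⋆-cong (λ i → p (suc i)) q n)

    ⋆-suc : ∀ f g n → (f ⋆ g) (suc n) ≈ f (suc n) * g 0 + (f ⋆ tail g) n
    ⋆-suc f g zero    = +-comm _ _
    ⋆-suc f g (suc n) = begin
      f 0 * g (2 ℕ.+ n) + (tail f ⋆ g) (suc n)
        ≈⟨ +-congˡ (⋆-suc (tail f) g n) ⟩
      f 0 * g (2 ℕ.+ n) + (f (2 ℕ.+ n) * g 0 + (tail f ⋆ tail g) n)
        ≈⟨ +P.x∙yz≈y∙xz _ _ _ ⟩
      f (2 ℕ.+ n) * g 0 + (f 0 * g (2 ℕ.+ n) + (tail f ⋆ tail g) n) ∎

    ⋆-comm : ∀ f g → f ⋆ g ≐ g ⋆ f
    ⋆-comm f g zero    = *-comm _ _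
    ⋆-comm f g (suc n) = begin
      f 0 * g (suc n) + (tail f ⋆ g) n  ≈⟨ +-cong (*-comm _ _) (⋆-comm (tail f) g n) ⟩
      g (suc n) * f 0 + (g ⋆ tail f) n  ≈⟨ ⋆-suc g f n ⟨
      (g ⋆ f) (suc n)                   ∎

    ⋆-distribʳ : ∀ h f g → (λ n → f n + g n) ⋆ h ≐ λ n → (f ⋆ h) n + (g ⋆ h) n
    ⋆-distribʳ h f g zero    = distribʳ _ _ _
    ⋆-distribʳ h f g (suc n) = trans
      (+-cong (distribʳ _ _ _) (⋆-distribʳ h (tail f) (tail g) n))
      (+P.interchange _ _ _ _)

    ⋆-distribˡ : ∀ h f g → h ⋆ (λ n → f n + g n) ≐ λ n → (h ⋆ f) n + (h ⋆ g) n
    ⋆-distribˡ h f g n = trans (⋆-comm h _ n) (trans (⋆-distribʳ h f g n)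
      (+-cong (⋆-comm f h n) (⋆-comm g h n)))

    ⋆-scale : ∀ x f g → (λ n → x * f n) ⋆ g ≐ λ n → x * (f ⋆ g) n
    ⋆-scale x f g zero    = *-assoc _ _ _
    ⋆-scale x f g (suc n) = trans
      (+-cong (*-assoc _ _ _) (⋆-scale x (tail f) g n))
      (sym (distribˡ _ _ _))

    ⋆-assoc : ∀ f g h → (f ⋆ g) ⋆ h ≐ f ⋆ (g ⋆ h)
    ⋆-assoc f g h zero    = *-assoc _ _ _
    ⋆-assoc f g h (suc n) = begin
      f 0 * g 0 * h (suc n) + (tail (f ⋆ g) ⋆ h) n
        ≈⟨ +-cong (*-assoc _ _ _)
             (trans (⋆-distribʳ h (λ i → f 0 * g (suc i)) (tail f ⋆ g) n)
               (+-cong (⋆-scale (f 0) (tail g) h n) (⋆-assoc (tail f) g h n))) ⟩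
      f 0 * (g 0 * h (suc n)) + (f 0 * (tail g ⋆ h) n + (tail f ⋆ (g ⋆ h)) n)
        ≈⟨ +-assoc _ _ _ ⟨
      f 0 * (g 0 * h (suc n)) + f 0 * (tail g ⋆ h) n + (tail f ⋆ (g ⋆ h)) n
        ≈⟨ +-congʳ (distribˡ _ _ _) ⟨
      (f ⋆ (g ⋆ h)) (suc n) ∎

    ⋆-zeroˡ : ∀ f → (λ _ → 0#) ⋆ f ≐ λ _ → 0#
    ⋆-zeroˡ f zero    = zeroˡ _
    ⋆-zeroˡ f (suc n) = trans (+-cong (zeroˡ _) (⋆-zeroˡ f n)) (+-identityˡ _)

    ⋆-identityˡ : ∀ f → constant 1# ⋆ f ≐ f
    ⋆-identityˡ f zero    = *-identityˡ _
    ⋆-identityˡ f (suc n) = trans (+-cong (*-identityˡ _) (⋆-zeroˡ f n)) (+-identityʳ _)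

    ⋆-identityʳ : ∀ f → f ⋆ constant 1# ≐ f
    ⋆-identityʳ f n = trans (⋆-comm f _ n) (⋆-identityˡ f n)

  powerSeries : CommutativeRing c ℓ
  powerSeries = record
    { Carrier = Series
    ; _≈_     = _≐_
    ; _+_     = λ f g n → f n + g n
    ; _*_     = _⋆_
    ; -_      = λ f n → - f n
    ; 0#      = λ _ → 0#
    ; 1#      = constant 1#
    ; isCommutativeRing = record
      { isRing = record
        { +-isAbelianGroup = record
          { isGroup = record
            { isMonoid = record
              { isSemigroup = record
                { isMagma = record
                  { isEquivalence = record
                    { refl  = λ _ → refl
                    ; sym   = λ p n → sym (p n)
                    ; trans = λ p q n → trans (p n) (q n)
                    }
                  ; ∙-cong = λ p q n → +-cong (p n) (q n)
                  }
                ; assoc = λ f g h n → +-assoc (f n) (g n) (h n)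
                }
              ; identity = (λ f n → +-identityˡ (f n)) , λ f n → +-identityʳ (f n)
              }
            ; inverse = (λ f n → -‿inverseˡ (f n)) , λ f n → -‿inverseʳ (f n)
            ; ⁻¹-cong = λ p n → -‿cong (p n)
            }
          ; comm = λ f g n → +-comm (f n) (g n)
          }
        ; *-cong = ⋆-cong
        ; *-assoc = ⋆-assoc
        ; *-identity = ⋆-identityˡ , ⋆-identityʳ
        ; distrib = ⋆-distribˡ , ⋆-distribʳ
        }
      ; *-comm = ⋆-comm
      }
    }

  variable-π : Series
  variable-π zero          = 0#
  variable-π (suc zero)    = 1#
  variable-π (suc (suc _)) = 0#

record CommAlgebra (R : CommutativeRing a b) c ℓ : Set (a ⊔ b ⊔ lsuc (c ⊔ ℓ)) where
  field
    ring                 : CommutativeRing c ℓ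
    structure            : ∣ R ∣ → ∣ ring ∣
    structure-isRingHom  : IsRingHomomorphism (rawRing R) (rawRing ring) structure

  open CommutativeRing ring public hiding (ring)

record IsAlgHom {R : CommutativeRing a b} (A : CommAlgebra R c ℓ) (B : CommAlgebra R d ℓ₁)
                (f : CommAlgebra.Carrier A → CommAlgebra.Carrier B) :
                Set (a ⊔ c ⊔ ℓ ⊔ d ⊔ ℓ₁) where
  private
    module A = CommAlgebra A
    module B = CommAlgebra B
  field
    isRingHomomorphism : IsRingHomomorphism (rawRing A.ring) (rawRing B.ring) f
    structure-homo     : ∀ x → f (A.structure x) B.≈ B.structure x

record AlgHom {R : CommutativeRing a b} (A : CommAlgebra R c ℓ) (B : CommAlgebra R d ℓ₁) :
              Set (a ⊔ b ⊔ c ⊔ ℓ ⊔ d ⊔ ℓ₁) where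
  field
    ⟦_⟧      : CommAlgebra.Carrier A → CommAlgebra.Carrier B
    isAlgHom : IsAlgHom A B ⟦_⟧

  open IsAlgHom isAlgHom public
  open RingMorphisms.IsRingHomomorphism isRingHomomorphism public

open AlgHom using (⟦_⟧)

record IsAlgIso {R : CommutativeRing a b} (A : CommAlgebra R c ℓ) (B : CommAlgebra R d ℓ₁)
                (f : CommAlgebra.Carrier A → CommAlgebra.Carrier B) :
                Set (a ⊔ c ⊔ ℓ ⊔ d ⊔ ℓ₁) where
  field
    isAlgHom  : IsAlgHom A B f
    bijective : Bijective (CommAlgebra._≈_ A) (CommAlgebra._≈_ B) f

module _ {R : CommutativeRing a b} where

  idHom : (A : CommAlgebra R c ℓ) → AlgHom A A
  idHom A = record
    { ⟦_⟧ = λ x → x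
    ; isAlgHom = record
      { isRingHomomorphism = record
        { isSemiringHomomorphism = record
          { isNearSemiringHomomorphism = record
            { +-isMonoidHomomorphism = record
              { isMagmaHomomorphism = record
                { isRelHomomorphism = record { cong = λ p → p }
                ; homo = λ _ _ → A.refl }
              ; ε-homo = A.refl }
            ; *-homo = λ _ _ → A.refl }
          ; 1#-homo = A.refl }
        ; -‿homo = λ _ → A.refl }
      ; structure-homo = λ _ → A.refl
      }
    }
    where module A = CommAlgebra A

  infixr 9 _∘Hom_
  _∘Hom_ : {A : CommAlgebra R c ℓ} {B : CommAlgebra R d ℓ₁} {C : CommAlgebra R g ℓ₂} →
           AlgHom B C → AlgHom A B → AlgHom A C
  _∘Hom_ {C = C} G F = record
    { ⟦_⟧ = λ x → G.⟦ F.⟦ x ⟧ ⟧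
    ; isAlgHom = record
      { isRingHomomorphism = record
        { isSemiringHomomorphism = record
          { isNearSemiringHomomorphism = record
            { +-isMonoidHomomorphism = record
              { isMagmaHomomorphism = record
                { isRelHomomorphism = record { cong = λ p → G.⟦⟧-cong (F.⟦⟧-cong p) }
                ; homo = λ x y → C.trans (G.⟦⟧-cong (F.+-homo x y)) (G.+-homo _ _) }
              ; ε-homo = C.trans (G.⟦⟧-cong F.0#-homo) G.0#-homo }
            ; *-homo = λ x y → C.trans (G.⟦⟧-cong (F.*-homo x y)) (G.*-homo _ _) }
          ; 1#-homo = C.trans (G.⟦⟧-cong F.1#-homo) G.1#-homo }
        ; -‿homo = λ x → C.trans (G.⟦⟧-cong (F.-‿homo x)) (G.-‿homo _) }
      ; structure-homo = λ x → C.trans (G.⟦⟧-cong (F.structure-homo x)) (G.structure-homo x)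
      }
    }
    where
    module C = CommAlgebra C
    module F = AlgHom F
    module G = AlgHom G

polynomialAlgebra : (R : CommutativeRing c ℓ) (V : Set g) →
                    CommAlgebra R (c ⊔ g) (c ⊔ ℓ ⊔ g)
polynomialAlgebra R V = record
  { ring      = Polynomials R V
  ; structure = con
  ; structure-isRingHom = record
    { isSemiringHomomorphism = record
      { isNearSemiringHomomorphism = record
        { +-isMonoidHomomorphism = record
          { isMagmaHomomorphism = record
            { isRelHomomorphism = record { cong = con-cong }
            ; homo = con-+ }
          ; ε-homo = ≋-refl }
        ; *-homo = con-* }
      ; 1#-homo = ≋-refl }
    ; -‿homo = λ x → inverseʳ-unique (con x) (con (R.- x))
        (P.trans (P.sym (con-+ x (R.- x))) (con-cong (R.-‿inverseʳ x)))
    }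
  }
  where
  module R = CommutativeRing R
  module P = CommutativeRing (Polynomials R V)
  open Presentation R V
  open RingProperties P.ring using () renaming (+-inverseʳ-unique to inverseʳ-unique)

-- Covariant functors from R-algebras to sets
record SetFunctor (R : CommutativeRing a b) c ℓ d ℓ₁ :
                  Set (a ⊔ b ⊔ lsuc (c ⊔ ℓ ⊔ d ⊔ ℓ₁)) where
  field
    obj : CommAlgebra R c ℓ → Setoid d ℓ₁
    mor : ∀ {A B} → AlgHom A B → Func (obj A) (obj B)

  map : ∀ {A B} → AlgHom A B → Setoid.Carrier (obj A) → Setoid.Carrier (obj B)
  map f = Func.to (mor f)

  private module Obj A = Setoid (obj A)

  field
    map-resp : ∀ {A B} (f g : AlgHom A B) →
               (∀ x → CommAlgebra._≈_ B (⟦ f ⟧ x) (⟦ g ⟧ x)) →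
               ∀ x → Obj._≈_ B (map f x) (map g x)
    map-id   : ∀ {A} x → Obj._≈_ A (map (idHom A) x) x
    map-∘    : ∀ {A B C} (g : AlgHom B C) (f : AlgHom A B) x →
               Obj._≈_ C (map (g ∘Hom f) x) (map g (map f x))

-- The functor of points of Spec A
points : ∀ {R : CommutativeRing a b} (A : CommAlgebra R d ℓ₁) →
         SetFunctor R c ℓ (a ⊔ b ⊔ d ⊔ ℓ₁ ⊔ c ⊔ ℓ) (d ⊔ ℓ)
points A = record
  { obj = λ B → let module B = CommAlgebra B in record
    { Carrier = AlgHom A B
    ; _≈_     = λ f g → ∀ x → ⟦ f ⟧ x B.≈ ⟦ g ⟧ x
    ; isEquivalence = record
      { refl  = λ _ → B.refl
      ; sym   = λ p x → B.sym (p x)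
      ; trans = λ p q x → B.trans (p x) (q x)
      }
    }
  ; mor = λ f → record { to = f ∘Hom_ ; cong = λ p x → AlgHom.⟦⟧-cong f (p x) }
  ; map-resp = λ _ _ p φ x → p (⟦ φ ⟧ x)
  ; map-id   = λ {B} _ _ → CommAlgebra.refl B
  ; map-∘    = λ {_} {_} {C} _ _ _ _ → CommAlgebra.refl C
  }

record AlgebraOn (S : CommutativeRing a b) (X : Setoid c ℓ) : Set (a ⊔ b ⊔ c ⊔ ℓ) where
  open Setoid X using (_≈_) renaming (Carrier to |X|)
  infixl 6 _+_
  infixl 7 _*_
  infix  8 -_
  field
    _+_ _*_ : Op₂ |X|
    -_      : Op₁ |X|
    0# 1#   : |X|
    isCommutativeRing : IsCommutativeRing _≈_ _+_ _*_ -_ 0# 1#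

  ring : CommutativeRing c ℓ
  ring = record
    { _≈_ = _≈_ ; _+_ = _+_ ; _*_ = _*_ ; -_ = -_ ; 0# = 0# ; 1# = 1#
    ; isCommutativeRing = isCommutativeRing }

  field
    structure          : ∣ S ∣ → |X|
    structure-isRingHom : IsRingHomomorphism (rawRing S) (rawRing ring) structure

  algebra : CommAlgebra S c ℓ
  algebra = record
    { ring = ring ; structure = structure ; structure-isRingHom = structure-isRingHom }

-- A lift of F to a functor from R-algebras to S-algebras.  For F = points A
-- this is the structure of an S-algebra scheme on Spec A.
record AlgebraLift {R : CommutativeRing a b} (F : SetFunctor R c ℓ d ℓ₁)
                   (S : CommutativeRing r ℓ₂) :
                   Set (a ⊔ b ⊔ lsuc (c ⊔ ℓ) ⊔ d ⊔ ℓ₁ ⊔ r ⊔ ℓ₂) where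
  open SetFunctor F
  field
    algebraOn : ∀ A → AlgebraOn S (obj A)

  algebra : CommAlgebra R c ℓ → CommAlgebra S d ℓ₁
  algebra A = AlgebraOn.algebra (algebraOn A)

  field
    map-isAlgHom : ∀ {A B} (f : AlgHom A B) → IsAlgHom (algebra A) (algebra B) (map f)

module TensorProduct (R : CommutativeRing a b)
                     (M : LeftModule (CommutativeRing.ring R) c ℓ)
                     (N : LeftModule (CommutativeRing.ring R) d ℓ₁) where
  private
    module R = CommutativeRing R
    module M = LeftModule M
    module N = LeftModule N

  infixl 6 _∔_
  infix  7 _⊗_
  infix  8 ∸_

  data Tensor : Set (c ⊔ d) where
    _⊗_ : M.Carrierᴹ → N.Carrierᴹ → Tensor
    _∔_ : Tensor → Tensor → Tensor
    ∸_  : Tensor → Tensor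
    𝟘   : Tensor

  infix 4 _≈⊗_

  -- The least congruence for which the tensors form an abelian group and
  -- _⊗_ is R-bilinear.
  data _≈⊗_ : Rel Tensor (a ⊔ c ⊔ ℓ ⊔ d ⊔ ℓ₁) where
    ≈⊗-refl     : ∀ {x} → x ≈⊗ x
    ≈⊗-sym      : ∀ {x y} → x ≈⊗ y → y ≈⊗ x
    ≈⊗-trans    : ∀ {x y z} → x ≈⊗ y → y ≈⊗ z → x ≈⊗ z
    ⊗-cong      : ∀ {m m′ n n′} → m M.≈ᴹ m′ → n N.≈ᴹ n′ → m ⊗ n ≈⊗ m′ ⊗ n′
    ∔-cong      : ∀ {x y u v} → x ≈⊗ y → u ≈⊗ v → x ∔ u ≈⊗ y ∔ v
    ∸-cong      : ∀ {x y} → x ≈⊗ y → ∸ x ≈⊗ ∸ y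
    ∔-assoc     : ∀ x y z → (x ∔ y) ∔ z ≈⊗ x ∔ (y ∔ z)
    ∔-comm      : ∀ x y → x ∔ y ≈⊗ y ∔ x
    ∔-identityˡ : ∀ x → 𝟘 ∔ x ≈⊗ x
    ∸-inverseˡ  : ∀ x → ∸ x ∔ x ≈⊗ 𝟘
    ⊗-additiveˡ : ∀ m m′ n → (m M.+ᴹ m′) ⊗ n ≈⊗ m ⊗ n ∔ m′ ⊗ n
    ⊗-additiveʳ : ∀ m n n′ → m ⊗ (n N.+ᴹ n′) ≈⊗ m ⊗ n ∔ m ⊗ n′
    ⊗-balanced  : ∀ r m n → (r M.*ₗ m) ⊗ n ≈⊗ m ⊗ (r N.*ₗ n)

-- The ideal πR as an R-module
module _ (R : CommutativeRing a b) (π : ∣ R ∣) where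

  open CommutativeRing R
  open RingProperties (CommutativeRing.ring R) using (-‿distribˡ-*)

  principalIdeal : LeftModule (CommutativeRing.ring R) (a ⊔ b) b
  principalIdeal = record
    { Carrierᴹ = Σ[ x ∈ ∣ R ∣ ] Σ[ r ∈ ∣ R ∣ ] r * π ≈ x
    ; _≈ᴹ_     = λ x y → proj₁ x ≈ proj₁ y
    ; _+ᴹ_     = λ (x , r , p) (y , s , q) →
        x + y , r + s , trans (distribʳ π r s) (+-cong p q)
    ; _*ₗ_     = λ c (x , r , p) → c * x , c * r , trans (*-assoc c r π) (*-congˡ p)
    ; 0ᴹ       = 0# , 0# , zeroˡ π
    ; -ᴹ_      = λ (x , r , p) →
        - x , - r , trans (sym (-‿distribˡ-* r π)) (-‿cong p)
    ; isLeftModule = record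
      { isLeftSemimodule = record
        { +ᴹ-isCommutativeMonoid = record
          { isMonoid = record
            { isSemigroup = record
              { isMagma = record
                { isEquivalence = record { refl = refl ; sym = sym ; trans = trans }
                ; ∙-cong = +-cong
                }
              ; assoc = λ _ _ _ → +-assoc _ _ _
              }
            ; identity = (λ _ → +-identityˡ _) , λ _ → +-identityʳ _
            }
          ; comm = λ _ _ → +-comm _ _
          }
        ; isPreleftSemimodule = record
          { *ₗ-cong      = *-cong
          ; *ₗ-zeroˡ     = λ _ → zeroˡ _
          ; *ₗ-distribʳ  = λ _ _ _ → distribʳ _ _ _
          ; *ₗ-identityˡ = λ _ → *-identityˡ _
          ; *ₗ-assoc     = λ _ _ _ → *-assoc _ _ _
          ; *ₗ-zeroʳ     = λ _ → zeroʳ _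
          ; *ₗ-distribˡ  = λ _ _ _ → distribˡ _ _ _
          }
        }
      ; -ᴹ‿cong    = -‿cong
      ; -ᴹ‿inverse = (λ _ → -‿inverseˡ _) , λ _ → -‿inverseʳ _
      }
    }

algebraModule : {R : CommutativeRing a b} (B : CommAlgebra R c ℓ) →
                LeftModule (CommutativeRing.ring R) c ℓ
algebraModule {R = R} B = record
  { Carrierᴹ = B.Carrier
  ; _≈ᴹ_     = B._≈_
  ; _+ᴹ_     = B._+_
  ; _*ₗ_     = λ r x → B.structure r B.* x
  ; 0ᴹ       = B.0#
  ; -ᴹ_      = B.-_
  ; isLeftModule = record
    { isLeftSemimodule = record
      { +ᴹ-isCommutativeMonoid = B.+-isCommutativeMonoid
      ; isPreleftSemimodule = record
        { *ₗ-cong      = λ p q → B.*-cong (⟦⟧-cong p) q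
        ; *ₗ-zeroˡ     = λ x → B.trans (B.*-congʳ 0#-homo) (B.zeroˡ x)
        ; *ₗ-distribʳ  = λ x r s → B.trans (B.*-congʳ (+-homo r s)) (B.distribʳ x _ _)
        ; *ₗ-identityˡ = λ x → B.trans (B.*-congʳ 1#-homo) (B.*-identityˡ x)
        ; *ₗ-assoc     = λ r s x → B.trans (B.*-congʳ (*-homo r s)) (B.*-assoc _ _ x)
        ; *ₗ-zeroʳ     = λ r → B.zeroʳ _
        ; *ₗ-distribˡ  = λ r x y → B.distribˡ _ x y
        }
      }
    ; -ᴹ‿cong    = B.-‿cong
    ; -ᴹ‿inverse = B.-‿inverse
    }
  }
  where
  module B = CommAlgebra B
  open IsRingHomomorphism B.structure-isRingHom

IsPerfect : ℕ → CommutativeRing c ℓ → Set (c ⊔ ℓ)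
IsPerfect p A = multiple A p 1# ≈ 0# × Bijective _≈_ _≈_ (λ x → x ^⟨ A ⟩ p)
  where open CommutativeRing A

-- The multiplication map πR ⊗_R B → B
module IdealTensor (R : CommutativeRing a b) (π : ∣ R ∣) (B : CommAlgebra R c ℓ) where
  private module B = CommAlgebra B
  open TensorProduct R (principalIdeal R π) (algebraModule B) public

  multiply : Tensor → B.Carrier
  multiply ((x , _) ⊗ y) = B.structure x B.* y
  multiply (u ∔ v)       = multiply u B.+ multiply v
  multiply (∸ u)         = B.- multiply u
  multiply 𝟘             = B.0#

-- CRP_R is the full subcategory of R-algebras satisfying IsCRP.
record IsCRP (p : ℕ) (R : CommutativeRing a b) (π : ∣ R ∣) (B : CommAlgebra R c ℓ) :
             Set (a ⊔ b ⊔ c ⊔ ℓ) where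
  private
    module B = CommAlgebra B
    module B^ = Completion B.ring (B.structure π)
    module πR⊗B = IdealTensor R π B
  field
    complete         : Bijective B._≈_ B^._≈^_ B^.diagonal
    perfect-residue  : IsPerfect p (B.ring /⟨ B.structure π ⟩)
    tensor-injective : Injective πR⊗B._≈⊗_ B._≈_ πR⊗B.multiply

-- { i ∈ ℕ | l ≤ i ≤ m }, where m may be ∞
record Interval (l : ℕ) (m : ℕ ⁺) : Set where
  constructor index
  field
    val    : ℕ
    .lower : l ℕ.≤ val
    .upper : [ val ] ≤⁺ m
open Interval public using (val)

extend : ∀ {l m} n → .([ n ] ≤⁺ m) → Interval l [ n ] → Interval l m
extend n n≤m (index i l≤i i≤n) = index i l≤i (≤⁺-trans ℕₚ.≤-trans i≤n n≤m)

below : ∀ {m} (i : Interval 0 m) → ∀ {l} → Interval l [ val i ] → Interval l m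
below (index i _ i≤m) = extend i i≤m

module Setup (p e : ℕ) (t : ℤ) where

  q : ℕ
  q = p ℕ.^ e

  𝔽ₚ : CommutativeRing 0ℓ 0ℓ
  𝔽ₚ = ℤ-ring /⟨ + p ⟩

  -- ℤ[ω_i^{q^{-∞}} | 1 ≤ i ≤ m]
  module ℤ[ω] (m : ℕ ⁺) = RootPolynomials q ℤ-ring (Interval 1 m)

  module ℤ[ω][[π]] (m : ℕ ⁺) = PowerSeries (ℤ[ω].ring m)

  module ℒ-Construction (m : ℕ ⁺) where
    open ℤ[ω] m using (gen)
    open ℤ[ω][[π]] m using (Series; powerSeries; constant; variable-π)

    -- ω_i^{q^s}
    ω-power : ℤ → Interval 1 m → ∣ ℤ[ω].ring m ∣
    ω-power (+ n)    i = gen (i , 0) ^⟨ ℤ[ω].ring m ⟩ (q ℕ.^ n)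
    ω-power -[1+ n ] i = gen (i , suc n)

    -- Σ_{1≤i≤m} ω_i^{q^t} πⁱ
    p-expansion : Series
    p-expansion zero    = CommutativeRing.0# (ℤ[ω].ring m)
    p-expansion (suc i) with ≤⁺-dec ℕₚ._≤?_ [ suc i ] m
    ... | yes 1+i≤m = ω-power t (index (suc i) (s≤s z≤n) 1+i≤m)
    ... | no  _     = CommutativeRing.0# (ℤ[ω].ring m)

    π^m+1 : ℕ ⁺ → Series
    π^m+1 [ n ] = variable-π ^⟨ powerSeries ⟩ suc n
    π^m+1 ⊤⁺    = CommutativeRing.0# powerSeries

    p-relation : Series
    p-relation = constant (ℤ[ω].con (+ p)) - p-expansion
      where open CommutativeRing powerSeries using (_-_)

    ℒ : CommutativeRing 0ℓ 0ℓ
    ℒ = powerSeries /⟨ p-relation ⨾ π^m+1 m ⟩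

    πℒ : ∣ ℒ ∣
    πℒ = variable-π

    -- ω_j^{q^{-n}}
    ωℒ : Interval 1 m → ℕ → ∣ ℒ ∣
    ωℒ j n = constant (gen (j , n))

  open ℒ-Construction public using (ℒ; πℒ; ωℒ)

  -- The residue ring 𝔽ₚ[ω_i | 1 ≤ i ≤ m]^pf of ℒ
  module 𝔽ₚ[ω] (m : ℕ ⁺) = Presentation 𝔽ₚ (Interval 1 m)
  module Perf (m : ℕ ⁺) = Perfection p (Polynomials 𝔽ₚ (Interval 1 m))

  ℒ₀ : ℕ ⁺ → CommutativeRing 0ℓ 0ℓ
  ℒ₀ = Perf.ring

  scalarℒ₀ : ∀ m → ∣ 𝔽ₚ ∣ → ∣ ℒ₀ m ∣
  scalarℒ₀ m x = Perf.gen (0 , 𝔽ₚ[ω].con x)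

  -- ω_j^{p^{-n}}
  ωℒ₀ : ∀ m → Interval 1 m → ℕ → ∣ ℒ₀ m ∣
  ωℒ₀ m j n = Perf.gen (n , 𝔽ₚ[ω].gen j)

  -- ω_j^{q^s}
  ωℒ₀-power : ∀ m → ℤ → Interval 1 m → ∣ ℒ₀ m ∣
  ωℒ₀-power m (+ n)    j = ωℒ₀ m j 0 ^⟨ ℒ₀ m ⟩ (q ℕ.^ n)
  ωℒ₀-power m -[1+ n ] j = ωℒ₀ m j (e ℕ.* suc n)

  -- The reduction ℒ → ℒ/πℒ ≅ ℒ₀ sends a power series to its constant
  -- coefficient modulo p.
  reduceℒ : ∀ m → ∣ ℒ m ∣ → ∣ ℒ₀ m ∣
  reduceℒ m f = ℤ[ω].eval m (ℒ₀ m) (scalarℒ₀ m) (λ (j , n) → ωℒ₀ m j (e ℕ.* n)) (f 0)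

  -- inj₁ i is X_i and inj₂ i is Y_i.
  module ℒ[X,Y] = RootPolynomials p (ℒ ⊤⁺) (ℕ ⊎ ℕ)
  module ℒ₀[X,Y] = RootPolynomials p (ℒ₀ ⊤⁺) (ℕ ⊎ ℕ)
  module ℒ[X,Y]^ = Completion ℒ[X,Y].ring (ℒ[X,Y].con (πℒ ⊤⁺))

  Ĉ : CommutativeRing 0ℓ 0ℓ
  Ĉ = ℒ[X,Y]^.completion

  -- The reduction of Ĉ modulo π, read off in the first quotient
  -- ℒ[X,Y]/π ≅ ℒ₀[X,Y] of the inverse system.
  reduce : ∣ Ĉ ∣ → ∣ ℒ₀[X,Y].ring ∣
  reduce x = ℒ[X,Y].eval ℒ₀[X,Y].ring
    (λ f → ℒ₀[X,Y].con (reduceℒ ⊤⁺ f)) ℒ₀[X,Y].gen (ℒ[X,Y]^.seq x 1)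

  -- X_i^{q^{-i}} and Y_i^{q^{-i}}
  X Y : ℕ → ∣ Ĉ ∣
  X i = ℒ[X,Y]^.diagonal (ℒ[X,Y].gen (inj₁ i , e ℕ.* i))
  Y i = ℒ[X,Y]^.diagonal (ℒ[X,Y].gen (inj₂ i , e ℕ.* i))

  -- As ℒ₀[X,Y] is perfect and Ĉ is π-adically complete with p ∈ πĈ, there is
  -- exactly one such section, the Teichmüller map.
  record MultiplicativeSection : Set where
    private
      module C = CommutativeRing Ĉ
      module E = CommutativeRing ℒ₀[X,Y].ring
    field
      [[_]]   : E.Carrier → C.Carrier
      cong    : ∀ {x y} → x E.≈ y → [[ x ]] C.≈ [[ y ]]
      *-homo  : ∀ x y → [[ x E.* y ]] C.≈ [[ x ]] C.* [[ y ]]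
      1#-homo : [[ E.1# ]] C.≈ C.1#
      section : ∀ x → reduce [[ x ]] E.≈ x

  -- 𝔽ₚ[ω_1^{q^t},…,ω_n^{q^t}; X_0,…,X_n; Y_0,…,Y_n]
  module Integral (n : ℕ) =
    Presentation 𝔽ₚ (Interval 1 [ n ] ⊎ Interval 0 [ n ] ⊎ Interval 0 [ n ])

  IntegralPolynomial : ℕ → Set
  IntegralPolynomial n = Integral.Term n

  toℒ₀[X,Y] : ∀ n → IntegralPolynomial n → ∣ ℒ₀[X,Y].ring ∣
  toℒ₀[X,Y] n = Integral.eval n ℒ₀[X,Y].ring (λ x → ℒ₀[X,Y].con (scalarℒ₀ ⊤⁺ x)) λ where
    (inj₁ j)        → ℒ₀[X,Y].con (ωℒ₀-power ⊤⁺ t (extend n ([ n ] ≤⊤⁺) j))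
    (inj₂ (inj₁ i)) → ℒ₀[X,Y].gen (inj₁ (val i) , 0)
    (inj₂ (inj₂ i)) → ℒ₀[X,Y].gen (inj₂ (val i) , 0)

  -- The arithmetic polynomials are characterised by their defining equation
  -- for an operation ∗ on Ĉ, which determines them uniquely.  Since ℒ₀[X,Y]
  -- is perfect, root-Q says that root i is Q_i^{q^{-i}}.
  record ArithmeticPolynomials (τ : MultiplicativeSection) (_∗_ : Op₂ ∣ Ĉ ∣) : Set where
    open MultiplicativeSection τ
    open ℒ[X,Y]^ using (series)
    field
      Q        : ∀ i → IntegralPolynomial i
      root     : ℕ → ∣ ℒ₀[X,Y].ring ∣
      root-Q   : ∀ i → CommutativeRing._≈_ ℒ₀[X,Y].ring
                   (root i ^⟨ ℒ₀[X,Y].ring ⟩ (q ℕ.^ i)) (toℒ₀[X,Y] i (Q i))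
      equation : CommutativeRing._≈_ Ĉ
                   (series X ∗ series Y) (series (λ i → [[ root i ]]))

  module _ (m : ℕ ⁺) (k : CommAlgebra (ℒ₀ m) c ℓ) where

    private module k = CommAlgebra k

    tuples : Setoid c ℓ
    tuples = record
      { Carrier = Interval 0 m → k.Carrier
      ; _≈_     = λ a b → ∀ i → a i k.≈ b i
      ; isEquivalence = record
        { refl  = λ _ → k.refl
        ; sym   = λ p i → k.sym (p i)
        ; trans = λ p q i → k.trans (p i) (q i)
        }
      }

    -- (Q_i(a, b))_i
    evaluate : (∀ i → IntegralPolynomial i) → Op₂ (Setoid.Carrier tuples)
    evaluate Q a b i = Integral.eval (val i) k.ring (λ x → k.structure (scalarℒ₀ m x)) (λ where
      (inj₁ j)        → k.structure (ωℒ₀-power m t (below i j))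
      (inj₂ (inj₁ j)) → a (below i j)
      (inj₂ (inj₂ j)) → b (below i j)) (Q (val i))

    -- (x, 0, 0, …)
    leading : k.Carrier → Setoid.Carrier tuples
    leading x (index zero _ _)    = x
    leading x (index (suc _) _ _) = k.0#

    -- (0, 1, 0, …)
    π-tuple : Setoid.Carrier tuples
    π-tuple (index (suc zero) _ _) = k.1#
    π-tuple _                      = k.0#

  record IsWittAlgebra (m : ℕ ⁺) (k : CommAlgebra (ℒ₀ m) c ℓ)
                       {τ : MultiplicativeSection}
                       (Q⁺ : ArithmeticPolynomials τ (CommutativeRing._+_ Ĉ))
                       (Q× : ArithmeticPolynomials τ (CommutativeRing._*_ Ĉ))
                       (W : AlgebraOn (ℒ m) (tuples m k)) : Set (c ⊔ ℓ) where
    private module k = CommAlgebra k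
    open Setoid (tuples m k) using (_≈_)
    open AlgebraOn W using (_+_; _*_; structure)
    open ArithmeticPolynomials using (Q)
    field
      sum         : ∀ a b → a + b ≈ evaluate m k (Q Q⁺) a b
      product     : ∀ a b → a * b ≈ evaluate m k (Q Q×) a b
      -- ω_j^{q^{-n}} ↦ (ω_j^{q^{-n}}, 0, 0, …)
      structure-ω : ∀ j n → structure (ωℒ m j n) ≈ leading m k (k.structure (ωℒ₀ m j (e ℕ.* n)))
      structure-π : structure (πℒ m) ≈ π-tuple m k

  affineSpace : ∀ m → SetFunctor (ℒ₀ m) c ℓ c ℓ
  affineSpace m = record
    { obj = tuples m
    ; mor = λ f → record
      { to = λ a i → ⟦ f ⟧ (a i) ; cong = λ p i → AlgHom.⟦⟧-cong f (p i) }
    ; map-resp = λ _ _ p a i → p (a i)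
    ; map-id   = λ {k} _ _ → CommAlgebra.refl k
    ; map-∘    = λ {_} {_} {k} _ _ _ _ → CommAlgebra.refl k
    }

  -- The coordinate ring ℒ₀[X_i | 0 ≤ i ≤ m] of 𝐀^{m+1}
  coordinateRing : ∀ m → CommAlgebra (ℒ₀ m) 0ℓ 0ℓ
  coordinateRing m = polynomialAlgebra (ℒ₀ m) (Interval 0 m)

  coordinates : ∀ m (k : CommAlgebra (ℒ₀ m) c ℓ) →
                AlgHom (coordinateRing m) k → Setoid.Carrier (tuples m k)
  coordinates m k f i = ⟦ f ⟧ (Presentation.gen i)

{-# OPTIONS --safe #-}
-- Let A be a polynomial ring over ℤ with the lift φ of Frobenius that sends
-- each variable to its p-th power, P = colim (A → A → ⋯) along φ, and E = P/p,
-- which is perfect.  For variables wⱼ put B = P[[π]]/(p - Σ wⱼ πʲ, πⁿ⁺¹).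
-- The Teichmüller map E → B is [x] = (a lift of x^{p⁻ⁿ})^{pⁿ}, and
-- θ(a) = Σ [aᵢ^{q⁻ⁱ}] πⁱ determines aᵢ for i ≤ n, because P has no p-torsion.
-- Multiplicative sections are compatible with every map Ĉ → B since they
-- commute with pⁿ-th roots, so the equation that defines the polynomials Q
-- says θ(Q(a, b)) = θ(a) ∗ θ(b).  Hence all identities of the ring B hold for
-- sequences over E, then over A/p ⊂ E, and then, being polynomial, over every
-- ring of characteristic p.  This includes π a = (0, a₀^q, a₁^q, …), so over a
-- perfect ring πⁿ divides exactly the tuples whose coordinates below n vanish.
module Submission where

open import Defs
open import Level using (Level; _⊔_; 0ℓ)
open import Algebra.Bundles using (AbelianGroup; CommutativeRing)
open import Algebra.Core using (Op₁; Op₂)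
open import Algebra.Module.Bundles using (LeftModule)
open import Algebra.Morphism.Structures using (module RingMorphisms)
open import Algebra.Structures using (IsCommutativeRing)
import Algebra.Definitions as AlgebraicLaws
import Algebra.Properties.CommutativeSemigroup as CSemigroupProperties
import Algebra.Properties.CommutativeSemiring.Binomial as Binomial
import Algebra.Properties.CommutativeSemiring.Exp as Exp
import Algebra.Properties.Group as GroupProperties
import Algebra.Properties.Ring as RingProperties
import Algebra.Properties.Semiring.Mult as Mult
import Algebra.Properties.Semiring.Sum as Sum
open import Data.Empty using (⊥; ⊥-elim; ⊥-elim-irr)
open import Data.Fin.Base as Fin using (Fin; toℕ; fromℕ; inject₁)
import Data.Fin.Properties as Finₚ
open import Data.Integer.Base as ℤ using (ℤ; +_; -[1+_])
import Data.Integer.Properties as ℤₚ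
open import Data.Nat.Base as ℕ using (ℕ; zero; suc; z≤n; s≤s)
import Data.Nat.Properties as ℕₚ
open import Data.Nat.Combinatorics using (_C_; nC1≡n; nCn≡1; nCk+nC[k+1]≡[n+1]C[k+1])
open import Data.Nat.Combinatorics.Specification using (k>n⇒nCk≡0)
open import Data.Nat.Divisibility using (_∣_; divides; ∣⇒≤; m∣m*n)
open import Data.Nat.Primality using (Prime; euclidsLemma; prime⇒nonZero; ¬prime[0]; ¬prime[1])
open import Data.Product.Base using (Σ-syntax; ∃; _×_; _,_; proj₁; proj₂)
open import Data.Sum.Base using (_⊎_; inj₁; inj₂)
open import Function.Definitions using (Injective; Bijective)
open import Relation.Binary.Bundles using (Setoid)
open import Relation.Binary.Construct.Add.Supremum.NonStrict ℕ._≤_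
  using (_≤⁺_; [_]; _≤⊤⁺; ≤⁺-trans; ≤⁺-dec; [≤]-injective)
open import Relation.Binary.Core using (Rel)
open import Relation.Binary.PropositionalEquality as ≡ using (_≡_)
import Relation.Binary.Reasoning.Setoid as SetoidReasoning
open import Relation.Binary.Structures using (IsEquivalence)
open import Relation.Nullary.Construct.Add.Supremum using (_⁺; ⊤⁺; [_])
open import Relation.Nullary.Decidable.Core using (yes; no; recompute)

open CommutativeRing using (rawRing) renaming (Carrier to ∣_∣)

private
  variable
    a b c c′ ℓ ℓ′ ℓ₁ ℓ₂ ℓ₃ : Level

-- The torsion-free ring `P` is there so that π can be cancelled. That π f vanishes in `B` means π f
-- = u (p - Σ wⱼ πʲ) + v πⁿ⁺¹, and the constant coefficient reads u₀ p = 0. Without p-torsion u is a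
-- multiple of π, so the equation can be divided by π at the cost of one order of truncation. Over a
-- ring of characteristic p that coefficient is always 0 and says nothing. The variables satisfy
-- φ(x) = xᵖ, so the wⱼ are their own Teichmüller lifts. Therefore p = Σ [wⱼ] πʲ holds in `B`, and p
-- has the coordinates wⱼ^(qʲ). The parameter t only decides which power or root of wⱼ is the value
-- of ω_j. Negation comes without a polynomial of its own. Since p is a multiple of π, pⁿ⁺¹ kills
-- `B`, and -a is (pⁿ⁺¹ - 1) a; the multiple depends on the coordinate. Coordinates are compared one
-- truncation at a time: coordinate n is read where πⁿ⁺¹ = 0.

record IsCommutativeRingˡ {A : Set c} (_≈_ : Rel A ℓ) (_+_ _*_ : Op₂ A) (-_ : Op₁ A) (0# 1# : A) :
                          Set (c ⊔ ℓ) where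
  open AlgebraicLaws _≈_
  field
    isEquivalence : IsEquivalence _≈_
    +-cong        : Congruent₂ _+_
    *-cong        : Congruent₂ _*_
    -‿cong        : Congruent₁ -_
    +-assoc       : Associative _+_
    +-comm        : Commutative _+_
    +-identityˡ   : LeftIdentity 0# _+_
    -‿inverseˡ    : LeftInverse 0# -_ _+_
    *-assoc       : Associative _*_
    *-comm        : Commutative _*_
    *-identityˡ   : LeftIdentity 1# _*_
    distribˡ      : _*_ DistributesOverˡ _+_

  isCommutativeRing : IsCommutativeRing _≈_ _+_ _*_ -_ 0# 1#
  isCommutativeRing = record
    { isRing = record
      { +-isAbelianGroup = record
        { isGroup = record
          { isMonoid = record
            { isSemigroup = record
              { isMagma = record { isEquivalence = isEquivalence ; ∙-cong = +-cong } ; assoc = +-assoc }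
            ; identity = +-identityˡ , λ x → trans (+-comm _ _) (+-identityˡ x) }
          ; inverse = -‿inverseˡ , λ x → trans (+-comm _ _) (-‿inverseˡ x)
          ; ⁻¹-cong = -‿cong }
        ; comm = +-comm }
      ; *-cong = *-cong
      ; *-assoc = *-assoc
      ; *-identity = *-identityˡ , λ x → trans (*-comm _ _) (*-identityˡ x)
      ; distrib = distribˡ , λ x y z → trans (*-comm _ _)
          (trans (distribˡ x y z) (+-cong (*-comm _ _) (*-comm _ _))) }
    ; *-comm = *-comm }
    where open IsEquivalence isEquivalence using (trans)

-- Homomorphisms, presentations and quotients of commutative rings

record RingHom (R : CommutativeRing a b) (S : CommutativeRing c ℓ₁) :
               Set (a ⊔ b ⊔ c ⊔ ℓ₁) where
  constructor ringHom
  private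
    module R = CommutativeRing R
    module S = CommutativeRing S
  field
    to        : R.Carrier → S.Carrier
    isRingHom : RingMorphisms.IsRingHomomorphism (rawRing R) (rawRing S) to

  open RingMorphisms.IsRingHomomorphism isRingHom public
    using (+-homo; *-homo; 0#-homo; 1#-homo; -‿homo) renaming (⟦⟧-cong to cong)

  ^-homo : ∀ x n → to (x ^⟨ R ⟩ n) S.≈ to x ^⟨ S ⟩ n
  ^-homo x zero    = 1#-homo
  ^-homo x (suc n) = S.trans (*-homo _ _) (S.*-congˡ (^-homo x n))

  multiple-homo : ∀ n → to (multiple R n R.1#) S.≈ multiple S n S.1#
  multiple-homo zero    = 0#-homo
  multiple-homo (suc n) = S.trans (+-homo _ _) (S.+-cong 1#-homo (multiple-homo n))

module _ {R : CommutativeRing a b} {S : CommutativeRing c ℓ₁} where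

  private
    module R = CommutativeRing R
    module S = CommutativeRing S
    module SP = RingProperties S.ring

  module _ (f : R.Carrier → S.Carrier)
           (f-cong : ∀ {x y} → x R.≈ y → f x S.≈ f y)
           (f-+ : ∀ x y → f (x R.+ y) S.≈ f x S.+ f y)
           (f-* : ∀ x y → f (x R.* y) S.≈ f x S.* f y)
           (f-1 : f R.1# S.≈ S.1#) where

    private
      f-0 : f R.0# S.≈ S.0#
      f-0 = SP.x+x≈x⇒x≈0 _ (S.trans (S.sym (f-+ _ _)) (f-cong (R.+-identityˡ _)))

    -- Zero and negatives come for free: f 0 + f 0 = f 0 can be cancelled, and additive inverses are
    -- unique.
    makeHom : RingHom R S
    makeHom = ringHom f record
      { isSemiringHomomorphism = record
        { isNearSemiringHomomorphism = record
          { +-isMonoidHomomorphism = record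
            { isMagmaHomomorphism = record
              { isRelHomomorphism = record { cong = f-cong } ; homo = f-+ }
            ; ε-homo = f-0 }
          ; *-homo = f-* }
        ; 1#-homo = f-1 }
      ; -‿homo = λ x → SP.+-inverseʳ-unique (f x) (f (R.- x))
          (S.trans (S.sym (f-+ _ _)) (S.trans (f-cong (R.-‿inverseʳ x)) f-0)) }

idRing : (R : CommutativeRing a b) → RingHom R R
idRing R = makeHom (λ x → x) (λ p → p) (λ _ _ → refl) (λ _ _ → refl) refl
  where open CommutativeRing R

infixr 9 _∘R_
_∘R_ : {R : CommutativeRing a b} {S : CommutativeRing c ℓ} {T : CommutativeRing c′ ℓ′} →
       RingHom S T → RingHom R S → RingHom R T
_∘R_ {T = T} G F = makeHom (λ x → G.to (F.to x)) (λ p → G.cong (F.cong p))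
  (λ x y → trans (G.cong (F.+-homo x y)) (G.+-homo _ _))
  (λ x y → trans (G.cong (F.*-homo x y)) (G.*-homo _ _))
  (trans (G.cong F.1#-homo) G.1#-homo)
  where
  open CommutativeRing T
  module F = RingHom F
  module G = RingHom G

iterate : {R : CommutativeRing a b} → RingHom R R → ℕ → RingHom R R
iterate {R = R} f zero    = idRing R
iterate         f (suc n) = f ∘R iterate f n

module _ (R : CommutativeRing a b) where

  open CommutativeRing R
  open RingProperties ring
    using (-‿involutive; -‿+-comm; -0#≈0#; -‿distribˡ-*; -‿distribʳ-*)
  open Mult semiring using (×1-homo-*; ×-homo-+) renaming (_×_ to _·_)
  open CSemigroupProperties +-commutativeSemigroup using (interchange)
  open SetoidReasoning setoid

  integer : ℤ → Carrier
  integer (+ n)    = n · 1#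
  integer -[1+ n ] = - (suc n · 1#)

  private
    integer-⊖ : ∀ m n → integer (m ℤ.⊖ n) ≈ m · 1# - n · 1#
    integer-⊖ zero    zero    = sym (-‿inverseʳ _)
    integer-⊖ (suc m) zero    = sym (trans (+-congˡ -0#≈0#) (+-identityʳ _))
    integer-⊖ zero    (suc n) = sym (+-identityˡ _)
    integer-⊖ (suc m) (suc n) = begin
      integer (suc m ℤ.⊖ suc n)          ≡⟨ ≡.cong integer (ℤₚ.[1+m]⊖[1+n]≡m⊖n m n) ⟩
      integer (m ℤ.⊖ n)                  ≈⟨ integer-⊖ m n ⟩
      m · 1# - n · 1#                    ≈⟨ +-identityˡ _ ⟨
      0# + (m · 1# - n · 1#)             ≈⟨ +-congʳ (-‿inverseʳ 1#) ⟨
      (1# - 1#) + (m · 1# - n · 1#)      ≈⟨ interchange _ _ _ _ ⟩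
      (1# + m · 1#) + (- 1# - n · 1#)    ≈⟨ +-congˡ (-‿+-comm _ _) ⟩
      suc m · 1# - suc n · 1#            ∎

    integer-+ : ∀ x y → integer (x ℤ.+ y) ≈ integer x + integer y
    integer-+ (+ m)    (+ n)    = ×-homo-+ 1# m n
    integer-+ (+ m)    -[1+ n ] = integer-⊖ m (suc n)
    integer-+ -[1+ m ] (+ n)    = trans (integer-⊖ n (suc m)) (+-comm _ _)
    integer-+ -[1+ m ] -[1+ n ] = begin
      - (suc (suc (m ℕ.+ n)) · 1#)          ≡⟨ ≡.cong (λ k → - (suc k · 1#)) (ℕₚ.+-suc m n) ⟨
      - ((suc m ℕ.+ suc n) · 1#)            ≈⟨ -‿cong (×-homo-+ 1# (suc m) (suc n)) ⟩
      - (suc m · 1# + suc n · 1#)           ≈⟨ -‿+-comm _ _ ⟨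
      - (suc m · 1#) - suc n · 1#           ∎

    integer-neg : ∀ x → integer (ℤ.- x) ≈ - integer x
    integer-neg (+ zero)  = sym -0#≈0#
    integer-neg (+ suc n) = refl
    integer-neg -[1+ n ]  = sym (-‿involutive _)

    integer-*+ : ∀ x n → integer (x ℤ.* + n) ≈ integer x * (n · 1#)
    integer-*+ (+ m) n = begin
      integer (+ m ℤ.* + n)   ≡⟨ ≡.cong integer (ℤₚ.pos-* m n) ⟨
      (m ℕ.* n) · 1#          ≈⟨ ×1-homo-* m n ⟩
      m · 1# * n · 1#         ∎
    integer-*+ -[1+ m ] n = begin
      integer (-[1+ m ] ℤ.* + n)            ≡⟨ ≡.cong integer (ℤₚ.neg-distribˡ-* (+ suc m) (+ n)) ⟨
      integer (ℤ.- (+ suc m ℤ.* + n))       ≈⟨ integer-neg (+ suc m ℤ.* + n) ⟩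
      - integer (+ suc m ℤ.* + n)           ≈⟨ -‿cong (integer-*+ (+ suc m) n) ⟩
      - (suc m · 1# * n · 1#)               ≈⟨ -‿distribˡ-* _ _ ⟩
      - (suc m · 1#) * n · 1#               ∎

    integer-* : ∀ x y → integer (x ℤ.* y) ≈ integer x * integer y
    integer-* x (+ n)    = integer-*+ x n
    integer-* x -[1+ n ] = begin
      integer (x ℤ.* -[1+ n ])          ≡⟨ ≡.cong integer (ℤₚ.neg-distribʳ-* x (+ suc n)) ⟨
      integer (ℤ.- (x ℤ.* + suc n))     ≈⟨ integer-neg (x ℤ.* + suc n) ⟩
      - integer (x ℤ.* + suc n)         ≈⟨ -‿cong (integer-*+ x (suc n)) ⟩
      - (integer x * suc n · 1#)        ≈⟨ -‿distribʳ-* _ _ ⟩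
      integer x * - (suc n · 1#)        ∎

  integerHom : RingHom ℤₚ.+-*-commutativeRing R
  integerHom = makeHom integer (λ { ≡.refl → refl }) integer-+ integer-* (+-identityʳ 1#)

  integer-unique : (f : RingHom ℤₚ.+-*-commutativeRing R) → ∀ x → RingHom.to f x ≈ integer x
  integer-unique f = unique
    where
    open RingHom f
    natural : ∀ n → to (+ n) ≈ n · 1#
    natural zero    = 0#-homo
    natural (suc n) = trans (+-homo (+ 1) (+ n)) (+-cong 1#-homo (natural n))
    unique : ∀ x → to x ≈ integer x
    unique (+ n)    = natural n
    unique -[1+ n ] = trans (-‿homo (+ suc n)) (-‿cong (natural (suc n)))

multiple-ℤ : ∀ n → multiple ℤₚ.+-*-commutativeRing n (+ 1) ≡ + n
multiple-ℤ zero    = ≡.refl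
multiple-ℤ (suc n) = ≡.cong ℤ.suc (multiple-ℤ n)

integer-agree : {R : CommutativeRing a b} (f g : RingHom ℤₚ.+-*-commutativeRing R) →
  ∀ x → CommutativeRing._≈_ R (RingHom.to f x) (RingHom.to g x)
integer-agree {R = R} f g x = trans (integer-unique R f x) (sym (integer-unique R g x))
  where open CommutativeRing R

module _ {R : CommutativeRing c ℓ} {G : Set ℓ₂} where
  open Presentation R G

  module _ {S : CommutativeRing a b} where
    private module S = CommutativeRing S

    module _ {φ : ∣ R ∣ → S.Carrier} {ρ : G → S.Carrier} where
      eval-^ : (φ (CommutativeRing.1# R) S.≈ S.1#) → ∀ x n →
               eval S φ ρ (x ⊛^ n) S.≈ eval S φ ρ x ^⟨ S ⟩ n
      eval-^ φ-1 x zero    = φ-1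
      eval-^ φ-1 x (suc n) = S.*-congˡ (eval-^ φ-1 x n)

    module _ {_~_ : Rel Term ℓ₃} (φ : RingHom R S) (ρ : G → S.Carrier) where
      private
        module φ = RingHom φ
        ⟦_⟧ = eval S φ.to ρ

      module _ (respects : ∀ {x y} → x ~ y → ⟦ x ⟧ S.≈ ⟦ y ⟧) where
        private
          sound : ∀ {x y} → _≋_ _~_ x y → ⟦ x ⟧ S.≈ ⟦ y ⟧
          sound (relation p)    = respects p
          sound ≋-refl          = S.refl
          sound (≋-sym p)       = S.sym (sound p)
          sound (≋-trans p q)   = S.trans (sound p) (sound q)
          sound (⊕-cong p q)    = S.+-cong (sound p) (sound q)
          sound (⊛-cong p q)    = S.*-cong (sound p) (sound q)
          sound (⊝-cong p)      = S.-‿cong (sound p)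
          sound (con-cong p)    = φ.cong p
          sound (con-+ x y)     = φ.+-homo x y
          sound (con-* x y)     = φ.*-homo x y
          sound (⊕-assoc x y z) = S.+-assoc _ _ _
          sound (⊕-comm x y)    = S.+-comm _ _
          sound (⊕-identityˡ x) = S.trans (S.+-congʳ φ.0#-homo) (S.+-identityˡ _)
          sound (⊝-inverseˡ x)  = S.trans (S.-‿inverseˡ _) (S.sym φ.0#-homo)
          sound (⊛-assoc x y z) = S.*-assoc _ _ _
          sound (⊛-comm x y)    = S.*-comm _ _
          sound (⊛-identityˡ x) = S.trans (S.*-congʳ φ.1#-homo) (S.*-identityˡ _)
          sound (⊛-distribˡ x y z) = S.distribˡ _ _ _

        evalHom : RingHom (presented _~_) S
        evalHom = makeHom ⟦_⟧ sound (λ _ _ → S.refl) (λ _ _ → S.refl) φ.1#-homo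

    -- Stated for raw terms, with `φ` and `ρ` mere functions. It therefore applies to evaluations
    -- such as `reduce` and `reduceℒ`, which are not known to respect the equality of a quotient.
    eval-natural : ∀ {a′ b′} {S′ : CommutativeRing a′ b′} (f : RingHom S S′) →
                   let open CommutativeRing S′ using (_≈_) in
                   ∀ {φ ρ φ′ ρ′} → (∀ x → RingHom.to f (φ x) ≈ φ′ x) → (∀ x → RingHom.to f (ρ x) ≈ ρ′ x) →
                   ∀ x → RingHom.to f (eval S φ ρ x) ≈ eval S′ φ′ ρ′ x
    eval-natural {S′ = S′} f {φ} {ρ} {φ′} {ρ′} φ≈ ρ≈ = go
      where
      open CommutativeRing S′ using (_≈_; trans; +-cong; *-cong; -‿cong)
      open RingHom f
      go : ∀ x → to (eval S φ ρ x) ≈ eval S′ φ′ ρ′ x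
      go (con x) = φ≈ x
      go (gen x) = ρ≈ x
      go (x ⊕ y) = trans (+-homo _ _) (+-cong (go x) (go y))
      go (x ⊛ y) = trans (*-homo _ _) (*-cong (go x) (go y))
      go (⊝ x)   = trans (-‿homo _) (-‿cong (go x))

    eval-cong : ∀ {φ φ′ : ∣ R ∣ → S.Carrier} {ρ ρ′} →
                (∀ x → φ x S.≈ φ′ x) → (∀ x → ρ x S.≈ ρ′ x) →
                ∀ x → eval S φ ρ x S.≈ eval S φ′ ρ′ x
    eval-cong = eval-natural (idRing S)

  conHom : (_~_ : Rel Term ℓ₃) → RingHom R (presented _~_)
  conHom _~_ = makeHom {S = presented _~_} con con-cong con-+ con-* ≋-refl

  ⊛^≡^ : (_~_ : Rel Term ℓ₃) → ∀ x n → x ⊛^ n ≡ x ^⟨ presented _~_ ⟩ n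
  ⊛^≡^ _~_ x zero    = ≡.refl
  ⊛^≡^ _~_ x (suc n) = ≡.cong (x ⊛_) (⊛^≡^ _~_ x n)

module _ (R : CommutativeRing a b) where
  open CommutativeRing R
  private
    module P = RingProperties ring

  x+y-y≈x : ∀ x y → (x + y) - y ≈ x
  x+y-y≈x x y = trans (+-assoc _ _ _) (trans (+-congˡ (-‿inverseʳ y)) (+-identityʳ x))

  y+x-y≈x : ∀ x y → (y + x) - y ≈ x
  y+x-y≈x x y = trans (+-congʳ (+-comm y x)) (x+y-y≈x x y)

  y+[x-y]≈x : ∀ x y → y + (x - y) ≈ x
  y+[x-y]≈x x y = trans (sym (+-assoc _ _ _)) (y+x-y≈x x y)

module _ {R : CommutativeRing a b} {s} {I : ∣ R ∣ → Set s} where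
  private module R = CommutativeRing R
  open Quotient R I

  quotientHom : RingHom R quotient
  quotientHom = makeHom {S = quotient} (λ x → x) ≈⇒≈/ (λ _ _ → Q.refl) (λ _ _ → Q.refl) Q.refl
    where module Q = CommutativeRing quotient

  ideal⇒≈/0 : ∀ {x} → Ideal x → x ≈/ R.0#
  ideal⇒≈/0 = resp∈ (R.sym (R.trans (R.+-congˡ -0#≈0#) (R.+-identityʳ _)))
    where open RingProperties R.ring using (-0#≈0#)

  factorHom : {S : CommutativeRing c ℓ₁} (f : RingHom R S) →
              let open CommutativeRing S in
              (∀ {x} → I x → RingHom.to f x ≈ 0#) → RingHom quotient S
  factorHom {S = S} f kills = makeHom {R = quotient} to sound +-homo *-homo 1#-homo
    where
    open RingHom f
    module S = CommutativeRing S
    kills-ideal : ∀ {x} → Ideal x → to x S.≈ S.0#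
    kills-ideal (generator i)   = kills i
    kills-ideal zero∈           = 0#-homo
    kills-ideal (sum∈ i j)      = S.trans (+-homo _ _)
      (S.trans (S.+-cong (kills-ideal i) (kills-ideal j)) (S.+-identityˡ _))
    kills-ideal (multiple∈ r i) = S.trans (*-homo _ _)
      (S.trans (S.*-congˡ (kills-ideal i)) (S.zeroʳ _))
    kills-ideal (resp∈ p i)     = S.trans (cong (R.sym p)) (kills-ideal i)
    sound : ∀ {x y} → x ≈/ y → to x S.≈ to y
    sound i = RingProperties.x∙y⁻¹≈ε⇒x≈y S.ring _ _
      (S.trans (S.+-congˡ (S.sym (-‿homo _))) (S.trans (S.sym (+-homo _ _)) (kills-ideal i)))

module Principal (R : CommutativeRing a b) (d : ∣ R ∣) where
  open CommutativeRing R
  open SetoidReasoning setoid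
  open Quotient R (_≈_ d) public using (_≈/_; Ideal; generator; zero∈; sum∈; multiple∈; resp∈)

  multiple-of : ∀ {x} → Ideal x → ∃ λ z → x ≈ z * d
  multiple-of (generator p)   = 1# , trans (sym p) (sym (*-identityˡ d))
  multiple-of zero∈           = 0# , sym (zeroˡ d)
  multiple-of (sum∈ i j)      = let u , p = multiple-of i ; v , q = multiple-of j in
    u + v , trans (+-cong p q) (sym (distribʳ d u v))
  multiple-of (multiple∈ r i) = let u , p = multiple-of i in
    r * u , trans (*-congˡ p) (sym (*-assoc r u d))
  multiple-of (resp∈ p i)     = let u , q = multiple-of i in u , trans (sym p) q

  ≈/⇒difference : ∀ {x y} → x ≈/ y → ∃ λ z → x ≈ y + z * d
  ≈/⇒difference {x} {y} i = let z , p = multiple-of i in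
    z , trans (sym (y+[x-y]≈x R x y)) (+-congˡ p)

  difference⇒≈/ : ∀ {x y} z → x ≈ y + z * d → x ≈/ y
  difference⇒≈/ {x} {y} z p = resp∈ (sym (begin
    x - y            ≈⟨ +-congʳ p ⟩
    (y + z * d) - y  ≈⟨ y+x-y≈x R _ y ⟩
    z * d            ∎)) (multiple∈ z (generator refl))

module _ (R : CommutativeRing a b) (d e : ∣ R ∣) where
  open CommutativeRing R
  open Quotient R (λ x → d ≈ x ⊎ e ≈ x)
  open CSemigroupProperties +-commutativeSemigroup using (interchange)

  -- Turns inductive membership in the ideal into one explicit pair of coefficients, so that an
  -- equation in a truncated ring can be examined coefficient by coefficient.
  combination-of : ∀ {x} → Ideal x → ∃ λ u → ∃ λ v → x ≈ u * d + v * e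
  combination-of (generator (inj₁ p)) = 1# , 0# ,
    trans (sym p) (sym (trans (+-cong (*-identityˡ d) (zeroˡ e)) (+-identityʳ d)))
  combination-of (generator (inj₂ p)) = 0# , 1# ,
    trans (sym p) (sym (trans (+-cong (zeroˡ d) (*-identityˡ e)) (+-identityˡ e)))
  combination-of zero∈ = 0# , 0# ,
    sym (trans (+-cong (zeroˡ d) (zeroˡ e)) (+-identityˡ 0#))
  combination-of (sum∈ i j) =
    let u , v , p = combination-of i ; u′ , v′ , q = combination-of j in
    u + u′ , v + v′ , trans (+-cong p q)
      (trans (interchange _ _ _ _) (sym (+-cong (distribʳ d u u′) (distribʳ e v v′))))
  combination-of (multiple∈ r i) = let u , v , p = combination-of i in
    r * u , r * v , trans (*-congˡ p)
      (trans (distribˡ _ _ _) (sym (+-cong (*-assoc r u d) (*-assoc r v e))))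
  combination-of (resp∈ p i) = let u , v , q = combination-of i in u , v , trans (sym p) q

-- Binomial coefficients and the Frobenius map

prime>0 : ∀ {p} → Prime p → 0 ℕ.< p
prime>0 {p} prime-p = ℕ.>-nonZero⁻¹ p ⦃ prime⇒nonZero prime-p ⦄

prime^n>0 : ∀ {p} → Prime p → ∀ n → 0 ℕ.< p ℕ.^ n
prime^n>0 {p} prime-p n = ℕₚ.m^n>0 p ⦃ prime⇒nonZero prime-p ⦄ n

private
  -- Induction by Pascal's rule. The identity shows that n + 1 divides (k + 1) C(n + 1, k + 1).
  absorption : ∀ n k → suc k ℕ.* (suc n C suc k) ≡ suc n ℕ.* (n C k)
  absorption zero    zero    = ≡.refl
  absorption zero    (suc k) = begin
    suc (suc k) ℕ.* (1 C suc (suc k))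
      ≡⟨ ≡.cong (suc (suc k) ℕ.*_) (k>n⇒nCk≡0 {1} {suc (suc k)} (s≤s (s≤s z≤n))) ⟩
    suc (suc k) ℕ.* 0               ≡⟨ ℕₚ.*-zeroʳ (suc (suc k)) ⟩
    0                               ≡⟨ ≡.cong (ℕ._+ 0) (k>n⇒nCk≡0 {0} {suc k} (s≤s z≤n)) ⟨
    1 ℕ.* (0 C suc k)               ∎
    where open ≡.≡-Reasoning
  absorption (suc n) zero    = begin
    1 ℕ.* (suc (suc n) C 1)         ≡⟨ ℕₚ.*-identityˡ _ ⟩
    suc (suc n) C 1                 ≡⟨ nC1≡n (suc (suc n)) ⟩
    suc (suc n)                     ≡⟨ ℕₚ.*-identityʳ _ ⟨
    suc (suc n) ℕ.* 1               ∎
    where open ≡.≡-Reasoning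
  absorption (suc n) (suc k) = begin
    suc (suc k) ℕ.* (suc (suc n) C suc (suc k))
      ≡⟨ ≡.cong (suc (suc k) ℕ.*_) (nCk+nC[k+1]≡[n+1]C[k+1] (suc n) (suc k)) ⟨
    suc (suc k) ℕ.* (x ℕ.+ y)
      ≡⟨ ℕₚ.*-distribˡ-+ (suc (suc k)) x y ⟩
    (x ℕ.+ suc k ℕ.* x) ℕ.+ suc (suc k) ℕ.* y
      ≡⟨ ≡.cong₂ (λ u v → (x ℕ.+ u) ℕ.+ v) (absorption n k) (absorption n (suc k)) ⟩
    (x ℕ.+ suc n ℕ.* (n C k)) ℕ.+ suc n ℕ.* (n C suc k)
      ≡⟨ ℕₚ.+-assoc x _ _ ⟩
    x ℕ.+ (suc n ℕ.* (n C k) ℕ.+ suc n ℕ.* (n C suc k))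
      ≡⟨ ≡.cong (x ℕ.+_) (ℕₚ.*-distribˡ-+ (suc n) (n C k) (n C suc k)) ⟨
    x ℕ.+ suc n ℕ.* ((n C k) ℕ.+ (n C suc k))
      ≡⟨ ≡.cong (λ u → x ℕ.+ suc n ℕ.* u) (nCk+nC[k+1]≡[n+1]C[k+1] n k) ⟩
    suc (suc n) ℕ.* (suc n C suc k) ∎
    where
    open ≡.≡-Reasoning
    x = suc n C suc k
    y = suc n C suc (suc k)

-- By `absorption` p divides k C(p, k), and it does not divide k because 0 < k < p; Euclid's lemma
-- leaves the binomial coefficient.
prime∣binomial : ∀ {p} → Prime p → ∀ k → 0 ℕ.< k → k ℕ.< p → p ∣ p C k
prime∣binomial {suc n} pp (suc k) _ k<p
  with euclidsLemma (suc k) (suc n C suc k) pp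
         (≡.subst (suc n ∣_) (≡.sym (absorption n k)) (m∣m*n (n C k)))
... | inj₁ p∣k = ⊥-elim (ℕₚ.<⇒≱ k<p (∣⇒≤ p∣k))
... | inj₂ p∣C = p∣C

module Frobenius {p : ℕ} (prime-p : Prime p) (R : CommutativeRing a b) where
  open CommutativeRing R
  open SetoidReasoning setoid
  open Exp commutativeSemiring
  open Mult semiring using (×-assoc-*; ×-homo-1; ×1-homo-*) renaming (_×_ to _·_)
  open Sum semiring using (sum; sum-init-last)

  private
    p# = multiple R p 1#

    sum-multiple : ∀ {n} z (t : Fin n → Carrier) → (∀ i → ∃ λ u → t i ≈ z * u) →
                   ∃ λ u → sum t ≈ z * u
    sum-multiple {zero}  z t h = 0# , sym (zeroʳ z)
    sum-multiple {suc n} z t h =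
      let u , p = h Fin.zero ; v , q = sum-multiple z (λ i → t (Fin.suc i)) (λ i → h (Fin.suc i)) in
      u + v , trans (+-cong p q) (sym (distribˡ z u v))

    -- The two extreme terms of the binomial theorem are split off; each middle term contains p and
    -- at least one factor y. The factor y is kept because `p-power-close` takes for y a multiple of
    -- a power of π, to which p contributes one more π.
    binomial-^ : ∀ {n} x y → Prime (suc (suc n)) →
      ∃ λ u → (x + y) ^ suc (suc n) ≈
        (x ^ suc (suc n) + y ^ suc (suc n)) + (suc (suc n) · 1# * y) * u
    binomial-^ {n} x y prime′ = u , (begin
      (x + y) ^ N             ≈⟨ Binomial.theorem commutativeSemiring N x y ⟩
      sum t                   ≡⟨⟩
      t Fin.zero + sum t′     ≈⟨ +-congˡ (sum-init-last t′) ⟩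
      t Fin.zero + (sum (λ i → t′ (inject₁ i)) + t′ (fromℕ (suc n)))
                              ≈⟨ +-cong first (+-cong u≈ last) ⟩
      y ^ N + (z * u + x ^ N) ≈⟨ +-comm _ _ ⟩
      (z * u + x ^ N) + y ^ N ≈⟨ +-assoc _ _ _ ⟩
      z * u + (x ^ N + y ^ N) ≈⟨ +-comm _ _ ⟩
      (x ^ N + y ^ N) + z * u ∎)
      where
      N = suc (suc n)
      z = N · 1# * y
      t : Fin (suc N) → Carrier
      t k = (N C toℕ k) · (x ^ toℕ k * y ^ (N ℕ.∸ toℕ k))
      t′ : Fin N → Carrier
      t′ i = t (Fin.suc i)

      first : t Fin.zero ≈ y ^ N
      first = trans (×-homo-1 _) (*-identityˡ _)

      last : t′ (fromℕ (suc n)) ≈ x ^ N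
      last = begin
        t′ (fromℕ (suc n))
          ≡⟨ ≡.cong (λ k → (N C suc k) · (x ^ suc k * y ^ (suc n ℕ.∸ k))) (Finₚ.toℕ-fromℕ (suc n)) ⟩
        (N C N) · (x ^ N * y ^ (n ℕ.∸ n))
          ≡⟨ ≡.cong₂ (λ i j → i · (x ^ N * y ^ j)) (nCn≡1 N) (ℕₚ.n∸n≡0 n) ⟩
        1 · (x ^ N * 1#)                  ≈⟨ ×-homo-1 _ ⟩
        x ^ N * 1#                        ≈⟨ *-identityʳ _ ⟩
        x ^ N                             ∎

      middle : ∀ i → ∃ λ v → t′ (inject₁ i) ≈ z * v
      middle i
        rewrite Finₚ.toℕ-inject₁ i
        with divides m eq ← prime∣binomial prime′ (suc (toℕ i)) (s≤s z≤n) (s≤s (Finₚ.toℕ<n i))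
           | m′ , eq′ ← ℕₚ.m≤n⇒∃[o]m+o≡n (Finₚ.toℕ<n i)
        = (m · 1#) * (x ^ suc (toℕ i) * y ^ m′) , (begin
        (N C suc (toℕ i)) · (x ^ suc (toℕ i) * y ^ (suc n ℕ.∸ toℕ i))
          ≡⟨ ≡.cong₂ (λ j k → j · (x ^ suc (toℕ i) * y ^ k)) eq exponent ⟩
        (m ℕ.* N) · (X * (y * Y))           ≈⟨ ×-congˡ′ (m ℕ.* N) (X * (y * Y)) ⟨
        (m ℕ.* N) · 1# * (X * (y * Y))      ≈⟨ *-congʳ (×1-homo-* m N) ⟩
        (m · 1# * N · 1#) * (X * (y * Y))   ≈⟨ rearrange (m · 1#) (N · 1#) X y Y ⟩
        (N · 1# * y) * (m · 1# * (X * Y))   ∎)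
        where
        X = x ^ suc (toℕ i)
        Y = y ^ m′
        -- In a middle term the exponent of y is positive, which releases the factor y of `z`.
        exponent : suc n ℕ.∸ toℕ i ≡ suc m′
        exponent = ≡.trans
          (≡.cong (ℕ._∸ toℕ i) (≡.trans (≡.sym eq′) (≡.sym (ℕₚ.+-suc (toℕ i) m′))))
          (ℕₚ.m+n∸m≡n (toℕ i) (suc m′))
        ×-congˡ′ : ∀ k v → k · 1# * v ≈ k · v
        ×-congˡ′ k v = trans (×-assoc-* k 1# v) (Mult.×-congʳ semiring k (*-identityˡ v))
        rearrange : ∀ m n X y Y → (m * n) * (X * (y * Y)) ≈ (n * y) * (m * (X * Y))
        rearrange = solve 5 (λ m n X y Y → (m :* n) :* (X :* (y :* Y)) := (n :* y) :* (m :* (X :* Y))) refl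
          where open import Algebra.Solver.Ring.NaturalCoefficients.Default commutativeSemiring

      u  = proj₁ (sum-multiple z _ middle)
      u≈ = proj₂ (sum-multiple z _ middle)

    frobenius : ∀ {q} → Prime q → ∀ x y →
      ∃ λ u → (x + y) ^ q ≈ (x ^ q + y ^ q) + (multiple R q 1# * y) * u
    frobenius {0}           prime-q = ⊥-elim (¬prime[0] prime-q)
    frobenius {1}           prime-q = ⊥-elim (¬prime[1] prime-q)
    frobenius {suc (suc _)} prime-q x y = binomial-^ x y prime-q

    -- A prime is at least 2. Two factors of x suffice in `p-power-close`, where x is a multiple of
    -- π^(k+1) and 2k + 2 ≥ k + 2.
    square-factor : ∀ {q} → Prime q → ∀ x → ∃ λ u → x ^ q ≈ x * (x * u)
    square-factor {0}           prime-q = ⊥-elim (¬prime[0] prime-q)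
    square-factor {1}           prime-q = ⊥-elim (¬prime[1] prime-q)
    square-factor {suc (suc n)} prime-q x = x ^ n , refl

  frobeniusHom : p# ≈ 0# → RingHom R R
  frobeniusHom p≈0 = makeHom (_^ p) (^-congˡ p) additive (λ x y → ^-distrib-* x y p) (1^n≈1 p)
    where
    additive : ∀ x y → (x + y) ^ p ≈ x ^ p + y ^ p
    additive x y = let u , eq = frobenius prime-p x y in begin
      (x + y) ^ p                        ≈⟨ eq ⟩
      (x ^ p + y ^ p) + (p# * y) * u     ≈⟨ +-congˡ (*-congʳ (*-congʳ p≈0)) ⟩
      (x ^ p + y ^ p) + (0# * y) * u     ≈⟨ +-congˡ (trans (*-congʳ (zeroˡ y)) (zeroˡ u)) ⟩
      (x ^ p + y ^ p) + 0#               ≈⟨ +-identityʳ _ ⟩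
      x ^ p + y ^ p                      ∎
    1^n≈1 : ∀ n → 1# ^ n ≈ 1#
    1^n≈1 zero    = refl
    1^n≈1 (suc n) = trans (*-identityˡ _) (1^n≈1 n)

  module _ {π s : Carrier} (p≈πs : p# ≈ π * s) where
    open import Algebra.Solver.Ring.NaturalCoefficients.Default commutativeSemiring
      using (solve; _:=_; _:+_; _:*_)

    private
      -- With d = π^(k+1) c, the difference of (y + d)^p and y^p consists of d^p, which contains d²,
      -- and of a multiple of p d, which gains a π from p = π s.
      p-power-close : ∀ k {x y} c → x ≈ y + π ^ suc k * c → ∃ λ c′ → x ^ p ≈ y ^ p + π ^ suc (suc k) * c′
      p-power-close k {x} {y} c eq =
        let d = π ^ suc k * c
            u , eq₁ = frobenius prime-p y d
            v , eq₂ = square-factor prime-p d in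
        c * (π ^ k * (c * v)) + s * c * u , (begin
          x ^ p                                     ≈⟨ ^-congˡ p eq ⟩
          (y + d) ^ p                               ≈⟨ eq₁ ⟩
          (y ^ p + d ^ p) + (p# * d) * u            ≈⟨ +-cong (+-congˡ eq₂) (*-congʳ (*-congʳ p≈πs)) ⟩
          (y ^ p + d * (d * v)) + ((π * s) * d) * u ≈⟨ rearrange (y ^ p) π (π ^ k) c v s u ⟩
          y ^ p + π ^ suc (suc k) * (c * (π ^ k * (c * v)) + s * c * u) ∎)
        where
        rearrange : ∀ Y π K c v s u →
          (Y + (π * K * c) * ((π * K * c) * v)) + ((π * s) * (π * K * c)) * u
            ≈ Y + (π * (π * K)) * (c * (K * (c * v)) + s * c * u)
        rearrange = solve 7 (λ Y π K c v s u →
          (Y :+ (π :* K :* c) :* ((π :* K :* c) :* v)) :+ ((π :* s) :* (π :* K :* c)) :* u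
            := Y :+ (π :* (π :* K)) :* (c :* (K :* (c :* v)) :+ s :* c :* u)) refl

    -- Each p-th power improves a congruence by one power of π. This is what makes Teichmüller lifts
    -- independent of the chosen representatives.
    pⁿ-power-close : ∀ n {x y} c → x ≈ y + π * c →
                     ∃ λ c′ → x ^ (p ℕ.^ n) ≈ y ^ (p ℕ.^ n) + π ^ suc n * c′
    pⁿ-power-close zero {x} {y} c eq = c , (begin
      x * 1#                ≈⟨ *-identityʳ x ⟩
      x                     ≈⟨ eq ⟩
      y + π * c             ≈⟨ +-cong (*-identityʳ y) (*-congʳ (*-identityʳ π)) ⟨
      y * 1# + (π * 1#) * c ∎)
    pⁿ-power-close (suc n) {x} {y} c eq =
      let c′ , eq′ = pⁿ-power-close n c eq
          c″ , eq″ = p-power-close n c′ eq′ in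
      c″ , trans (step x) (trans eq″ (+-congʳ (sym (step y))))
      where
      step : ∀ z → z ^ (p ℕ.^ suc n) ≈ (z ^ (p ℕ.^ n)) ^ p
      step z = trans (reflexive (≡.cong (z ^_) (ℕₚ.*-comm p (p ℕ.^ n)))) (sym (^-assocʳ z (p ℕ.^ n) p))

-- Polynomial rings with a lift of Frobenius

module SeriesFacts (R : CommutativeRing c ℓ) where
  open CommutativeRing R
  open PowerSeries R public using (Series; constant; variable-π; powerSeries; _⋆_)
  private module S = CommutativeRing powerSeries
  open Mult semiring using () renaming (_×_ to _·_)

  tail : Series → Series
  tail f n = f (suc n)

  constantHom : RingHom R powerSeries
  constantHom = makeHom {S = powerSeries} constant
    (λ { p zero → p ; p (suc _) → refl })
    (λ { _ _ zero → refl ; _ _ (suc _) → sym (+-identityˡ 0#) })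
    (λ { _ _ zero → refl ; x y (suc n) → sym (constant-*ᵣ x y n) })
    S.refl
    where
    constant-*ᵣ : ∀ x y n → (constant x ⋆ constant y) (suc n) ≈ 0#
    constant-*ᵣ x y n = trans (+-cong (zeroʳ x) (S.zeroˡ (constant y) n)) (+-identityˡ 0#)

  ⋆-constant : ∀ f x n → (f ⋆ constant x) n ≈ f n * x
  ⋆-constant f x zero    = refl
  ⋆-constant f x (suc n) = trans (+-cong (zeroʳ _) (⋆-constant (tail f) x n)) (+-identityˡ _)

  π⋆-zero : ∀ f → (variable-π ⋆ f) 0 ≈ 0#
  π⋆-zero f = zeroˡ _

  π⋆-suc : ∀ f n → (variable-π ⋆ f) (suc n) ≈ f n
  π⋆-suc f n = trans (+-cong (zeroˡ _) (S.*-congʳ {f} tail-π n))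
    (trans (+-identityˡ _) (S.*-identityˡ f n))
    where
    tail-π : tail variable-π S.≈ S.1#
    tail-π zero    = refl
    tail-π (suc n) = refl

  πⁿ⋆-drop : ∀ n f i → (variable-π ^⟨ powerSeries ⟩ n ⋆ f) (n ℕ.+ i) ≈ f i
  πⁿ⋆-drop zero    f i = S.*-identityˡ f i
  πⁿ⋆-drop (suc n) f i = trans (S.*-assoc variable-π _ f (suc n ℕ.+ i))
    (trans (π⋆-suc (variable-π ^⟨ powerSeries ⟩ n ⋆ f) (n ℕ.+ i)) (πⁿ⋆-drop n f i))

  πⁿ⋆-low : ∀ n f i → i ℕ.< n → (variable-π ^⟨ powerSeries ⟩ n ⋆ f) i ≈ 0#
  πⁿ⋆-low (suc n) f zero    _       = trans (*-congʳ (zeroˡ _)) (zeroˡ _)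
  πⁿ⋆-low (suc n) f (suc i) (s≤s p) = trans (S.*-assoc variable-π _ f (suc i))
    (trans (π⋆-suc (variable-π ^⟨ powerSeries ⟩ n ⋆ f) i) (πⁿ⋆-low n f i p))

  head-tail : ∀ f → f S.≈ constant (f 0) S.+ variable-π ⋆ tail f
  head-tail f zero    = sym (trans (+-congˡ (π⋆-zero (tail f))) (+-identityʳ _))
  head-tail f (suc n) = sym (trans (+-congˡ (π⋆-suc (tail f) n)) (+-identityˡ _))

  module Horner {S : CommutativeRing a b} (g : RingHom R S) (v : ∣ S ∣) where
    private
      module g = RingHom g
      module T = CommutativeRing S
    open CommutativeRing S using () renaming (_+_ to _+′_; _*_ to _*′_; _≈_ to _≈′_)
    open import Algebra.Solver.Ring.NaturalCoefficients.Default T.commutativeSemiring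
      using (solve; _:=_; _:+_; _:*_)

    -- The truncated value Σ_{i<n} g(fᵢ) vⁱ. Recursion on the tail matches the recursion in the
    -- Cauchy product `_⋆_`.
    horner : ℕ → Series → T.Carrier
    horner zero    f = T.0#
    horner (suc n) f = g.to (f 0) +′ v *′ horner n (tail f)

    horner-cong : ∀ n {f h} → f S.≈ h → horner n f ≈′ horner n h
    horner-cong zero    p = T.refl
    horner-cong (suc n) p = T.+-cong (g.cong (p 0)) (T.*-congˡ (horner-cong n (λ i → p (suc i))))

    horner-+ : ∀ n f h → horner n (f S.+ h) ≈′ horner n f +′ horner n h
    horner-+ zero    f h = T.sym (T.+-identityˡ _)
    horner-+ (suc n) f h = T.trans
      (T.+-cong (g.+-homo _ _) (T.*-congˡ (horner-+ n (tail f) (tail h))))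
      (rearrange _ _ _ _ _)
      where
      rearrange : ∀ x y v X Y → (x +′ y) +′ v *′ (X +′ Y) ≈′ (x +′ v *′ X) +′ (y +′ v *′ Y)
      rearrange = solve 5 (λ x y v X Y →
        (x :+ y) :+ v :* (X :+ Y) := (x :+ v :* X) :+ (y :+ v :* Y)) T.refl

    horner-scale : ∀ n x f → horner n (λ i → x * f i) ≈′ g.to x *′ horner n f
    horner-scale zero    x f = T.sym (T.zeroʳ _)
    horner-scale (suc n) x f = T.trans
      (T.+-cong (g.*-homo _ _) (T.*-congˡ (horner-scale n x (tail f))))
      (rearrange _ _ _ _)
      where
      rearrange : ∀ x y v X → x *′ y +′ v *′ (x *′ X) ≈′ x *′ (y +′ v *′ X)
      rearrange = solve 4 (λ x y v X → x :* y :+ v :* (x :* X) := x :* (y :+ v :* X)) T.refl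

    -- The step of multiplicativity: x and y are the constant coefficients, F and H the values of
    -- the tails, and the left side is what unfolding `_⋆_` once produces.
    horner-product : ∀ x y v H F → x *′ y +′ v *′ (x *′ H +′ F *′ (y +′ v *′ H))
                                 ≈′ (x +′ v *′ F) *′ (y +′ v *′ H)
    horner-product = solve 5 (λ x y v H F →
      x :* y :+ v :* (x :* H :+ F :* (y :+ v :* H)) := (x :+ v :* F) :* (y :+ v :* H)) T.refl

    horner-0 : ∀ n {f} → f S.≈ S.0# → horner n f ≈′ T.0#
    horner-0 zero    p = T.refl
    horner-0 (suc n) p = T.trans
      (T.+-cong (T.trans (g.cong (p 0)) g.0#-homo)
                (T.trans (T.*-congˡ (horner-0 n (λ i → p (suc i)))) (T.zeroʳ v)))
      (T.+-identityˡ _)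

module _ {R : CommutativeRing c ℓ} {a b a′ b′} {S : CommutativeRing a b} {S′ : CommutativeRing a′ b′}
         (F : RingHom S S′) (g : RingHom R S) (v : ∣ S ∣) (g′ : RingHom R S′) (v′ : ∣ S′ ∣) where
  private
    module F = RingHom F
    open CommutativeRing S′
    open SeriesFacts R

  horner-natural : (∀ x → F.to (RingHom.to g x) ≈ RingHom.to g′ x) → F.to v ≈ v′ →
                   ∀ n f → F.to (Horner.horner g v n f) ≈ Horner.horner g′ v′ n f
  horner-natural g≈ v≈ zero    f = F.0#-homo
  horner-natural g≈ v≈ (suc n) f = trans (F.+-homo _ _) (+-cong (g≈ (f 0))
    (trans (F.*-homo _ _) (*-cong v≈ (horner-natural g≈ v≈ n (tail f)))))

module Polynomial (R : CommutativeRing c ℓ) where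
  open CommutativeRing R
  open SeriesFacts R
  private module S = CommutativeRing powerSeries

  Bounded : ℕ → Series → Set ℓ
  Bounded d f = ∀ i → d ℕ.≤ i → f i ≈ 0#

  private
    +-bounded : ∀ {d e f h} → Bounded d f → Bounded e h → Bounded (d ℕ.+ e) (f S.+ h)
    +-bounded {d} {e} p q i d+e≤i = trans
      (+-cong (p i (ℕₚ.m+n≤o⇒m≤o d d+e≤i)) (q i (ℕₚ.m+n≤o⇒n≤o d d+e≤i)))
      (+-identityˡ 0#)

    ⋆-bounded : ∀ d {e f h} → Bounded d f → Bounded e h → Bounded (d ℕ.+ e) (f ⋆ h)
    ⋆-bounded zero    {h = h} p q i _ = trans (S.*-congʳ {h} (λ j → p j z≤n) i) (S.zeroˡ h i)
    ⋆-bounded (suc d) p q (suc i) (s≤s d+e≤i) = trans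
      (+-cong (trans (*-congˡ (q (suc i) (ℕₚ.m≤n⇒m≤1+n (ℕₚ.m+n≤o⇒n≤o d d+e≤i)))) (zeroʳ _))
              (⋆-bounded d (λ j d≤j → p (suc j) (s≤s d≤j)) q i d+e≤i))
      (+-identityˡ 0#)

  -- Polynomials as power series with a degree bound, not necessarily sharp and ignored by equality.
  -- Unlike the presented ring `Polynomials`, this model gives access to coefficients, on which
  -- torsion and divisibility by p can be tested.
  record Poly : Set (c ⊔ ℓ) where
    constructor poly
    field
      coefficient : Series
      bound       : ℕ
      bounded     : Bounded bound coefficient
  open Poly public

  polynomials : CommutativeRing (c ⊔ ℓ) ℓ
  polynomials = record
    { Carrier = Poly
    ; _≈_     = λ f h → coefficient f S.≈ coefficient h
    ; _+_     = λ f h → poly _ _ (+-bounded (bounded f) (bounded h))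
    ; _*_     = λ f h → poly _ _ (⋆-bounded (bound f) (bounded f) (bounded h))
    ; -_      = λ f → poly (S.- coefficient f) (bound f)
        (λ i p → trans (-‿cong (bounded f i p)) -0#≈0#)
    ; 0#      = poly S.0# 0 (λ _ _ → refl)
    ; 1#      = poly S.1# 1 (λ { (suc i) _ → refl })
    ; isCommutativeRing = IsCommutativeRingˡ.isCommutativeRing record
      { isEquivalence = record
        { refl = λ _ → refl ; sym = λ p i → sym (p i) ; trans = λ p q i → trans (p i) (q i) }
      ; +-cong      = S.+-cong
      ; *-cong      = S.*-cong
      ; -‿cong      = S.-‿cong
      ; +-assoc     = λ f g h → S.+-assoc (coefficient f) (coefficient g) (coefficient h)
      ; +-comm      = λ f g → S.+-comm (coefficient f) (coefficient g)
      ; +-identityˡ = λ f → S.+-identityˡ (coefficient f)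
      ; -‿inverseˡ  = λ f → S.-‿inverseˡ (coefficient f)
      ; *-assoc     = λ f g h → S.*-assoc (coefficient f) (coefficient g) (coefficient h)
      ; *-comm      = λ f g → S.*-comm (coefficient f) (coefficient g)
      ; *-identityˡ = λ f → S.*-identityˡ (coefficient f)
      ; distribˡ    = λ f g h → S.distribˡ (coefficient f) (coefficient g) (coefficient h)
      }
    }
    where open RingProperties ring using (-0#≈0#)

  private module P = CommutativeRing polynomials

  constantₚ : RingHom R polynomials
  constantₚ = makeHom {S = polynomials} (λ x → poly (constant x) 1 (λ { (suc i) _ → refl }))
    C.cong C.+-homo C.*-homo C.1#-homo
    where module C = RingHom constantHom

  coefficientHom : RingHom polynomials powerSeries
  coefficientHom = makeHom {R = polynomials} {S = powerSeries} coefficient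
    (λ p → p) (λ _ _ → S.refl) (λ _ _ → S.refl) S.refl

  X : Poly
  X = poly variable-π 2 (λ { (suc (suc i)) _ → refl ; (suc zero) (s≤s ()) })

  tailₚ : ∀ {d f} → Bounded (suc d) f → Poly
  tailₚ {d} {f} p = poly (tail f) d (λ i d≤i → p (suc i) (s≤s d≤i))

  head-tailₚ : ∀ {d f} (p : Bounded (suc d) f) →
    poly f (suc d) p P.≈ RingHom.to constantₚ (f 0) P.+ X P.* tailₚ p
  head-tailₚ {f = f} _ = head-tail f

  module Evaluation {S : CommutativeRing a b} (g : RingHom R S) (v : ∣ S ∣) where
    open Horner g v public
    private
      module g = RingHom g
      module T = CommutativeRing S
    open CommutativeRing S using () renaming (_+_ to _+′_; _*_ to _*′_; _≈_ to _≈′_)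
    open SetoidReasoning T.setoid

    -- Terms past a bound contribute zero, so the value does not depend on the bound; `polyHom`
    -- needs this because equal polynomials may carry different bounds.
    horner-bound : ∀ d e {f h} → f S.≈ h → Bounded d f → Bounded e h → horner d f ≈′ horner e h
    horner-bound zero    e       f≈h p q = T.sym (horner-0 e (λ i → trans (sym (f≈h i)) (p i z≤n)))
    horner-bound (suc d) zero    f≈h p q = horner-0 (suc d) (λ i → trans (f≈h i) (q i z≤n))
    horner-bound (suc d) (suc e) f≈h p q = T.+-cong (g.cong (f≈h 0)) (T.*-congˡ
      (horner-bound d e (λ i → f≈h (suc i)) (λ i d≤i → p (suc i) (s≤s d≤i)) (λ i e≤i → q (suc i) (s≤s e≤i))))

    private
      weaken : ∀ {d e f} → d ℕ.≤ e → Bounded d f → Bounded e f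
      weaken d≤e p i e≤i = p i (ℕₚ.≤-trans d≤e e≤i)

      horner-⋆ : ∀ d {e f h} → Bounded d f → Bounded e h →
                 horner (d ℕ.+ e) (f ⋆ h) ≈′ horner d f *′ horner e h
      horner-⋆ zero {e} {f} {h} p q = T.trans
        (horner-0 e (λ i → trans (S.*-congʳ {h} (λ j → p j z≤n) i) (S.zeroˡ h i)))
        (T.sym (T.zeroˡ _))
      horner-⋆ (suc d) {e} {f} {h} p q = begin
        g.to (f 0 * h 0) +′ v *′ horner (d ℕ.+ e) (λ i → f 0 * h (suc i) + (tail f ⋆ h) i)
          ≈⟨ T.+-cong (g.*-homo _ _) (T.*-congˡ (T.trans (horner-+ (d ℕ.+ e) (λ i → f 0 * h (suc i)) (tail f ⋆ h))
               (T.+-cong (horner-scale (d ℕ.+ e) (f 0) (tail h))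
                         (horner-⋆ d (λ i d≤i → p (suc i) (s≤s d≤i)) q)))) ⟩
        x *′ y +′ v *′ (x *′ H +′ F *′ horner e h)
          ≈⟨ T.+-congˡ (T.*-congˡ (T.+-congˡ (T.*-congˡ split))) ⟩
        x *′ y +′ v *′ (x *′ H +′ F *′ (y +′ v *′ H))
          ≈⟨ horner-product x y v H F ⟩
        (x +′ v *′ F) *′ (y +′ v *′ H)
          ≈⟨ T.*-congˡ split ⟨
        (x +′ v *′ F) *′ horner e h ∎
        where
        x = g.to (f 0)
        y = g.to (h 0)
        H = horner (d ℕ.+ e) (tail h)
        F = horner d (tail f)
        split : horner e h ≈′ y +′ v *′ H
        split = horner-bound e (suc (d ℕ.+ e)) S.refl q (weaken (ℕₚ.m≤n⇒m≤1+n (ℕₚ.m≤n+m e d)) q)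

    polyHom : RingHom polynomials S
    polyHom = makeHom {R = polynomials} (λ f → horner (bound f) (coefficient f))
      (λ {f} {h} p → horner-bound (bound f) (bound h) p (bounded f) (bounded h))
      (λ f h → T.trans (horner-+ (bound f ℕ.+ bound h) (coefficient f) (coefficient h)) (T.+-cong
        (horner-bound (bound f ℕ.+ bound h) (bound f) S.refl
          (weaken (ℕₚ.m≤m+n (bound f) (bound h)) (bounded f)) (bounded f))
        (horner-bound (bound f ℕ.+ bound h) (bound h) S.refl
          (weaken (ℕₚ.m≤n+m (bound h) (bound f)) (bounded h)) (bounded h))))
      (λ f h → horner-⋆ (bound f) (bounded f) (bounded h))
      (T.trans (T.+-congˡ (T.zeroʳ v)) (T.trans (T.+-identityʳ _) g.1#-homo))

    polyHom-constant : ∀ x → RingHom.to polyHom (RingHom.to constantₚ x) ≈′ g.to x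
    polyHom-constant x = T.trans (T.+-congˡ (T.zeroʳ v)) (T.+-identityʳ _)

    polyHom-X : RingHom.to polyHom X ≈′ v
    polyHom-X = begin
      g.to 0# +′ v *′ (g.to 1# +′ v *′ T.0#)
        ≈⟨ T.+-cong g.0#-homo (T.*-congˡ (T.+-cong g.1#-homo (T.zeroʳ v))) ⟩
      T.0# +′ v *′ (T.1# +′ T.0#)   ≈⟨ T.+-identityˡ _ ⟩
      v *′ (T.1# +′ T.0#)           ≈⟨ T.*-congˡ (T.+-identityʳ _) ⟩
      v *′ T.1#                     ≈⟨ T.*-identityʳ v ⟩
      v                             ∎

-- Since φ is the p-th power modulo p, `reflects` says that the Frobenius of A/p is injective, that
-- is, A/p is reduced. It is phrased with φ because it is iterated along the colimit over φ.
record FrobeniusLift (p : ℕ) : Set₁ where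
  field
    ring : CommutativeRing 0ℓ 0ℓ
    φ    : RingHom ring ring
  open CommutativeRing ring public hiding (ring)
  p# : Carrier
  p# = multiple ring p 1#
  field
    lifts        : ∀ x → ∃ λ z → RingHom.to φ x ≈ x ^⟨ ring ⟩ p + z * p#
    torsion-free : ∀ z → z * p# ≈ 0# → z ≈ 0#
    reflects     : ∀ x z → RingHom.to φ x ≈ z * p# → ∃ λ y → x ≈ y * p#

module _ {p : ℕ} (prime-p : Prime p) where

  module ModuloP (P : CommutativeRing a b) where
    private module P = CommutativeRing P
    p# = multiple P p P.1#
    open Principal P p# public
    open CommutativeRing P using (_+_; _*_; 1#)
    residue : CommutativeRing a (a ⊔ b)
    residue = P /⟨ p# ⟩
    module E = CommutativeRing residue

    toResidue : RingHom P residue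
    toResidue = quotientHom

    p#≈0 : p# E.≈ E.0#
    p#≈0 = ideal⇒≈/0 {R = P} (generator P.refl)

    residue-char : multiple residue p E.1# E.≈ E.0#
    residue-char = E.trans (E.sym (RingHom.multiple-homo toResidue p)) p#≈0

    frobeniusE : RingHom residue residue
    frobeniusE = Frobenius.frobeniusHom prime-p residue residue-char

    ^-residue : ∀ x n → x ^⟨ residue ⟩ n E.≈ x ^⟨ P ⟩ n
    ^-residue x n = E.sym (RingHom.^-homo toResidue x n)

    private module F = RingHom frobeniusE

    frobenius-fixed : ∀ x → x E.≈ F.to x → ∃ λ z → x P.≈ x ^⟨ P ⟩ p + z * p#
    frobenius-fixed x eq = ≈/⇒difference (E.trans eq (^-residue x p))

    ^p-0 : ∀ {x y} → x P.≈ P.0# → y P.≈ P.0# → y ≈/ (x ^⟨ P ⟩ p)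
    ^p-0 {x} {y} x≈0 y≈0 = begin
      y             ≈⟨ R.cong y≈0 ⟩
      P.0#          ≈⟨ F.0#-homo ⟨
      F.to P.0#     ≈⟨ F.cong (R.cong x≈0) ⟨
      F.to x        ≈⟨ ^-residue x p ⟩
      x ^⟨ P ⟩ p    ∎
      where
      open SetoidReasoning E.setoid
      module R = RingHom toResidue

    -- The p-th power is additive modulo p, so the congruence between the lift of Frobenius and the
    -- p-th power passes from k and f to g = k + X f. This is the induction step of `Φ-lifts`.
    ^p-head-tail : ∀ {k k′ X f F g} → k′ ≈/ (k ^⟨ P ⟩ p) → F ≈/ (f ^⟨ P ⟩ p) → g P.≈ k + X * f →
                   (k′ + X ^⟨ P ⟩ p * F) ≈/ (g ^⟨ P ⟩ p)
    ^p-head-tail {k} {k′} {X} {f} {F} {g} k′≈ F≈ g≈ = begin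
      k′ + X ^⟨ P ⟩ p * F                    ≈⟨ E.+-cong k′≈ (E.*-congˡ F≈) ⟩
      k ^⟨ P ⟩ p + X ^⟨ P ⟩ p * f ^⟨ P ⟩ p
        ≈⟨ E.+-cong (^-residue k p) (E.*-cong (^-residue X p) (^-residue f p)) ⟨
      F.to k + F.to X * F.to f               ≈⟨ E.+-congˡ (F.*-homo X f) ⟨
      F.to k + F.to (X * f)                  ≈⟨ F.+-homo k (X * f) ⟨
      F.to (k + X * f)                       ≈⟨ F.cong (RingHom.cong toResidue g≈) ⟨
      F.to g                                 ≈⟨ ^-residue g p ⟩
      g ^⟨ P ⟩ p                             ∎
      where open SetoidReasoning E.setoid

  private
    Z = ℤₚ.+-*-commutativeRing
    module ℤ-mod-p = ModuloP Z

  -- The identity lifts Frobenius by Fermat's little theorem: ℤ is initial, so reduction modulo p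
  -- and reduction followed by Frobenius agree.
  ℤ-lift : FrobeniusLift p
  ℤ-lift = record
    { ring         = Z
    ; φ            = idRing Z
    ; lifts        = λ x → frobenius-fixed x
        (integer-agree toResidue (frobeniusE ∘R toResidue) x)
    ; torsion-free = tf
    ; reflects     = λ _ z eq → z , eq
    }
    where
    open ℤ-mod-p
    tf : ∀ z → z ℤ.* p# ≡ + 0 → z ≡ + 0
    tf z eq with ℤₚ.i*j≡0⇒i≡0∨j≡0 z eq
    ... | inj₁ z≡0  = z≡0
    ... | inj₂ p#≡0 = ⊥-elim (¬prime[0]
      (≡.subst Prime (ℤₚ.+-injective (≡.trans (≡.sym (multiple-ℤ p)) p#≡0)) prime-p))

  module _ (A : FrobeniusLift p) where
    private
      module A = FrobeniusLift A
      module φ = RingHom A.φ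
      open SeriesFacts A.ring
      open Polynomial A.ring
      module P = CommutativeRing polynomials
      module S = CommutativeRing powerSeries
      module K = RingHom constantₚ
      module M = ModuloP polynomials
      open M using (p#)
      open P using (_+_; _*_)

      open Evaluation (constantₚ ∘R A.φ) (X ^⟨ polynomials ⟩ p)
      module Φ = RingHom polyHom

      *p# : ∀ f i → coefficient (f * p#) i A.≈ coefficient f i A.* A.p#
      *p# f i = A.trans (S.*-congˡ {coefficient f} (λ j → A.sym (K.multiple-homo p j)) i)
                        (⋆-constant (coefficient f) A.p# i)

      lifts-constant : ∀ x → K.to (φ.to x) M.≈/ (K.to x ^⟨ polynomials ⟩ p)
      lifts-constant x = let z , eq = A.lifts x in
        M.difference⇒≈/ {K.to (φ.to x)} {K.to x ^⟨ polynomials ⟩ p} (K.to z) λ i →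
          A.trans (K.cong eq i) (A.trans (K.+-homo (x ^⟨ A.ring ⟩ p) (z A.* A.p#) i)
            (A.+-cong (K.^-homo x p i) (A.trans (K.*-homo z A.p# i)
              (S.*-congˡ {coefficient (K.to z)} (K.multiple-homo p) i))))

      Φ-lifts : ∀ d {f} (b : Bounded d f) → Φ.to (poly f d b) M.≈/ (poly f d b ^⟨ polynomials ⟩ p)
      Φ-lifts zero {f} b = M.^p-0 {poly f 0 b} {P.0#} (λ i → b i z≤n) (λ _ → A.refl)
      Φ-lifts (suc d) {f} b =
        M.^p-head-tail {K.to (f 0)} {K.to (φ.to (f 0))} {X} {tailₚ b} {Φ.to (tailₚ b)} {poly f (suc d) b}
          (lifts-constant (f 0)) (Φ-lifts d (bounded (tailₚ b))) (head-tailₚ b)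

      drop : ℕ → Poly → Poly
      drop n f = poly (λ i → coefficient f (n ℕ.+ i)) (bound f)
        (λ i b≤i → bounded f (n ℕ.+ i) (ℕₚ.≤-trans b≤i (ℕₚ.m≤n+m i n)))

      Xᵖ : Series
      Xᵖ = variable-π ^⟨ powerSeries ⟩ p

      coefficient-Xᵖ : ∀ g i → coefficient (X ^⟨ polynomials ⟩ p * g) i A.≈ (Xᵖ ⋆ coefficient g) i
      coefficient-Xᵖ g i = S.*-congʳ {coefficient g} (RingHom.^-homo coefficientHom X p) i

      -- Φ f = φ(f₀) + Xᵖ Φ(tail f) with p > 0. The constant coefficient of Φ f is thus φ(f₀), and
      -- dropping the first p coefficients leaves Φ(tail f), so divisibility by p can be treated
      -- separately for f₀ and for the tail.
      Φ-reflects : ∀ d {f} (b : Bounded d f) z →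
        (∀ i → coefficient (Φ.to (poly f d b)) i A.≈ coefficient (z * p#) i) →
        ∃ λ y → ∀ i → f i A.≈ coefficient (y * p#) i
      Φ-reflects zero b z eq = P.0# , λ i → A.trans (b i z≤n) (A.sym (S.zeroˡ (coefficient p#) i))
      Φ-reflects (suc d) {f} b z eq =
        let y₀ , eq₀ = A.reflects (f 0) (coefficient z 0) (A.trans (A.sym low) (A.trans (eq 0) (*p# z 0)))
            y₁ , eq₁ = Φ-reflects d (bounded (tailₚ b)) (drop p z) high
        in K.to y₀ + X * y₁ , λ
          { zero    → A.trans eq₀ (A.sym (A.trans (*p# (K.to y₀ + X * y₁) 0)
                        (A.*-congʳ (A.trans (A.+-congˡ (π⋆-zero (coefficient y₁))) (A.+-identityʳ _)))))
          ; (suc i) → A.trans (eq₁ i) (A.trans (*p# y₁ i) (A.sym (A.trans (*p# (K.to y₀ + X * y₁) (suc i))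
                        (A.*-congʳ (A.trans (A.+-congˡ (π⋆-suc (coefficient y₁) i)) (A.+-identityˡ _)))))) }
        where
        G = Φ.to (tailₚ b)
        low : coefficient (Φ.to (poly f (suc d) b)) 0 A.≈ φ.to (f 0)
        low = A.trans (A.+-congˡ (A.trans (coefficient-Xᵖ G 0) (πⁿ⋆-low p (coefficient G) 0 (prime>0 prime-p))))
                      (A.+-identityʳ _)
        high : ∀ i → coefficient G i A.≈ coefficient (drop p z * p#) i
        high i = A.trans (A.sym (πⁿ⋆-drop p (coefficient G) i))
          (A.trans (A.sym (coefficient-Xᵖ G (p ℕ.+ i)))
            (A.trans (A.sym (A.trans (A.+-congʳ (constant-high (prime>0 prime-p))) (A.+-identityˡ _)))
              (A.trans (eq (p ℕ.+ i))
                (A.trans (*p# z (p ℕ.+ i)) (A.sym (*p# (drop p z) i))))))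
          where
          constant-high : ∀ {q} → 0 ℕ.< q → constant (φ.to (f 0)) (q ℕ.+ i) A.≈ A.0#
          constant-high (s≤s _) = A.refl

    polynomial-lift : FrobeniusLift p
    polynomial-lift = record
      { ring         = polynomials
      ; φ            = polyHom
      ; lifts        = λ f → M.≈/⇒difference {RingHom.to polyHom f} {f ^⟨ polynomials ⟩ p} (Φ-lifts (bound f) (bounded f))
      ; torsion-free = λ z eq i → A.torsion-free _ (A.trans (A.sym (*p# z i)) (eq i))
      ; reflects     = λ f → Φ-reflects (bound f) (bounded f)
      }

    private module L = FrobeniusLift polynomial-lift

    φ-X : RingHom.to L.φ X L.≈ X ^⟨ L.ring ⟩ p
    φ-X = polyHom-X

    φ-constant : ∀ x → RingHom.to L.φ (K.to x) L.≈ K.to (φ.to x)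
    φ-constant x = polyHom-constant x

  -- Only the finitely many elements v need preimages. `φ-preimage` singles the preimages out as
  -- variables; in the perfection it becomes the Teichmüller condition.
  record Cover (K : CommutativeRing c ℓ) {n : ℕ} (v : Fin n → ∣ K ∣) : Set (Level.suc 0ℓ ⊔ c ⊔ ℓ) where
    field
      lift : FrobeniusLift p
    private
      module A = FrobeniusLift lift
      module K = CommutativeRing K
    field
      evaluation : RingHom A.ring K
      preimage   : Fin n → A.Carrier
      evaluates  : ∀ i → RingHom.to evaluation (preimage i) K.≈ v i
      φ-preimage : ∀ i → RingHom.to A.φ (preimage i) A.≈ preimage i ^⟨ A.ring ⟩ p

  cover : (K : CommutativeRing c ℓ) → ∀ {n} (v : Fin n → ∣ K ∣) → Cover K v
  cover K {zero}  v = record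
    { lift = ℤ-lift ; evaluation = integerHom K ; preimage = λ () ; evaluates = λ () ; φ-preimage = λ () }
  cover K {suc n} v = record
    { lift       = polynomial-lift A
    ; evaluation = polyHom
    ; preimage   = λ { Fin.zero → X ; (Fin.suc i) → C.to (preimage i) }
    ; evaluates  = λ
      { Fin.zero    → polyHom-X
      ; (Fin.suc i) → K.trans (polyHom-constant (preimage i)) (evaluates i) }
    ; φ-preimage = λ
      { Fin.zero    → φ-X A
      ; (Fin.suc i) → λ j → A.trans (φ-constant A (preimage i) j)
          (A.trans (C.cong (φ-preimage i) j) (C.^-homo (preimage i) p j)) }
    }
    where
    module K = CommutativeRing K
    open Cover (cover K (λ i → v (Fin.suc i))) renaming (lift to A)
    module A = FrobeniusLift A
    open Polynomial A.ring
    open Evaluation evaluation (v Fin.zero)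
    module C = RingHom constantₚ

-- The perfection of a ring with a lift of Frobenius

-- `ρ` plays the part of φ⁻¹. By `lifts` it yields p-th roots modulo p, which makes Frobenius on P/p
-- surjective.
record PerfectLift (p : ℕ) : Set₁ where
  field
    ring : CommutativeRing 0ℓ 0ℓ
    ρ    : RingHom ring ring
  open CommutativeRing ring public hiding (ring)
  p# : Carrier
  p# = multiple ring p 1#
  field
    lifts        : ∀ x → ∃ λ z → x ≈ RingHom.to ρ x ^⟨ ring ⟩ p + z * p#
    torsion-free : ∀ z → z * p# ≈ 0# → z ≈ 0#

-- The germ of (fₙ) stands for φ⁻ⁿ(fₙ) in the colimit of A → A → ⋯ along φ.
module Germs {p : ℕ} (A : FrobeniusLift p) where
  open FrobeniusLift A
  private
    module φ = RingHom φ
    module R = RingProperties (CommutativeRing.ring ring)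

  -- An element of the colimit is given by its representatives in all late copies of A. The
  -- operations are then termwise, with no passage to a common index, and equality is equality from
  -- some index on.
  record Germ : Set where
    field
      term   : ℕ → Carrier
      start  : ℕ
      stable : ∀ n → start ℕ.≤ n → term (suc n) ≈ φ.to (term n)
  open Germ public

  infix 4 _≈∞_
  _≈∞_ : Germ → Germ → Set
  f ≈∞ g = ∃ λ m → ∀ n → m ℕ.≤ n → term f n ≈ term g n

  private
    both : ∀ {f g h k u v} → (∀ n → term f n ≈ term g n → term h n ≈ term k n → term u n ≈ term v n) →
           f ≈∞ g → h ≈∞ k → u ≈∞ v
    both op (i , p) (j , q) = i ℕ.+ j , λ n i+j≤n →
      op n (p n (ℕₚ.m+n≤o⇒m≤o i i+j≤n)) (q n (ℕₚ.m+n≤o⇒n≤o i i+j≤n))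

  private
    _+G_ _*G_ : Germ → Germ → Germ
    f +G g = record
      { term   = λ n → term f n + term g n
      ; start  = start f ℕ.+ start g
      ; stable = λ n s → trans
          (+-cong (stable f n (ℕₚ.m+n≤o⇒m≤o (start f) s)) (stable g n (ℕₚ.m+n≤o⇒n≤o (start f) s)))
          (sym (φ.+-homo _ _)) }
    f *G g = record
      { term   = λ n → term f n * term g n
      ; start  = start f ℕ.+ start g
      ; stable = λ n s → trans
          (*-cong (stable f n (ℕₚ.m+n≤o⇒m≤o (start f) s)) (stable g n (ℕₚ.m+n≤o⇒n≤o (start f) s)))
          (sym (φ.*-homo _ _)) }

  germs : CommutativeRing 0ℓ 0ℓ
  germs = record
    { Carrier = Germ
    ; _≈_     = _≈∞_
    ; _+_     = _+G_
    ; _*_     = _*G_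
    ; -_      = λ f → record
      { term = λ n → - term f n ; start = start f
      ; stable = λ n s → trans (-‿cong (stable f n s)) (sym (φ.-‿homo _)) }
    ; 0#      = record { term = λ _ → 0# ; start = 0 ; stable = λ _ _ → sym φ.0#-homo }
    ; 1#      = record { term = λ _ → 1# ; start = 0 ; stable = λ _ _ → sym φ.1#-homo }
    ; isCommutativeRing = IsCommutativeRingˡ.isCommutativeRing record
      { isEquivalence = record
        { refl  = 0 , λ _ _ → refl
        ; sym   = λ (i , p) → i , λ n i≤n → sym (p n i≤n)
        ; trans = λ {f} {g} {h} → both {f} {g} {g} {h} {f} {h} (λ _ → trans) }
      ; +-cong      = λ {f} {g} {h} {k} → both {f} {g} {h} {k} {f +G h} {g +G k} (λ _ → +-cong)
      ; *-cong      = λ {f} {g} {h} {k} → both {f} {g} {h} {k} {f *G h} {g *G k} (λ _ → *-cong)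
      ; -‿cong      = λ (i , p) → i , λ n i≤n → -‿cong (p n i≤n)
      ; +-assoc     = λ f g h → 0 , λ n _ → +-assoc (term f n) (term g n) (term h n)
      ; +-comm      = λ f g → 0 , λ n _ → +-comm (term f n) (term g n)
      ; +-identityˡ = λ f → 0 , λ n _ → +-identityˡ (term f n)
      ; -‿inverseˡ  = λ f → 0 , λ n _ → -‿inverseˡ (term f n)
      ; *-assoc     = λ f g h → 0 , λ n _ → *-assoc (term f n) (term g n) (term h n)
      ; *-comm      = λ f g → 0 , λ n _ → *-comm (term f n) (term g n)
      ; *-identityˡ = λ f → 0 , λ n _ → *-identityˡ (term f n)
      ; distribˡ    = λ f g h → 0 , λ n _ → distribˡ (term f n) (term g n) (term h n)
      }
    }

  private
    module G = CommutativeRing germs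

    term-^ : ∀ f k n → term (f ^⟨ germs ⟩ k) n ≡ term f n ^⟨ ring ⟩ k
    term-^ f zero    n = ≡.refl
    term-^ f (suc k) n = ≡.cong (term f n *_) (term-^ f k n)

    term-multiple : ∀ k n → term (multiple germs k G.1#) n ≡ multiple ring k 1#
    term-multiple zero    n = ≡.refl
    term-multiple (suc k) n = ≡.cong (λ x → 1# + x) (term-multiple k n)

  -- The inverse of φ: f_{n-1} in copy n stands for φ⁻ⁿ(f_{n-1}), which is φ⁻¹ of
  -- φ^(-(n-1))(f_{n-1}). The value at index 0 is a filler and lies before the new `start`.
  shift : RingHom germs germs
  shift = makeHom {R = germs} {S = germs}
    (λ f → record
      { term = λ n → term f (ℕ.pred n) ; start = suc (start f)
      ; stable = λ { (suc n) (s≤s s) → stable f n s } })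
    (λ { (m , p) → suc m , λ { (suc n) (s≤s m≤n) → p n m≤n } })
    (λ _ _ → 0 , λ n _ → refl)
    (λ _ _ → 0 , λ n _ → refl)
    (0 , λ _ _ → refl)

  private
    module ρ = RingHom shift
    open SetoidReasoning setoid hiding (start)

    quotient-term : Germ → ℕ → Carrier
    quotient-term f n = proj₁ (lifts (term f (ℕ.pred n)))

    cancel-p : ∀ x y → x * p# ≈ y * p# → x ≈ y
    cancel-p x y eq = R.x∙y⁻¹≈ε⇒x≈y x y (torsion-free (x - y)
      (trans (R.[y-z]x≈yx-zx p# x y) (R.x≈y⇒x∙y⁻¹≈ε eq)))

    -- The witness z in φ(x) = xᵖ + z p is unique because p can be cancelled. Hence the witnesses
    -- chosen separately for consecutive terms correspond under φ and form a germ.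
    quotient-stable : ∀ f n → start f ℕ.≤ n →
      quotient-term f (suc (suc n)) ≈ φ.to (quotient-term f (suc n))
    quotient-stable f n s = cancel-p _ _ (R.+-cancelˡ (φ.to (term f n) ^⟨ ring ⟩ p) _ _ (begin
      φ.to (term f n) ^⟨ ring ⟩ p + quotient-term f (suc (suc n)) * p#
        ≈⟨ +-congʳ (^-congˡ p (stable f n s)) ⟨
      term f (suc n) ^⟨ ring ⟩ p + quotient-term f (suc (suc n)) * p#
        ≈⟨ proj₂ (lifts (term f (suc n))) ⟨
      φ.to (term f (suc n))                      ≈⟨ φ.cong (stable f n s) ⟩
      φ.to (φ.to (term f n))                     ≈⟨ φ.cong (proj₂ (lifts (term f n))) ⟩
      φ.to (term f n ^⟨ ring ⟩ p + z * p#)       ≈⟨ φ.+-homo _ _ ⟩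
      φ.to (term f n ^⟨ ring ⟩ p) + φ.to (z * p#)
        ≈⟨ +-cong (φ.^-homo _ p) (trans (φ.*-homo z p#) (*-congˡ (φ.multiple-homo p))) ⟩
      φ.to (term f n) ^⟨ ring ⟩ p + φ.to z * p#  ∎))
      where
      z = quotient-term f (suc n)
      open import Algebra.Properties.CommutativeSemiring.Exp commutativeSemiring using (^-congˡ)

  perfectLift : PerfectLift p
  perfectLift = record
    { ring = germs
    ; ρ    = shift
    ; lifts = λ f → record
        { term = quotient-term f ; start = suc (start f)
        ; stable = λ { (suc n) (s≤s s) → quotient-stable f n s } }
      , suc (start f) , λ { (suc n) (s≤s s) → begin
        term f (suc n)                 ≈⟨ stable f n s ⟩
        φ.to (term f n)                ≈⟨ proj₂ (lifts (term f n)) ⟩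
        term f n ^⟨ ring ⟩ p + quotient-term f (suc n) * p#
          ≡⟨ ≡.cong₂ (λ x y → x + quotient-term f (suc n) * y)
               (term-^ (ρ.to f) p (suc n)) (term-multiple p (suc n)) ⟨
        term (ρ.to f ^⟨ germs ⟩ p) (suc n) + quotient-term f (suc n) * term (multiple germs p G.1#) (suc n) ∎ }
    ; torsion-free = λ z (m , eq) → m , λ n m≤n → torsion-free (term z n)
        (trans (reflexive (≡.cong (term z n *_) (≡.sym (term-multiple p n)))) (eq n m≤n))
    }

  private
    iterate-φ : ∀ n x → RingHom.to (iterate φ n) (φ.to x) ≈ φ.to (RingHom.to (iterate φ n) x)
    iterate-φ zero    x = refl
    iterate-φ (suc n) x = φ.cong (iterate-φ n x)

    iterate-reflects : ∀ n x z → RingHom.to (iterate φ n) x ≈ z * p# → ∃ λ y → x ≈ y * p#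
    iterate-reflects zero    x z eq = z , eq
    iterate-reflects (suc n) x z eq =
      let y , eq′ = reflects _ z eq in iterate-reflects n x y eq′

  embed : RingHom ring germs
  embed = makeHom {S = germs}
    (λ x → record { term = λ n → RingHom.to (iterate φ n) x ; start = 0 ; stable = λ _ _ → refl })
    (λ p → 0 , λ n _ → RingHom.cong (iterate φ n) p)
    (λ x y → 0 , λ n _ → RingHom.+-homo (iterate φ n) x y)
    (λ x y → 0 , λ n _ → RingHom.*-homo (iterate φ n) x y)
    (0 , λ n _ → RingHom.1#-homo (iterate φ n))

  -- An equation of germs is evaluated at an index where it holds, and `reflects` is applied that
  -- many times. It gives the injectivity of A/p → P/p.
  embed-reflects : ∀ x z → RingHom.to embed x G.≈ z G.* multiple germs p G.1# → ∃ λ y → x ≈ y * p#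
  embed-reflects x z (m , eq) = iterate-reflects m x (term z m)
    (trans (eq m ℕₚ.≤-refl) (reflexive (≡.cong (term z m *_) (term-multiple p m))))

  -- For a variable, where φ(x) = xᵖ, the root ρ(x) satisfies ρ(x)ᵖ = x exactly and not just modulo
  -- p.
  shift-embed : ∀ x → φ.to x ≈ x ^⟨ ring ⟩ p →
                ρ.to (RingHom.to embed x) ^⟨ germs ⟩ p G.≈ RingHom.to embed x
  shift-embed x eq = 1 , λ { (suc n) _ → begin
    term (ρ.to (RingHom.to embed x) ^⟨ germs ⟩ p) (suc n) ≡⟨ term-^ (ρ.to (RingHom.to embed x)) p (suc n) ⟩
    RingHom.to (iterate φ n) x ^⟨ ring ⟩ p                  ≈⟨ RingHom.^-homo (iterate φ n) x p ⟨
    RingHom.to (iterate φ n) (x ^⟨ ring ⟩ p)                ≈⟨ RingHom.cong (iterate φ n) eq ⟨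
    RingHom.to (iterate φ n) (φ.to x)                       ≈⟨ iterate-φ n x ⟩
    φ.to (RingHom.to (iterate φ n) x)                       ∎ }

-- Convergent series and maps of power series

module _ (R : CommutativeRing c ℓ) (π : ∣ R ∣) where
  open Completion R π
  open CommutativeRing R

  partial-sum : (ℕ → Limit) → ℕ → ℕ → Carrier
  partial-sum x n zero    = 0#
  partial-sum x n (suc k) = partial-sum x n k + seq (x k) n * π ^⟨ R ⟩ k

  -- The left-hand side of unfold is the function hidden inside series; it can
  -- only be named by unification, once its two arguments have been separated.
  mutual
    seq-series : ∀ x n → seq (series x) (suc n) ≡ partial-sum x (suc n) (suc n)
    seq-series x n with suc n
    ... | N = ≡.cong (_+ seq (x n) N * π ^⟨ R ⟩ n) (unfold x N n)

    unfold : ∀ x n k → _ ≡ partial-sum x n k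
    unfold x n zero    = ≡.refl
    unfold x n (suc k) = ≡.cong (_+ seq (x k) n * π ^⟨ R ⟩ k) (unfold x n k)

module _ {R : CommutativeRing a b} (f : RingHom R R) where
  open CommutativeRing R
  open RingHom using (to)

  iterate-+ : ∀ m n x → to (iterate f (m ℕ.+ n)) x ≡ to (iterate f m) (to (iterate f n) x)
  iterate-+ zero    n x = ≡.refl
  iterate-+ (suc m) n x = ≡.cong (to f) (iterate-+ m n x)

module _ {R : CommutativeRing a b} {S : CommutativeRing c ℓ₁} (f : RingHom R S) where
  private
    module R = CommutativeRing R
    module S = CommutativeRing S
    module f = RingHom f
    module PR = PowerSeries R
    module PS = PowerSeries S

    ⋆-homo : ∀ x y n → f.to ((x PR.⋆ y) n) S.≈ ((λ i → f.to (x i)) PS.⋆ (λ i → f.to (y i))) n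
    ⋆-homo x y zero    = f.*-homo _ _
    ⋆-homo x y (suc n) = S.trans (f.+-homo _ _)
      (S.+-cong (f.*-homo _ _) (⋆-homo (λ i → x (suc i)) y n))

  mapSeries : RingHom PR.powerSeries PS.powerSeries
  mapSeries = makeHom {R = PR.powerSeries} {S = PS.powerSeries} (λ x n → f.to (x n))
    (λ p n → f.cong (p n)) (λ _ _ _ → f.+-homo _ _) ⋆-homo
    (λ { zero → f.1#-homo ; (suc _) → f.0#-homo })

constantCoefficient : (R : CommutativeRing a b) → RingHom (PowerSeries.powerSeries R) R
constantCoefficient R = makeHom {R = PowerSeries.powerSeries R} (λ f → f 0)
  (λ p → p 0) (λ _ _ → refl) (λ _ _ → refl) refl
  where open CommutativeRing R

-- Perfect rings of characteristic p

module _ {p : ℕ} where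

  private 𝔽 = ℤₚ.+-*-commutativeRing /⟨ + p ⟩

  char-p : {S : CommutativeRing a b} → RingHom 𝔽 S →
           let open CommutativeRing S in multiple S p 1# ≈ 0#
  char-p {S = S} f = trans (sym (RingHom.multiple-homo (f ∘R quotientHom) p))
    (trans (RingHom.cong f {multiple ℤₚ.+-*-commutativeRing p (+ 1)} {+ 0}
      (ideal⇒≈/0 {R = ℤₚ.+-*-commutativeRing} (generator (≡.sym (multiple-ℤ p))))) (RingHom.0#-homo f))
    where
    open CommutativeRing S
    open Principal ℤₚ.+-*-commutativeRing (+ p)

  𝔽ₚ-hom : (S : CommutativeRing a b) → let open CommutativeRing S in
           multiple S p 1# ≈ 0# → RingHom 𝔽 S
  𝔽ₚ-hom S p≈0 = factorHom (integerHom S) (λ { ≡.refl → p≈0 })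

Characteristic : ℕ → CommutativeRing a b → Set b
Characteristic p R = multiple R p 1# ≈ 0#
  where open CommutativeRing R

HasRoots : ℕ → CommutativeRing a b → Set (a ⊔ b)
HasRoots n R = ∀ x → ∃ λ y → y ^⟨ R ⟩ n ≈ x
  where open CommutativeRing R

module _ {p : ℕ} (prime-p : Prime p) where

  module _ {R : CommutativeRing c ℓ} {G : Set ℓ₂} where
    open Presentation R G

    -- In characteristic p the elements with a p-th root form a subring, so constants and generators
    -- suffice.
    presented-roots : (_~_ : Rel Term ℓ₃) → let S = presented _~_ in let open CommutativeRing S in
      multiple S p 1# ≈ 0# → (∀ x → ∃ λ y → y ^⟨ S ⟩ p ≈ con x) →
      (∀ x → ∃ λ y → y ^⟨ S ⟩ p ≈ gen x) → HasRoots p S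
    presented-roots _~_ p≈0 con-root gen-root = go
      where
      S = presented _~_
      module F = RingHom (Frobenius.frobeniusHom prime-p S p≈0)
      open CommutativeRing S using (_≈_; trans; +-cong; *-cong; -‿cong)
      go : HasRoots p S
      go (con x) = con-root x
      go (gen x) = gen-root x
      go (x ⊕ y) = let u , p = go x ; v , q = go y in u ⊕ v , trans (F.+-homo u v) (+-cong p q)
      go (x ⊛ y) = let u , p = go x ; v , q = go y in u ⊛ v , trans (F.*-homo u v) (*-cong p q)
      go (⊝ x)   = let u , p = go x in ⊝ u , trans (F.-‿homo u) (-‿cong p)

  roots-pⁿ : {R : CommutativeRing a b} → HasRoots p R → ∀ n → HasRoots (p ℕ.^ n) R
  roots-pⁿ {R = R} root zero    x = x , CommutativeRing.*-identityʳ R x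
  roots-pⁿ {R = R} root (suc n) x =
    let y , y≈ = roots-pⁿ {R = R} root n x ; z , z≈ = root y in
    z , trans (sym (^-assocʳ z p (p ℕ.^ n))) (trans (^-congˡ (p ℕ.^ n) z≈) y≈)
    where
    open CommutativeRing R
    open Exp commutativeSemiring

  module _ {A : CommutativeRing 0ℓ 0ℓ} where
    open Perfection p A
    private module A = CommutativeRing A

    private
      module P = CommutativeRing ring

    toPerfection : RingHom A ring
    toPerfection = makeHom {S = ring} (λ x → gen (0 , x))
      (λ p → relation (resp 0 p)) (λ x y → relation (additive 0 x y))
      (λ x y → relation (multiplicative 0 x y)) (relation (unital 0))

    perfection-root : ∀ n x → gen (suc n , x) ^⟨ ring ⟩ p P.≈ gen (n , x)
    perfection-root n x = P.trans (power p) (relation (frobenius n x))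
      where
      power : ∀ k → gen (suc n , x) ^⟨ ring ⟩ k P.≈ gen (suc n , x ^⟨ A ⟩ k)
      power zero    = P.sym (relation (unital (suc n)))
      power (suc k) = P.trans (P.*-congˡ (power k)) (P.sym (relation (multiplicative (suc n) _ _)))

    perfection-rootⁿ : ∀ k n x → gen (k ℕ.+ n , x) ^⟨ ring ⟩ (p ℕ.^ k) P.≈ gen (n , x)
    perfection-rootⁿ zero    n x = P.*-identityʳ _
    perfection-rootⁿ (suc k) n x = P.trans (P.sym (^-assocʳ (gen (suc k ℕ.+ n , x)) p (p ℕ.^ k)))
      (P.trans (^-congˡ (p ℕ.^ k) (perfection-root (k ℕ.+ n) x)) (perfection-rootⁿ k n x))
      where open Exp P.commutativeSemiring using (^-assocʳ; ^-congˡ)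

    perfection-roots : multiple ring p P.1# P.≈ P.0# → HasRoots p ring
    perfection-roots p≈0 = presented-roots PerfectionRelation p≈0
      -- Integers are their own p-th roots: Frobenius fixes the image of ℤ.
      (λ x → con x , integer-agree (Frobenius.frobeniusHom prime-p ring p≈0 ∘R conHom PerfectionRelation)
                                   (conHom PerfectionRelation) x)
      (λ (n , x) → gen (suc n , x) , perfection-root n x)

  module _ {R : CommutativeRing c ℓ} {V : Set ℓ₂} where
    open RootPolynomials p R V
    private module P = CommutativeRing ring

    rootPolynomials-roots : let open CommutativeRing R using (_≈_; 1#; 0#) in
      multiple R p 1# ≈ 0# → HasRoots p R → HasRoots p ring
    rootPolynomials-roots p≈0 R-root = presented-roots RootRelation
      (P.trans (P.sym (C.multiple-homo p)) (P.trans (C.cong p≈0) C.0#-homo))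
      (λ x → let y , eq = R-root x in con y , P.trans (P.sym (C.^-homo y p)) (C.cong eq))
      (λ (v , n) → gen (v , suc n) ,
        P.trans (P.reflexive (≡.sym (⊛^≡^ RootRelation (gen (v , suc n)) p))) (relation (root v n)))
      where module C = RingHom (conHom RootRelation)

  module Residue (P : PerfectLift p) where
    open PerfectLift P renaming (ring to ringP)
    open ModuloP prime-p ringP public hiding (p#)
    private module ρ = RingHom ρ

    inducedHom : RingHom ringP ringP → RingHom residue residue
    inducedHom f = factorHom {R = ringP} {S = residue} (toResidue ∘R f) λ {x} p#≈x →
      E.trans (RingHom.cong toResidue (f.cong (sym p#≈x)))
        (E.trans (RingHom.cong toResidue (f.multiple-homo p)) p#≈0)
      where module f = RingHom f

    root : ℕ → Carrier → Carrier
    root n = RingHom.to (iterate ρ n)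

    rootHom : ℕ → RingHom residue residue
    rootHom n = inducedHom (iterate ρ n)

    root-power : ∀ x → ρ.to x ^⟨ residue ⟩ p E.≈ x
    root-power x = let z , eq = lifts x in
      E.trans (^-residue (ρ.to x) p) (E.sym (difference⇒≈/ z eq))

    root-powerⁿ : ∀ n x → root n x ^⟨ residue ⟩ (p ℕ.^ n) E.≈ x
    root-powerⁿ zero    x = E.*-identityʳ x
    root-powerⁿ (suc n) x = E.trans (E.sym (^-assocʳ (ρ.to (root n x)) p (p ℕ.^ n)))
      (E.trans (^-congˡ (p ℕ.^ n) (root-power (root n x))) (root-powerⁿ n x))
      where open Exp E.commutativeSemiring

    root-of-power : ∀ n x → root n (x ^⟨ residue ⟩ (p ℕ.^ n)) E.≈ x
    root-of-power n x = E.trans (RingHom.^-homo (rootHom n) x (p ℕ.^ n)) (root-powerⁿ n x)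

    -- The exact form in P of `root-power`, which holds for every x but only modulo p. For such x
    -- the representative `T n x` is x itself, for every n.
    Teichmüller : Carrier → Set
    Teichmüller x = ρ.to x ^⟨ ringP ⟩ p ≈ x

    module _ {x} (teich : Teichmüller x) where
      open Exp commutativeSemiring

      teich-root : ∀ n → Teichmüller (root n x)
      teich-root zero    = teich
      teich-root (suc n) = trans (sym (ρ.^-homo _ p)) (ρ.cong (teich-root n))

      teich-^ : ∀ n → Teichmüller (x ^⟨ ringP ⟩ n)
      teich-^ n = begin
        ρ.to (x ^ n) ^ p    ≈⟨ ^-congˡ p (ρ.^-homo x n) ⟩
        (ρ.to x ^ n) ^ p    ≈⟨ ^-assocʳ (ρ.to x) n p ⟩
        ρ.to x ^ (n ℕ.* p)  ≈⟨ ^-congʳ (ρ.to x) (ℕₚ.*-comm n p) ⟩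
        ρ.to x ^ (p ℕ.* n)  ≈⟨ ^-assocʳ (ρ.to x) p n ⟨
        (ρ.to x ^ p) ^ n    ≈⟨ ^-congˡ n teich ⟩
        x ^ n               ∎
        where open SetoidReasoning setoid

      teich-powerⁿ : ∀ n → root n x ^⟨ ringP ⟩ (p ℕ.^ n) ≈ x
      teich-powerⁿ zero    = *-identityʳ x
      teich-powerⁿ (suc n) = trans (sym (^-assocʳ (ρ.to (root n x)) p (p ℕ.^ n)))
        (trans (^-congˡ (p ℕ.^ n) (teich-root n)) (teich-powerⁿ n))

      teich-of-power : ∀ n → root n (x ^⟨ ringP ⟩ (p ℕ.^ n)) ≈ x
      teich-of-power n = trans (RingHom.^-homo (iterate ρ n) x (p ℕ.^ n)) (teich-powerⁿ n)

    -- A representative of the Teichmüller lift modulo pⁿ⁺¹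
    T : ℕ → Carrier → Carrier
    T n x = root n x ^⟨ ringP ⟩ (p ℕ.^ n)

    T-* : ∀ n x y → T n (x * y) ≈ T n x * T n y
    T-* n x y = trans (^-congˡ (p ℕ.^ n) (RingHom.*-homo (iterate ρ n) x y))
                      (^-distrib-* (root n x) (root n y) (p ℕ.^ n))
      where open Exp commutativeSemiring

    T-1 : ∀ n → T n 1# ≈ 1#
    T-1 n = trans (^-congˡ (p ℕ.^ n) (RingHom.1#-homo (iterate ρ n))) (one (p ℕ.^ n))
      where
      open Exp commutativeSemiring
      one : ∀ k → 1# ^ k ≈ 1#
      one zero    = refl
      one (suc k) = trans (*-identityˡ _) (one k)

    T-^ : ∀ n x k → T n (x ^⟨ ringP ⟩ k) ≈ T n x ^⟨ ringP ⟩ k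
    T-^ n x zero    = T-1 n
    T-^ n x (suc k) = trans (T-* n x _) (*-congˡ (T-^ n x k))

    T-0 : ∀ n → T n 0# ≈ 0#
    T-0 n = trans (^-congˡ (p ℕ.^ n) (RingHom.0#-homo (iterate ρ n))) (zero-power (prime^n>0 prime-p n))
      where
      open Exp commutativeSemiring
      zero-power : ∀ {k} → 0 ℕ.< k → 0# ^ k ≈ 0#
      zero-power (s≤s _) = zeroˡ _

    T-residue : ∀ n x → T n x E.≈ x
    T-residue n x = E.trans (E.sym (^-residue (root n x) (p ℕ.^ n))) (root-powerⁿ n x)

    T-teich : ∀ n {x} → Teichmüller x → T n x ≈ x
    T-teich n teich = teich-powerⁿ teich n

-- The defining equation of the arithmetic polynomials in B

module _ (p : ℕ) (R : CommutativeRing c ℓ) (w : ℕ → ∣ R ∣) where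
  open CommutativeRing R
  open PowerSeries R using (Series; constant; powerSeries)

  expansion : Series
  expansion zero    = 0#
  expansion (suc j) = w (suc j)

  expansion-relation : Series
  expansion-relation = CommutativeRing._-_ powerSeries (constant (multiple R p 1#)) expansion

module Evaluate (p e : ℕ) (t : ℤ) where
  open Setup p e t using (IntegralPolynomial; module Integral)

  module _ (K : CommutativeRing c ℓ) (w : ℕ → ∣ K ∣) where
    assignment : (a b : ℕ → ∣ K ∣) → ∀ {n} → Interval 1 [ n ] ⊎ Interval 0 [ n ] ⊎ Interval 0 [ n ] → ∣ K ∣
    assignment a b (inj₁ j)        = w (val j)
    assignment a b (inj₂ (inj₁ i)) = a (val i)
    assignment a b (inj₂ (inj₂ i)) = b (val i)

    -- The coefficients of `Q n` are represented by integers, so they can be evaluated in any ring.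
    -- Sequences over all of ℕ keep the arithmetic independent of the length m + 1.
    evaluateℕ : (∀ i → IntegralPolynomial i) → (a b : ℕ → ∣ K ∣) → ℕ → ∣ K ∣
    evaluateℕ Q a b n = Integral.eval n K (integer K) (assignment a b) (Q n)

module Core (p e : ℕ) (t : ℤ) (prime-p : Prime p) (P : PerfectLift p)
            (w : ℕ → PerfectLift.Carrier P)
            (w-teich : ∀ j → Residue.Teichmüller prime-p P (w j)) where
  open Setup p e t
  open Evaluate p e t
  open PerfectLift P renaming (ring to ringP)
  open Residue prime-p P
  open SeriesFacts ringP
  relationP : Series
  relationP = expansion-relation p ringP w

  private
    module S = CommutativeRing powerSeries
    module Z = ℤ[ω] ⊤⁺

    -- The value of ω_j, chosen such that ω_j^{q^t} becomes w_j
    ω-value : ℤ → ℕ → Carrier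
    ω-value (+ n)    j = root (e ℕ.* n) (w j)
    ω-value -[1+ n ] j = w j ^⟨ ringP ⟩ (p ℕ.^ (e ℕ.* suc n))

    ω-value-teich : ∀ s j → Teichmüller (ω-value s j)
    ω-value-teich (+ n)    j = teich-root (w-teich j) (e ℕ.* n)
    ω-value-teich -[1+ n ] j = teich-^ (w-teich j) (p ℕ.^ (e ℕ.* suc n))

    q^≡p^ : ∀ n → q ℕ.^ n ≡ p ℕ.^ (e ℕ.* n)
    q^≡p^ n = ℕₚ.^-*-assoc p e n

    ω-root : Interval 1 ⊤⁺ × ℕ → Carrier
    ω-root (j , n) = root (e ℕ.* n) (ω-value t (val j))

    ω-root-relation : ∀ {x y} → Z.RootRelation x y →
      Z.eval ringP (integer ringP) ω-root x ≈ Z.eval ringP (integer ringP) ω-root y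
    ω-root-relation (Z.root j n) = begin
      Z.eval ringP (integer ringP) ω-root (Z.gen (j , suc n) Z.⊛^ q)
        ≈⟨ eval-^ {S = ringP} (RingHom.1#-homo (integerHom ringP)) (Z.gen (j , suc n)) q ⟩
      root (e ℕ.* suc n) x ^⟨ ringP ⟩ q
        ≡⟨ ≡.cong (λ k → root k x ^⟨ ringP ⟩ q) (ℕₚ.*-suc e n) ⟩
      root (e ℕ.+ e ℕ.* n) x ^⟨ ringP ⟩ q
        ≡⟨ ≡.cong (λ y → y ^⟨ ringP ⟩ q) (iterate-+ ρ e (e ℕ.* n) x) ⟩
      root e (root (e ℕ.* n) x) ^⟨ ringP ⟩ q
        ≈⟨ teich-powerⁿ (teich-root (ω-value-teich t (val j)) (e ℕ.* n)) e ⟩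
      root (e ℕ.* n) x ∎
      where
      x = ω-value t (val j)
      open SetoidReasoning setoid

    ω-hom : RingHom (ℤ[ω].ring ⊤⁺) ringP
    ω-hom = evalHom (integerHom ringP) ω-root ω-root-relation

    open ℒ-Construction ⊤⁺ using (ω-power; p-expansion; p-relation)

    -- The variable s can be split into cases where the parameter t cannot. For s ≥ 0 a root is
    -- raised to a power, for s < 0 a root is taken of a power; on Teichmüller elements both give
    -- back wⱼ.
    w≈ω-power : ∀ s → s ≡ t → ∀ j → RingHom.to ω-hom (ω-power s j) ≈ w (val j)
    w≈ω-power (+ n) ≡.refl j = begin
      RingHom.to ω-hom (Z.gen (j , 0) ^⟨ Z.ring ⟩ (q ℕ.^ n))
        ≈⟨ RingHom.^-homo ω-hom (Z.gen (j , 0)) (q ℕ.^ n) ⟩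
      root (e ℕ.* 0) (root (e ℕ.* n) (w (val j))) ^⟨ ringP ⟩ (q ℕ.^ n)
        ≡⟨ ≡.cong₂ (λ k l → root k (root (e ℕ.* n) (w (val j))) ^⟨ ringP ⟩ l) (ℕₚ.*-zeroʳ e) (q^≡p^ n) ⟩
      root (e ℕ.* n) (w (val j)) ^⟨ ringP ⟩ (p ℕ.^ (e ℕ.* n))
        ≈⟨ teich-powerⁿ (w-teich (val j)) (e ℕ.* n) ⟩
      w (val j) ∎
      where open SetoidReasoning setoid
    w≈ω-power -[1+ n ] ≡.refl j = teich-of-power (w-teich (val j)) (e ℕ.* suc n)


    series-hom : RingHom (PowerSeries.powerSeries (ℤ[ω].ring ⊤⁺)) powerSeries
    series-hom = mapSeries ω-hom

    series-hom-relation : ∀ n → RingHom.to series-hom p-relation n ≈ relationP n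
    series-hom-relation zero    = +-congˡ (-‿cong refl)
    series-hom-relation (suc n) = +-congˡ (-‿cong (w≈ω-power t ≡.refl _))

    ω-residue : RingHom (Polynomials 𝔽ₚ (Interval 1 ⊤⁺)) residue
    ω-residue = evalHom (𝔽ₚ-hom residue residue-char) (λ j → ω-value t (val j)) (λ ())

    module Pf = Perf ⊤⁺

    ψ₀-gen : ℕ × ∣ Polynomials 𝔽ₚ (Interval 1 ⊤⁺) ∣ → Carrier
    ψ₀-gen (n , x) = root n (RingHom.to ω-residue x)

    ψ₀-relation : ∀ {x y} → Pf.PerfectionRelation x y →
      Pf.eval residue (integer residue) ψ₀-gen x E.≈ Pf.eval residue (integer residue) ψ₀-gen y
    ψ₀-relation (Pf.resp n p)       = RingHom.cong (rootHom n) (RingHom.cong ω-residue p)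
    ψ₀-relation (Pf.additive n x y) = RingHom.+-homo (rootHom n) _ _
    ψ₀-relation (Pf.multiplicative n x y) = RingHom.*-homo (rootHom n) _ _
    ψ₀-relation (Pf.unital n)       = E.trans
      (RingHom.cong (rootHom n) (RingHom.1#-homo ω-residue))
      (E.trans (RingHom.1#-homo (rootHom n)) (E.sym (RingHom.1#-homo (integerHom residue))))
    ψ₀-relation (Pf.frobenius n x)  = begin
      root (suc n) (RingHom.to ω-residue (x ^⟨ Polynomials 𝔽ₚ (Interval 1 ⊤⁺) ⟩ p))
        ≈⟨ RingHom.cong (rootHom (suc n)) (RingHom.^-homo ω-residue x p) ⟩
      root (suc n) (RingHom.to ω-residue x ^⟨ residue ⟩ p)
        ≈⟨ RingHom.^-homo (rootHom (suc n)) (RingHom.to ω-residue x) p ⟩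
      root (suc n) (RingHom.to ω-residue x) ^⟨ residue ⟩ p
        ≈⟨ root-power (root n (RingHom.to ω-residue x)) ⟩
      root n (RingHom.to ω-residue x) ∎
      where open SetoidReasoning E.setoid

    ψ₀ : RingHom (ℒ₀ ⊤⁺) residue
    ψ₀ = evalHom (integerHom residue) ψ₀-gen ψ₀-relation

    -- Both sides evaluate the same term `f 0` in E, so naturality of evaluation suffices; `reduceℒ`
    -- is not asked to respect the equality of ℒ.
    ψ₀-reduce : ∀ f → RingHom.to ψ₀ (reduceℒ ⊤⁺ f) E.≈ RingHom.to ω-hom (f 0)
    ψ₀-reduce f = E.trans
      (eval-natural ψ₀ {φ′ = integer residue} {ρ′ = ω-root} (λ _ → E.refl) (λ _ → E.refl) (f 0))
      (E.sym (eval-natural toResidue {φ = integer ringP} {ρ = ω-root}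
        (integer-unique residue (toResidue ∘R integerHom ringP)) (λ _ → E.refl) (f 0)))

    ψ₀-ω-power : ∀ s → s ≡ t → ∀ j → RingHom.to ψ₀ (ωℒ₀-power ⊤⁺ s j) E.≈ w (val j)
    ψ₀-ω-power (+ n) ≡.refl j = begin
      RingHom.to ψ₀ (ωℒ₀ ⊤⁺ j 0 ^⟨ ℒ₀ ⊤⁺ ⟩ (q ℕ.^ n))
        ≈⟨ RingHom.^-homo ψ₀ (ωℒ₀ ⊤⁺ j 0) (q ℕ.^ n) ⟩
      root (e ℕ.* n) (w (val j)) ^⟨ residue ⟩ (q ℕ.^ n)
        ≡⟨ ≡.cong (λ k → root (e ℕ.* n) (w (val j)) ^⟨ residue ⟩ k) (q^≡p^ n) ⟩
      root (e ℕ.* n) (w (val j)) ^⟨ residue ⟩ (p ℕ.^ (e ℕ.* n))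
        ≈⟨ root-powerⁿ (e ℕ.* n) (w (val j)) ⟩
      w (val j) ∎
      where open SetoidReasoning E.setoid
    ψ₀-ω-power -[1+ n ] ≡.refl j =
      RingHom.cong toResidue (teich-of-power (w-teich (val j)) (e ℕ.* suc n))

  -- Of `B` only the vanishing of the relation and of π^(N+1) is asked, so `B` may be truncated at a
  -- lower order than N; `T-injective` relies on this freedom.
  module Target (N : ℕ) (B : CommutativeRing 0ℓ 0ℓ) (κ : RingHom powerSeries B)
    (κ-relation : CommutativeRing._≈_ B (RingHom.to κ relationP) (CommutativeRing.0# B))
    (κ-π : CommutativeRing._≈_ B (RingHom.to κ (variable-π ^⟨ powerSeries ⟩ suc N)) (CommutativeRing.0# B))
    where
    module B = CommutativeRing B
    private module κ = RingHom κ
    open B using () renaming (_≈_ to _≈ᴮ_; _+_ to _+ᴮ_; _*_ to _*ᴮ_)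
    open SetoidReasoning B.setoid

    const : RingHom ringP B
    const = κ ∘R constantHom
    private module const = RingHom const

    πᴮ : B.Carrier
    πᴮ = κ.to variable-π

    private
      σ : B.Carrier
      σ = κ.to (tail (expansion p ringP w))

    κ-head-tail : ∀ f → κ.to f ≈ᴮ const.to (f 0) +ᴮ πᴮ *ᴮ κ.to (tail f)
    κ-head-tail f = B.trans (κ.cong (head-tail f))
      (B.trans (κ.+-homo _ _) (B.+-congˡ (κ.*-homo _ _)))

    p≈expansion : multiple B p B.1# ≈ᴮ κ.to (expansion p ringP w)
    p≈expansion = begin
      multiple B p B.1#                            ≈⟨ const.multiple-homo p ⟨
      const.to p#                                  ≈⟨ RingProperties.x∙y⁻¹≈ε⇒x≈y B.ring _ _
        (B.trans (B.+-congˡ (B.sym (κ.-‿homo _))) (B.trans (B.sym (κ.+-homo _ _)) κ-relation)) ⟩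
      κ.to (expansion p ringP w)                   ∎

    p≈πσ : multiple B p B.1# ≈ᴮ πᴮ *ᴮ σ
    p≈πσ = begin
      multiple B p B.1#                            ≈⟨ p≈expansion ⟩
      κ.to (expansion p ringP w)                   ≈⟨ κ-head-tail (expansion p ringP w) ⟩
      const.to 0# +ᴮ πᴮ *ᴮ σ                       ≈⟨ B.+-congʳ const.0#-homo ⟩
      B.0# +ᴮ πᴮ *ᴮ σ                              ≈⟨ B.+-identityˡ _ ⟩
      πᴮ *ᴮ σ                                      ∎

    π^N+1≈0 : πᴮ ^⟨ B ⟩ suc N ≈ᴮ B.0#
    π^N+1≈0 = B.trans (B.sym (κ.^-homo variable-π (suc N))) κ-π

    -- As p is a multiple of π in `B`, f and y agree there modulo π. Their p^N-th powers then agree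
    -- modulo π^(N+1), which is 0.
    κ-power : ∀ f y → f 0 E.≈ y → κ.to f ^⟨ B ⟩ (p ℕ.^ N) ≈ᴮ const.to (y ^⟨ ringP ⟩ (p ℕ.^ N))
    κ-power f y f₀≈y =
      let z , eq = ≈/⇒difference f₀≈y
          c′ , eq′ = Frobenius.pⁿ-power-close prime-p B p≈πσ N (σ *ᴮ const.to z +ᴮ κ.to (tail f)) (begin
            κ.to f                                       ≈⟨ κ-head-tail f ⟩
            const.to (f 0) +ᴮ πᴮ *ᴮ κ.to (tail f)        ≈⟨ B.+-congʳ (const.cong eq) ⟩
            const.to (y + z * p#) +ᴮ πᴮ *ᴮ κ.to (tail f) ≈⟨ B.+-congʳ (B.trans (const.+-homo _ _)
              (B.+-congˡ (B.trans (const.*-homo z p#) (B.*-congˡ (B.trans (const.multiple-homo p) p≈πσ))))) ⟩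
            (const.to y +ᴮ const.to z *ᴮ (πᴮ *ᴮ σ)) +ᴮ πᴮ *ᴮ κ.to (tail f) ≈⟨ rearrange _ _ _ _ _ ⟩
            const.to y +ᴮ πᴮ *ᴮ (σ *ᴮ const.to z +ᴮ κ.to (tail f)) ∎) in begin
      κ.to f ^⟨ B ⟩ (p ℕ.^ N)                                   ≈⟨ eq′ ⟩
      const.to y ^⟨ B ⟩ (p ℕ.^ N) +ᴮ πᴮ ^⟨ B ⟩ suc N *ᴮ c′
        ≈⟨ B.+-congˡ (B.trans (B.*-congʳ π^N+1≈0) (B.zeroˡ c′)) ⟩
      const.to y ^⟨ B ⟩ (p ℕ.^ N) +ᴮ B.0#                       ≈⟨ B.+-identityʳ _ ⟩
      const.to y ^⟨ B ⟩ (p ℕ.^ N)                               ≈⟨ const.^-homo y (p ℕ.^ N) ⟨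
      const.to (y ^⟨ ringP ⟩ (p ℕ.^ N))                         ∎
      where
      open import Algebra.Solver.Ring.NaturalCoefficients.Default B.commutativeSemiring
        using (solve; _:=_; _:+_; _:*_)
      rearrange : ∀ y z π σ f → (y +ᴮ z *ᴮ (π *ᴮ σ)) +ᴮ π *ᴮ f ≈ᴮ y +ᴮ π *ᴮ (σ *ᴮ z +ᴮ f)
      rearrange = solve 5 (λ y z π σ f → (y :+ z :* (π :* σ)) :+ π :* f := y :+ π :* (σ :* z :+ f)) B.refl

    teichmüller : Carrier → B.Carrier
    teichmüller x = const.to (T N x)

    teichmüller-cong : ∀ {x y} → x E.≈ y → teichmüller x ≈ᴮ teichmüller y
    teichmüller-cong {x} {y} x≈y = B.trans (const.^-homo (root N x) (p ℕ.^ N))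
      (κ-power (constant (root N x)) (root N y) (RingHom.cong (rootHom N) x≈y))

    teichmüller-^ : ∀ x n → teichmüller (x ^⟨ ringP ⟩ n) ≈ᴮ teichmüller x ^⟨ B ⟩ n
    teichmüller-^ x n = B.trans (const.cong (T-^ N x n)) (const.^-homo (T N x) n)

    θ-series : (ℕ → Carrier) → Series
    θ-series a i = T N (root (e ℕ.* i) (a i))

    θ : (ℕ → Carrier) → B.Carrier
    θ a = κ.to (θ-series a)

    private
      sum-π : (ℕ → B.Carrier) → ℕ → B.Carrier
      sum-π x zero    = B.0#
      sum-π x (suc k) = sum-π x k +ᴮ x k *ᴮ πᴮ ^⟨ B ⟩ k

      drop : ℕ → Series → Series
      drop zero    f = f
      drop (suc k) f = tail (drop k f)

      drop-0 : ∀ k f i → drop k f i ≡ f (i ℕ.+ k)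
      drop-0 zero    f i = ≡.cong f (≡.sym (ℕₚ.+-identityʳ i))
      drop-0 (suc k) f i = ≡.trans (drop-0 k f (suc i)) (≡.cong f (≡.sym (ℕₚ.+-suc i k)))

      -- No continuity of κ is assumed. Splitting off k coefficients leaves a multiple of π^k, which
      -- vanishes for k = N + 1, so κ is determined by finitely many coefficients.
      κ-expand : ∀ k f → κ.to f ≈ᴮ sum-π (λ i → const.to (f i)) k +ᴮ πᴮ ^⟨ B ⟩ k *ᴮ κ.to (drop k f)
      κ-expand zero    f = B.sym (B.trans (B.+-identityˡ _) (B.*-identityˡ _))
      κ-expand (suc k) f = begin
        κ.to f                            ≈⟨ κ-expand k f ⟩
        s +ᴮ π^k *ᴮ κ.to (drop k f)       ≈⟨ B.+-congˡ (B.*-congˡ (κ-head-tail (drop k f))) ⟩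
        s +ᴮ π^k *ᴮ (const.to (drop k f 0) +ᴮ πᴮ *ᴮ d)
          ≡⟨ ≡.cong (λ x → s +ᴮ π^k *ᴮ (const.to x +ᴮ πᴮ *ᴮ d)) (drop-0 k f 0) ⟩
        s +ᴮ π^k *ᴮ (const.to (f k) +ᴮ πᴮ *ᴮ d)   ≈⟨ rearrange s π^k _ πᴮ d ⟩
        (s +ᴮ const.to (f k) *ᴮ π^k) +ᴮ (πᴮ *ᴮ π^k) *ᴮ d ∎
        where
        s   = sum-π (λ i → const.to (f i)) k
        π^k = πᴮ ^⟨ B ⟩ k
        d   = κ.to (drop (suc k) f)
        open import Algebra.Solver.Ring.NaturalCoefficients.Default B.commutativeSemiring
          using (solve; _:=_; _:+_; _:*_)
        rearrange : ∀ s P x π d → s +ᴮ P *ᴮ (x +ᴮ π *ᴮ d) ≈ᴮ (s +ᴮ x *ᴮ P) +ᴮ (π *ᴮ P) *ᴮ d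
        rearrange = solve 5 (λ s P x π d → s :+ P :* (x :+ π :* d) := (s :+ x :* P) :+ (π :* P) :* d) B.refl

      κ-truncate : ∀ f → κ.to f ≈ᴮ sum-π (λ i → const.to (f i)) (suc N)
      κ-truncate f = B.trans (κ-expand (suc N) f)
        (B.trans (B.+-congˡ (B.trans (B.*-congʳ π^N+1≈0) (B.zeroˡ _))) (B.+-identityʳ _))

      sum-π-cong : ∀ {x y} → (∀ i → x i ≈ᴮ y i) → ∀ k → sum-π x k ≈ᴮ sum-π y k
      sum-π-cong eq zero    = B.refl
      sum-π-cong eq (suc k) = B.+-cong (sum-π-cong eq k) (B.*-congʳ (eq k))

    κ-T-cong : ∀ {x y : ℕ → Carrier} → (∀ i → x i E.≈ y i) →
               κ.to (λ i → T N (x i)) ≈ᴮ κ.to (λ i → T N (y i))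
    κ-T-cong {x} {y} eq = B.trans (κ-truncate (λ i → T N (x i)))
      (B.trans (sum-π-cong (λ i → teichmüller-cong (eq i)) (suc N)) (B.sym (κ-truncate (λ i → T N (y i)))))

    module _ (a b : ℕ → Carrier) where
      private
        variables : ℕ ⊎ ℕ → Carrier
        variables (inj₁ i) = a i
        variables (inj₂ i) = b i

        module L = ℒ[X,Y]
        module L₀ = ℒ₀[X,Y]

        root-ψ : (ℕ ⊎ ℕ) × ℕ → Carrier
        root-ψ (v , n) = root n (variables v)

        ℒ→B : RingHom (ℒ ⊤⁺) B
        ℒ→B = factorHom {R = PowerSeries.powerSeries (ℤ[ω].ring ⊤⁺)} (κ ∘R series-hom) λ
          { (inj₁ eq) → B.trans (κ.cong (λ i → trans (RingHom.cong ω-hom (Zr.sym (eq i))) (series-hom-relation i))) κ-relation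
          ; (inj₂ eq) → B.trans (κ.cong (λ i → trans (RingHom.cong ω-hom (Zr.sym (eq i))) (RingHom.0#-homo ω-hom))) κ.0#-homo }
          where module Zr = CommutativeRing (ℤ[ω].ring ⊤⁺)

        h-gen : (ℕ ⊎ ℕ) × ℕ → B.Carrier
        h-gen x = teichmüller (root-ψ x)

        h-relation : ∀ {x y} → L.RootRelation x y →
          L.eval B (RingHom.to ℒ→B) h-gen x ≈ᴮ L.eval B (RingHom.to ℒ→B) h-gen y
        h-relation (L.root v n) = begin
          L.eval B (RingHom.to ℒ→B) h-gen (L.gen (v , suc n) L.⊛^ p)
            ≈⟨ eval-^ {S = B} (RingHom.1#-homo ℒ→B) (L.gen (v , suc n)) p ⟩
          teichmüller (root (suc n) (variables v)) ^⟨ B ⟩ p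
            ≈⟨ teichmüller-^ (root (suc n) (variables v)) p ⟨
          teichmüller (root (suc n) (variables v) ^⟨ ringP ⟩ p)
            ≈⟨ teichmüller-cong (E.trans (E.sym (^-residue _ p)) (root-power (root n (variables v)))) ⟩
          teichmüller (root n (variables v)) ∎

        h : RingHom L.ring B
        h = evalHom ℒ→B h-gen h-relation

        h-π : RingHom.to h (L.con (πℒ ⊤⁺)) ≈ᴮ πᴮ
        h-π = κ.cong λ
          { zero → RingHom.0#-homo ω-hom ; (suc zero) → RingHom.1#-homo ω-hom
          ; (suc (suc _)) → RingHom.0#-homo ω-hom }

        h-truncated : RingHom (L.ring /⟨ L.con (πℒ ⊤⁺) ^⟨ L.ring ⟩ suc N ⟩) B
        h-truncated = factorHom h λ eq → B.trans (RingHom.cong h (CommutativeRing.sym L.ring eq))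
          (B.trans (RingHom.^-homo h (L.con (πℒ ⊤⁺)) (suc N))
            (B.trans (Exp.^-congˡ B.commutativeSemiring (suc N) h-π) π^N+1≈0))

        -- Since π^(N+1) = 0 in `B`, an element of the completion acts through its entry modulo
        -- π^(N+1).
        H : RingHom Ĉ B
        H = makeHom {R = Ĉ} {S = B} (λ z → RingHom.to h (ℒ[X,Y]^.seq z (suc N)))
          (λ {x} {y} eq → RingHom.cong h-truncated {ℒ[X,Y]^.seq x (suc N)} {ℒ[X,Y]^.seq y (suc N)} (eq (suc N)))
          (λ _ _ → B.refl) (λ _ _ → B.refl) (RingHom.1#-homo h)

        ℒ→E : RingHom (ℒ ⊤⁺) residue
        ℒ→E = factorHom {R = PowerSeries.powerSeries (ℤ[ω].ring ⊤⁺)}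
          (toResidue ∘R constantCoefficient ringP ∘R series-hom) λ
          { (inj₁ eq) → E.trans (RingHom.cong toResidue (trans (RingHom.cong ω-hom (Zr.sym (eq 0)))
                         (trans (series-hom-relation 0) (trans (+-congˡ -0#≈0#) (+-identityʳ _))))) p#≈0
          ; (inj₂ eq) → RingHom.cong toResidue (trans (RingHom.cong ω-hom (Zr.sym (eq 0))) (RingHom.0#-homo ω-hom)) }
          where
          module Zr = CommutativeRing (ℤ[ω].ring ⊤⁺)
          open RingProperties (CommutativeRing.ring ringP) using (-0#≈0#)

        r-relation : ∀ {x y} → L.RootRelation x y →
          L.eval residue (RingHom.to ℒ→E) root-ψ x E.≈ L.eval residue (RingHom.to ℒ→E) root-ψ y
        r-relation (L.root v n) = E.trans
          (eval-^ {S = residue} (RingHom.1#-homo ℒ→E) (L.gen (v , suc n)) p)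
          (root-power (root n (variables v)))

        r : RingHom L.ring residue
        r = evalHom ℒ→E root-ψ r-relation

        r-step : ∀ z n → RingHom.to r (ℒ[X,Y]^.seq z (suc (suc n))) E.≈ RingHom.to r (ℒ[X,Y]^.seq z (suc n))
        r-step z n = RingHom.cong r-truncated {ℒ[X,Y]^.seq z (suc (suc n))} {ℒ[X,Y]^.seq z (suc n)}
          (ℒ[X,Y]^.coherent z (suc n))
          where
          r-π : RingHom.to r (L.con (πℒ ⊤⁺)) E.≈ E.0#
          r-π = RingHom.cong toResidue (RingHom.0#-homo ω-hom)
          r-truncated : RingHom (L.ring /⟨ L.con (πℒ ⊤⁺) ^⟨ L.ring ⟩ suc n ⟩) residue
          r-truncated = factorHom r λ eq → E.trans (RingHom.cong r (CommutativeRing.sym L.ring eq))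
            (E.trans (RingHom.*-homo r (L.con (πℒ ⊤⁺)) (L.con (πℒ ⊤⁺) ^⟨ L.ring ⟩ n))
              (E.trans (E.*-congʳ r-π) (E.zeroˡ _)))

        -- `reduce` reads the entry at level 1 and `H` the entry at level N + 1; coherence makes
        -- them equal modulo π.
        r-seq : ∀ z n → RingHom.to r (ℒ[X,Y]^.seq z (suc n)) E.≈ RingHom.to r (ℒ[X,Y]^.seq z 1)
        r-seq z zero    = E.refl
        r-seq z (suc n) = E.trans (r-step z n) (r-seq z n)

        ψ-relation : ∀ {x y} → L₀.RootRelation x y →
          L₀.eval residue (RingHom.to ψ₀) root-ψ x E.≈ L₀.eval residue (RingHom.to ψ₀) root-ψ y
        ψ-relation (L₀.root v n) = E.trans
          (eval-^ {S = residue} (RingHom.1#-homo ψ₀) (L₀.gen (v , suc n)) p)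
          (root-power (root n (variables v)))

        ψ : RingHom L₀.ring residue
        ψ = evalHom ψ₀ root-ψ ψ-relation

        r≈ψ : ∀ z → RingHom.to r (ℒ[X,Y]^.seq z 1) E.≈ RingHom.to ψ (reduce z)
        r≈ψ z = E.sym (eval-natural ψ (λ f → ψ₀-reduce f) (λ _ → E.refl) (ℒ[X,Y]^.seq z 1))

        lift-gen : (ℕ ⊎ ℕ) × ℕ → Series
        lift-gen x = constant (T N (root-ψ x))

        -- Represents the value of h by a power series, because `κ-power` speaks of series. It is a
        -- function on raw terms: the root relations matter only after κ.
        lift : L.Term → Series
        lift = L.eval powerSeries (RingHom.to series-hom) lift-gen

        κ-lift : ∀ x → κ.to (lift x) ≈ᴮ RingHom.to h x
        κ-lift = eval-natural κ (λ _ → B.refl) (λ _ → B.refl)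

        lift-residue : ∀ x → lift x 0 E.≈ RingHom.to r x
        lift-residue = eval-natural (toResidue ∘R constantCoefficient ringP)
          (λ _ → E.refl) (λ x → T-residue N (root-ψ x))

      module _ (τ : MultiplicativeSection) where
        open MultiplicativeSection τ using ([[_]]; *-homo; 1#-homo; section) renaming (cong to [[]]-cong)
        private
          module C = CommutativeRing Ĉ
          module L₀R = CommutativeRing L₀.ring

          ℒ₀-char : let module R = CommutativeRing (ℒ₀ ⊤⁺) in multiple (ℒ₀ ⊤⁺) p R.1# R.≈ R.0#
          ℒ₀-char = char-p (toPerfection prime-p ∘R conHom {R = 𝔽ₚ} (λ _ _ → Data.Empty.⊥))

          roots : HasRoots (p ℕ.^ N) L₀.ring
          roots = roots-pⁿ prime-p {R = L₀.ring} (rootPolynomials-roots prime-p ℒ₀-char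
            (perfection-roots prime-p ℒ₀-char)) N

          [[]]-^ : ∀ x n → [[ x ^⟨ L₀.ring ⟩ n ]] C.≈ [[ x ]] ^⟨ Ĉ ⟩ n
          [[]]-^ x zero    = 1#-homo
          [[]]-^ x (suc n) = C.trans {[[ x L₀R.* x ^⟨ L₀.ring ⟩ n ]]} {[[ x ]] C.* [[ x ^⟨ L₀.ring ⟩ n ]]} {[[ x ]] C.* [[ x ]] ^⟨ Ĉ ⟩ n}
            (*-homo x _) (C.*-congˡ {[[ x ]]} {[[ x ^⟨ L₀.ring ⟩ n ]]} {[[ x ]] ^⟨ Ĉ ⟩ n} ([[]]-^ x n))

          -- Write x = y^(p^N), so that [[ x ]] is the p^N-th power of [[ y ]]. By `section` only
          -- the residue of [[ y ]] is known, and it is the p^N-th root of ψ(x) in E; by `κ-power`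
          -- the residue determines the p^N-th power in `B`.
          H-[[]] : ∀ x → RingHom.to H [[ x ]] ≈ᴮ teichmüller (RingHom.to ψ x)
          H-[[]] x = let y , y^≈x = roots x ; z = ℒ[X,Y]^.seq [[ y ]] (suc N) in begin
            RingHom.to H [[ x ]]
              ≈⟨ RingHom.cong H {[[ y ^⟨ L₀.ring ⟩ (p ℕ.^ N) ]]} {[[ x ]]} ([[]]-cong y^≈x) ⟨
            RingHom.to H [[ y ^⟨ L₀.ring ⟩ (p ℕ.^ N) ]]
              ≈⟨ RingHom.cong H {[[ y ^⟨ L₀.ring ⟩ (p ℕ.^ N) ]]} {[[ y ]] ^⟨ Ĉ ⟩ (p ℕ.^ N)} ([[]]-^ y (p ℕ.^ N)) ⟩
            RingHom.to H ([[ y ]] ^⟨ Ĉ ⟩ (p ℕ.^ N))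
              ≈⟨ RingHom.^-homo H [[ y ]] (p ℕ.^ N) ⟩
            RingHom.to h z ^⟨ B ⟩ (p ℕ.^ N)
              ≈⟨ Exp.^-congˡ B.commutativeSemiring (p ℕ.^ N) (κ-lift z) ⟨
            κ.to (lift z) ^⟨ B ⟩ (p ℕ.^ N)
              ≈⟨ κ-power (lift z) (root N (RingHom.to ψ x)) (E.trans (lift-residue z)
                   (E.trans (r-seq [[ y ]] N) (E.trans (r≈ψ [[ y ]])
                     (E.trans (RingHom.cong ψ (section y)) (E.sym (E.trans
                       (RingHom.cong (rootHom N) (E.trans (RingHom.cong ψ (L₀R.sym y^≈x)) (RingHom.^-homo ψ y (p ℕ.^ N))))
                       (root-of-power N (RingHom.to ψ y)))))))) ⟩
            teichmüller (RingHom.to ψ x) ∎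

          H-series : ∀ x → RingHom.to H (ℒ[X,Y]^.series x) ≈ᴮ sum-π (λ i → RingHom.to H (x i)) (suc N)
          H-series x = B.trans
            (B.reflexive (≡.cong (RingHom.to h) (seq-series L.ring (L.con (πℒ ⊤⁺)) x N)))
            (go (suc N))
            where
            go : ∀ k → RingHom.to h (partial-sum L.ring (L.con (πℒ ⊤⁺)) x (suc N) k)
                       ≈ᴮ sum-π (λ i → RingHom.to H (x i)) k
            go zero    = RingHom.0#-homo h
            go (suc k) = B.+-cong (go k) (B.*-congˡ (B.trans (RingHom.^-homo h (L.con (πℒ ⊤⁺)) k)
              (Exp.^-congˡ B.commutativeSemiring k h-π)))

          module _ {_∗_ : ∣ Ĉ ∣ → ∣ Ĉ ∣ → ∣ Ĉ ∣} (Q∗ : ArithmeticPolynomials τ _∗_) where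
            open ArithmeticPolynomials Q∗ using (Q; equation) renaming (root to rootQ; root-Q to rootQ-Q)

            ψ-Q : ∀ i → RingHom.to ψ (toℒ₀[X,Y] i (Q i)) E.≈ evaluateℕ residue w Q a b i
            ψ-Q i = eval-natural ψ (λ _ → E.refl) (λ
              { (inj₁ j)        → ψ₀-ω-power t ≡.refl _
              ; (inj₂ (inj₁ _)) → E.refl
              ; (inj₂ (inj₂ _)) → E.refl }) (Q i)

            -- In E the map `root` undoes the power map, so `root-Q` pins down the image of
            -- `rootQ i` as the q^i-th root of the value of Q_i.
            ψ-root : ∀ i → RingHom.to ψ (rootQ i) E.≈ root (e ℕ.* i) (evaluateℕ residue w Q a b i)
            ψ-root i = E.sym (E.trans
              (RingHom.cong (rootHom (e ℕ.* i)) (E.trans (E.sym (ψ-Q i))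
                (E.trans (RingHom.cong ψ (L₀R.sym (rootQ-Q i))) (E.trans (RingHom.^-homo ψ (rootQ i) (q ℕ.^ i))
                  (E.reflexive (≡.cong (λ k → RingHom.to ψ (rootQ i) ^⟨ residue ⟩ k) (q^≡p^ i)))))))
              (root-of-power (e ℕ.* i) (RingHom.to ψ (rootQ i))))

            H-equation : RingHom.to H (ℒ[X,Y]^.series X ∗ ℒ[X,Y]^.series Y) ≈ᴮ θ (evaluateℕ residue w Q a b)
            H-equation = begin
              RingHom.to H (ℒ[X,Y]^.series X ∗ ℒ[X,Y]^.series Y)
                ≈⟨ RingHom.cong H {ℒ[X,Y]^.series X ∗ ℒ[X,Y]^.series Y} {ℒ[X,Y]^.series (λ i → [[ rootQ i ]])} equation ⟩
              RingHom.to H (ℒ[X,Y]^.series (λ i → [[ rootQ i ]]))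
                ≈⟨ H-series (λ i → [[ rootQ i ]]) ⟩
              sum-π (λ i → RingHom.to H [[ rootQ i ]]) (suc N)
                ≈⟨ sum-π-cong (λ i → B.trans (H-[[]] (rootQ i)) (teichmüller-cong (ψ-root i))) (suc N) ⟩
              sum-π (λ i → teichmüller (root (e ℕ.* i) (evaluateℕ residue w Q a b i))) (suc N)
                ≈⟨ κ-truncate (θ-series (evaluateℕ residue w Q a b)) ⟨
              θ (evaluateℕ residue w Q a b) ∎

          H-X : RingHom.to H (ℒ[X,Y]^.series X) ≈ᴮ θ a
          H-X = B.trans (H-series X) (B.sym (κ-truncate (θ-series a)))

          H-Y : RingHom.to H (ℒ[X,Y]^.series Y) ≈ᴮ θ b
          H-Y = B.trans (H-series Y) (B.sym (κ-truncate (θ-series b)))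

        θ-+ : (Q⁺ : ArithmeticPolynomials τ C._+_) →
              θ (evaluateℕ residue w (ArithmeticPolynomials.Q Q⁺) a b) ≈ᴮ θ a +ᴮ θ b
        θ-+ Q⁺ = B.trans (B.sym (H-equation Q⁺)) (B.trans
          (RingHom.+-homo H (ℒ[X,Y]^.series X) (ℒ[X,Y]^.series Y)) (B.+-cong H-X H-Y))

        θ-* : (Q× : ArithmeticPolynomials τ C._*_) →
              θ (evaluateℕ residue w (ArithmeticPolynomials.Q Q×) a b) ≈ᴮ θ a *ᴮ θ b
        θ-* Q× = B.trans (B.sym (H-equation Q×)) (B.trans
          (RingHom.*-homo H (ℒ[X,Y]^.series X) (ℒ[X,Y]^.series Y)) (B.*-cong H-X H-Y))

-- Injectivity of θ

-- A syntax for the identities to be transferred. Every term has a reading in coordinates over any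
-- ring, `⟦_⟧`, and a reading as an element of the truncated ring, `value`; θ sends the first to the
-- second.
data Expr (v : ℕ) : Set where
  var             : Fin v → Expr v
  𝟎 𝟙 𝛑 p-coords  : Expr v
  _⊞_ _⊠_         : Expr v → Expr v → Expr v
  head shift      : Fin v → Expr v
  head*           : Fin v → Fin v → Expr v
  take drop       : ℕ → Fin v → Expr v

infixl 6 _⊞_
infixl 7 _⊠_

_•_ : ∀ {v} → ℕ → Expr v → Expr v
zero  • x = 𝟎
suc n • x = x ⊞ n • x

module _ {a} {A : Set a} (0# : A) where

  leadingSequence : A → ℕ → A
  leadingSequence x zero    = x
  leadingSequence x (suc _) = 0#

  takeSequence dropSequence : ℕ → (ℕ → A) → ℕ → A
  takeSequence zero    x i       = 0#
  takeSequence (suc n) x zero    = x 0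
  takeSequence (suc n) x (suc i) = takeSequence n (λ j → x (suc j)) i
  dropSequence zero    x i       = x i
  dropSequence (suc n) x zero    = 0#
  dropSequence (suc n) x (suc i) = dropSequence n (λ j → x (suc j)) i

  take-drop : ∀ n x i → (takeSequence n x i ≡ x i × dropSequence n x i ≡ 0#)
                      ⊎ (takeSequence n x i ≡ 0# × dropSequence n x i ≡ x i)
  take-drop zero    x i       = inj₂ (≡.refl , ≡.refl)
  take-drop (suc n) x zero    = inj₁ (≡.refl , ≡.refl)
  take-drop (suc n) x (suc i) = take-drop n (λ j → x (suc j)) i

module Sequences (q : ℕ) (K : CommutativeRing c ℓ) (w : ℕ → ∣ K ∣) where
  open CommutativeRing K

  Sequence : Set c
  Sequence = ℕ → Carrier

  infix 4 _≈[≤_]_ _≋_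
  _≈[≤_]_ : Sequence → ℕ → Sequence → Set ℓ
  a ≈[≤ n ] b = ∀ i → i ℕ.≤ n → a i ≈ b i

  _≋_ : Sequence → Sequence → Set ℓ
  a ≋ b = ∀ i → a i ≈ b i

  leading : Carrier → Sequence
  leading = leadingSequence 0#

  π-sequence : Sequence
  π-sequence zero    = 0#
  π-sequence (suc i) = leading 1# i

  frobeniusShift : Sequence → Sequence
  frobeniusShift a zero    = 0#
  frobeniusShift a (suc i) = a i ^⟨ K ⟩ q

  -- The coordinates of p = Σ [wⱼ] πʲ: the power q^j compensates for the q^j-th root that θ takes in
  -- position j.
  p-sequence : Sequence
  p-sequence zero    = 0#
  p-sequence (suc i) = w (suc i) ^⟨ K ⟩ (q ℕ.^ suc i)

module Semantics (p e : ℕ) (t : ℤ) (K : CommutativeRing c ℓ) (w : ℕ → ∣ K ∣)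
                 (Q⁺ Q× : ∀ i → Setup.IntegralPolynomial p e t i) where
  open Setup p e t using (q)
  open Evaluate p e t
  open CommutativeRing K
  open Sequences q K w public

  infixl 6 _⊕_
  infixl 7 _⊗_
  _⊕_ _⊗_ : Sequence → Sequence → Sequence
  _⊕_ = evaluateℕ K w Q⁺
  _⊗_ = evaluateℕ K w Q×

  ⟦_⟧ : ∀ {v} → Expr v → (Fin v → Sequence) → Sequence
  ⟦ var i ⟧    ρ = ρ i
  ⟦ 𝟎 ⟧        ρ = λ _ → 0#
  ⟦ 𝟙 ⟧        ρ = leading 1#
  ⟦ 𝛑 ⟧        ρ = π-sequence
  ⟦ p-coords ⟧ ρ = p-sequence
  ⟦ x ⊞ y ⟧    ρ = ⟦ x ⟧ ρ ⊕ ⟦ y ⟧ ρ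
  ⟦ x ⊠ y ⟧    ρ = ⟦ x ⟧ ρ ⊗ ⟦ y ⟧ ρ
  ⟦ head i ⟧   ρ = leading (ρ i 0)
  ⟦ shift i ⟧  ρ = frobeniusShift (ρ i)
  ⟦ head* i j ⟧ ρ = leading (ρ i 0 * ρ j 0)
  ⟦ take n i ⟧ ρ = takeSequence 0# n (ρ i)
  ⟦ drop n i ⟧ ρ = dropSequence 0# n (ρ i)

module ResidueLaws (p e : ℕ) (t : ℤ) (prime-p : Prime p) (P : PerfectLift p)
                   (w : ℕ → PerfectLift.Carrier P)
                   (w-teich : ∀ j → Residue.Teichmüller prime-p P (w j)) where
  open Setup p e t
  open PerfectLift P renaming (ring to ringP)
  open Residue prime-p P
  open SeriesFacts ringP
  open Core p e t prime-p P w w-teich using (relationP; module Target)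
  private
    module S = CommutativeRing powerSeries
    module RP = RingProperties (CommutativeRing.ring ringP)

    π^ : ℕ → Series
    π^ n = variable-π ^⟨ powerSeries ⟩ n

  module Truncation (n : ℕ) where
    private
      generators : Series → Set
      generators z = relationP S.≈ z ⊎ π^ (suc n) S.≈ z
      module Q = Quotient powerSeries generators

    truncation : CommutativeRing 0ℓ 0ℓ
    truncation = powerSeries /⟨ relationP ⨾ π^ (suc n) ⟩

    projection : RingHom powerSeries truncation
    projection = quotientHom

    congruent : ∀ f g → CommutativeRing._≈_ truncation f g →
      ∃ λ u → ∃ λ v → ∀ i → f i - g i ≈ (u ⋆ relationP) i + (v ⋆ π^ (suc n)) i
    congruent f g eq = combination-of powerSeries relationP (π^ (suc n)) eq

    congruent⁻¹ : ∀ f g u v → (∀ i → f i - g i ≈ (u ⋆ relationP) i + (v ⋆ π^ (suc n)) i) →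
                  CommutativeRing._≈_ truncation f g
    congruent⁻¹ f g u v eq = Q.resp∈ (λ i → sym (eq i))
      (Q.sum∈ (Q.multiple∈ u (Q.generator (inj₁ S.refl))) (Q.multiple∈ v (Q.generator (inj₂ S.refl))))

    projection-relation : CommutativeRing._≈_ truncation relationP (CommutativeRing.0# truncation)
    projection-relation = ideal⇒≈/0 {R = powerSeries} (Q.generator (inj₁ S.refl))

    projection-π : ∀ {N} → n ℕ.≤ N → CommutativeRing._≈_ truncation (π^ (suc N)) (CommutativeRing.0# truncation)
    projection-π n≤N with o , ≡.refl ← ℕₚ.m≤n⇒∃[o]m+o≡n n≤N =
      ideal⇒≈/0 {R = powerSeries} (Q.resp∈
        (S.trans (S.*-comm (π^ o) (π^ (suc n))) (S.sym (^-homo-* variable-π (suc n) o)))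
        (Q.multiple∈ (π^ o) (Q.generator (inj₂ S.refl))))
      where open Exp S.commutativeSemiring using (^-homo-*)

    module At {N} (n≤N : n ℕ.≤ N) =
      Target N truncation projection projection-relation (projection-π n≤N)

  private
    constant-term : ∀ n (u v : Series) → (u ⋆ relationP) 0 + (v ⋆ π^ (suc n)) 0 ≈ u 0 * p#
    constant-term n u v = begin
      u 0 * (p# - 0#) + v 0 * (0# * _)
        ≈⟨ +-cong (*-congˡ (trans (+-congˡ RP.-0#≈0#) (+-identityʳ p#))) (trans (*-congˡ (zeroˡ _)) (zeroʳ _)) ⟩
      u 0 * p# + 0#                        ≈⟨ +-identityʳ _ ⟩
      u 0 * p#                             ∎
      where open SetoidReasoning setoid

    -- The coefficient u₀ is killed by p and hence 0, so u = π (tail u). Coefficient i + 1 of the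
    -- given equation is then coefficient i of the desired one, with π^(n+2) lowered to π^(n+1).
    cancel-π : ∀ n (f g : Series) → let open CommutativeRing (Truncation.truncation (suc n)) using () renaming (_≈_ to _≈ᴮ_) in
      (variable-π ⋆ f) ≈ᴮ (variable-π ⋆ g) → CommutativeRing._≈_ (Truncation.truncation n) f g
    cancel-π n f g eq =
      let u , v , coefficients = Truncation.congruent (suc n) (variable-π ⋆ f) (variable-π ⋆ g) eq
          u₀≈0 = torsion-free (u 0) (begin
            u 0 * p#                                                ≈⟨ constant-term (suc n) u v ⟨
            (u ⋆ relationP) 0 + (v ⋆ π^ (suc (suc n))) 0            ≈⟨ coefficients 0 ⟨
            (variable-π ⋆ f) 0 - (variable-π ⋆ g) 0                 ≈⟨ +-cong (π⋆-zero f) (trans (-‿cong (π⋆-zero g)) RP.-0#≈0#) ⟩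
            0# + 0#                                                 ≈⟨ +-identityˡ 0# ⟩
            0#                                                      ∎)
          πu : u S.≈ variable-π ⋆ tail u
          πu = λ { zero → trans u₀≈0 (sym (π⋆-zero (tail u))) ; (suc i) → sym (π⋆-suc (tail u) i) }
      in Truncation.congruent⁻¹ n f g (tail u) v λ i → begin
        f i - g i
          ≈⟨ +-cong (π⋆-suc f i) (-‿cong (π⋆-suc g i)) ⟨
        (variable-π ⋆ f) (suc i) - (variable-π ⋆ g) (suc i)
          ≈⟨ coefficients (suc i) ⟩
        (u ⋆ relationP) (suc i) + (v ⋆ π^ (suc (suc n))) (suc i)
          ≈⟨ +-cong (S.*-congʳ {relationP} πu (suc i)) (S.*-comm v (π^ (suc (suc n))) (suc i)) ⟩
        ((variable-π ⋆ tail u) ⋆ relationP) (suc i) + (π^ (suc (suc n)) ⋆ v) (suc i)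
          ≈⟨ +-cong (S.*-assoc variable-π (tail u) relationP (suc i)) (S.*-assoc variable-π (π^ (suc n)) v (suc i)) ⟩
        (variable-π ⋆ (tail u ⋆ relationP)) (suc i) + (variable-π ⋆ (π^ (suc n) ⋆ v)) (suc i)
          ≈⟨ +-cong (π⋆-suc (tail u ⋆ relationP) i) (trans (π⋆-suc (π^ (suc n) ⋆ v) i) (S.*-comm (π^ (suc n)) v i)) ⟩
        (tail u ⋆ relationP) i + (v ⋆ π^ (suc n)) i ∎
      where open SetoidReasoning setoid

    -- The constant coefficients show that the first entries agree modulo p, so their Teichmüller
    -- lifts are equal in the quotient. Subtracting them and cancelling π lowers n by one; N stays
    -- fixed, since the representatives `T N` must not change during the induction.
    T-injective : ∀ n {N} → n ℕ.≤ N → ∀ (x y : ℕ → Carrier) →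
      CommutativeRing._≈_ (Truncation.truncation n) (λ i → T N (x i)) (λ i → T N (y i)) →
      ∀ i → i ℕ.≤ n → x i E.≈ y i
    T-injective n {N} n≤N x y eq zero _ =
      let u , v , coefficients = Truncation.congruent n (λ i → T N (x i)) (λ i → T N (y i)) eq in
      E.trans (E.sym (T-residue N (x 0))) (E.trans
        (≈/0-difference u (trans (coefficients 0) (constant-term n u v))) (T-residue N (y 0)))
      where
      ≈/0-difference : ∀ (u : Series) {x y} → x - y ≈ u 0 * p# → x E.≈ y
      ≈/0-difference u eq = resp∈ (sym eq) (multiple∈ (u 0) (generator refl))
    T-injective (suc n) {N} n+1≤N x y eq (suc i) (s≤s i≤n) =
      T-injective n (ℕₚ.<⇒≤ n+1≤N) (λ j → x (suc j)) (λ j → y (suc j))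
        (cancel-π n (tail F) (tail G) (cancel-head eq)) i i≤n
      where
      F G : Series
      F j = T N (x j)
      G j = T N (y j)
      open Truncation (suc n) using (truncation; module At)
      open At n+1≤N using (κ-head-tail; teichmüller-cong; const)
      module B = CommutativeRing truncation
      head≈ : RingHom.to const (F 0) B.≈ RingHom.to const (G 0)
      head≈ = teichmüller-cong {x 0} {y 0} (T-injective (suc n) n+1≤N x y eq 0 z≤n)
      cancel-head : F B.≈ G → (variable-π ⋆ tail F) B.≈ (variable-π ⋆ tail G)
      cancel-head F≈G = RingProperties.+-cancelˡ B.ring
        (RingHom.to const (F 0)) (variable-π ⋆ tail F) (variable-π ⋆ tail G)
        (B.trans {RingHom.to const (F 0) B.+ (variable-π ⋆ tail F)} {F} {RingHom.to const (F 0) B.+ (variable-π ⋆ tail G)}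
          (B.sym {F} {RingHom.to const (F 0) B.+ (variable-π ⋆ tail F)} (κ-head-tail F))
          (B.trans {F} {G} {RingHom.to const (F 0) B.+ (variable-π ⋆ tail G)} F≈G
            (B.trans {G} {RingHom.to const (G 0) B.+ (variable-π ⋆ tail G)} {RingHom.to const (F 0) B.+ (variable-π ⋆ tail G)}
              (κ-head-tail G)
              (B.+-congʳ {variable-π ⋆ tail G} {RingHom.to const (G 0)} {RingHom.to const (F 0)}
                (B.sym {RingHom.to const (F 0)} {RingHom.to const (G 0)} head≈)))))

  θ-injective : ∀ n (a b : ℕ → Carrier) → let open Truncation n in
    CommutativeRing._≈_ truncation (At.θ (ℕₚ.≤-refl {n}) a) (At.θ (ℕₚ.≤-refl {n}) b) → a n E.≈ b n
  θ-injective n a b eq = begin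
    a n                                                       ≈⟨ root-powerⁿ (e ℕ.* n) (a n) ⟨
    root (e ℕ.* n) (a n) ^⟨ residue ⟩ (p ℕ.^ (e ℕ.* n))
      ≈⟨ Exp.^-congˡ E.commutativeSemiring (p ℕ.^ (e ℕ.* n))
           (T-injective n ℕₚ.≤-refl (λ i → root (e ℕ.* i) (a i)) (λ i → root (e ℕ.* i) (b i)) eq n ℕₚ.≤-refl) ⟩
    root (e ℕ.* n) (b n) ^⟨ residue ⟩ (p ℕ.^ (e ℕ.* n))       ≈⟨ root-powerⁿ (e ℕ.* n) (b n) ⟩
    b n                                                       ∎
    where open SetoidReasoning E.setoid

-- Values of terms in the truncated rings

module Interpretation (p e : ℕ) (t : ℤ) (prime-p : Prime p) (P : PerfectLift p)
  (w : ℕ → PerfectLift.Carrier P) (w-teich : ∀ j → Residue.Teichmüller prime-p P (w j))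
  {τ : Setup.MultiplicativeSection p e t}
  (Q⁺ : Setup.ArithmeticPolynomials p e t τ (CommutativeRing._+_ (Setup.Ĉ p e t)))
  (Q× : Setup.ArithmeticPolynomials p e t τ (CommutativeRing._*_ (Setup.Ĉ p e t)))
  where
  open Setup p e t using (q; module ArithmeticPolynomials)
  open ArithmeticPolynomials using (Q)
  open PerfectLift P renaming (ring to ringP)
  open Residue prime-p P
  open SeriesFacts ringP
  open Core p e t prime-p P w w-teich using (relationP; module Target)
  open Semantics p e t residue w (Q Q⁺) (Q Q×)

  module _ (N : ℕ) (B : CommutativeRing 0ℓ 0ℓ) (κ : RingHom powerSeries B)
    (κ-relation : CommutativeRing._≈_ B (RingHom.to κ relationP) (CommutativeRing.0# B))
    (κ-π : CommutativeRing._≈_ B (RingHom.to κ (variable-π ^⟨ powerSeries ⟩ suc N)) (CommutativeRing.0# B))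
    where
    open Target N B κ κ-relation κ-π
    private
      module κ = RingHom κ
      module RN = RingHom (iterate ρ N)
    open B using () renaming (_≈_ to _≈ᴮ_; _+_ to _+ᴮ_; _*_ to _*ᴮ_)
    open Exp commutativeSemiring using (^-congˡ)
    open Mult B.semiring using (×-assoc-*; ×1-homo-*; ×-congʳ) renaming (_×_ to _·_)

    private
      T-cong : ∀ {x y} → x ≈ y → T N x ≈ T N y
      T-cong eq = ^-congˡ (p ℕ.^ N) (RN.cong eq)

      T-root-0 : ∀ k → T N (root k 0#) ≈ 0#
      T-root-0 k = trans (T-cong (RingHom.0#-homo (iterate ρ k))) (T-0 N)

      root-e0 : ∀ x → T N (root (e ℕ.* 0) x) ≈ T N x
      root-e0 x = reflexive (≡.cong (λ k → T N (root k x)) (ℕₚ.*-zeroʳ e))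

      θ-0 : θ (λ _ → 0#) ≈ᴮ B.0#
      θ-0 = B.trans (κ.cong (λ i → T-root-0 (e ℕ.* i))) κ.0#-homo

      θ-leading : ∀ x → θ (leading x) ≈ᴮ teichmüller x
      θ-leading x = κ.cong (λ { zero → root-e0 x ; (suc i) → T-root-0 (e ℕ.* suc i) })

      teichmüller-1 : teichmüller 1# ≈ᴮ B.1#
      teichmüller-1 = B.trans (RingHom.cong const (T-1 N)) (RingHom.1#-homo const)

      θ-π : θ π-sequence ≈ᴮ πᴮ
      θ-π = κ.cong λ
        { zero          → T-root-0 (e ℕ.* 0)
        ; (suc zero)    → trans (T-cong (RingHom.1#-homo (iterate ρ (e ℕ.* 1)))) (T-1 N)
        ; (suc (suc i)) → T-root-0 (e ℕ.* suc (suc i)) }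

      root-shift : ∀ i x → root (e ℕ.* suc i) (x ^⟨ residue ⟩ q) E.≈ root (e ℕ.* i) x
      root-shift i x = begin
        root (e ℕ.* suc i) (x ^⟨ residue ⟩ q)
          ≡⟨ ≡.cong (λ k → root k (x ^⟨ residue ⟩ q)) (≡.trans (ℕₚ.*-suc e i) (ℕₚ.+-comm e (e ℕ.* i))) ⟩
        root (e ℕ.* i ℕ.+ e) (x ^⟨ residue ⟩ q)
          ≡⟨ iterate-+ ρ (e ℕ.* i) e (x ^⟨ residue ⟩ q) ⟩
        root (e ℕ.* i) (root e (x ^⟨ residue ⟩ q))
          ≈⟨ RingHom.cong (rootHom (e ℕ.* i)) (root-of-power e x) ⟩
        root (e ℕ.* i) x ∎
        where open SetoidReasoning E.setoid

      -- Moving aᵢ to position i + 1 costs one more q-th root, which the q-th power in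
      -- `frobeniusShift` cancels; the move itself is multiplication by π.
      θ-shift : ∀ a → θ (frobeniusShift a) ≈ᴮ πᴮ *ᴮ θ a
      θ-shift a = B.trans
        (κ-T-cong {λ i → root (e ℕ.* i) (frobeniusShift a i)} {shifted} λ
          { zero    → RingHom.0#-homo (rootHom (e ℕ.* 0))
          ; (suc i) → root-shift i (a i) })
        (B.trans (κ.cong (λ
          { zero    → trans (T-0 N) (sym (π⋆-zero (θ-series a)))
          ; (suc i) → sym (π⋆-suc (θ-series a) i) }))
          (κ.*-homo variable-π (θ-series a)))
        where
        shifted : ℕ → Carrier
        shifted zero    = 0#
        shifted (suc i) = root (e ℕ.* i) (a i)

      θ-p : θ p-sequence ≈ᴮ multiple B p B.1#
      θ-p = B.trans
        (κ-T-cong {λ i → root (e ℕ.* i) (p-sequence i)} {expansion p ringP w} λ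
          { zero    → RingHom.0#-homo (rootHom (e ℕ.* 0))
          ; (suc i) → E.trans
              (E.reflexive (≡.cong (λ k → root (e ℕ.* suc i) (w (suc i) ^⟨ residue ⟩ k)) (ℕₚ.^-*-assoc p e (suc i))))
              (root-of-power (e ℕ.* suc i) (w (suc i))) })
        -- By `w-teich` the representative `T N (w j)` is `w j`, so the series is literally the one
        -- in the relation for p.
        (B.trans (κ.cong (λ { zero → T-0 N ; (suc i) → T-teich N (w-teich (suc i)) }))
          (B.sym p≈expansion))

    value : ∀ {v} → (Fin v → Sequence) → Expr v → B.Carrier
    value ρ (var i)     = θ (ρ i)
    value ρ 𝟎           = B.0#
    value ρ 𝟙           = B.1#
    value ρ 𝛑           = πᴮ
    value ρ p-coords    = multiple B p B.1#
    value ρ (x ⊞ y)     = value ρ x +ᴮ value ρ y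
    value ρ (x ⊠ y)     = value ρ x *ᴮ value ρ y
    value ρ (head i)    = teichmüller (ρ i 0)
    value ρ (shift i)   = πᴮ *ᴮ θ (ρ i)
    value ρ (head* i j) = teichmüller (ρ i 0) *ᴮ teichmüller (ρ j 0)
    value ρ (take n i)  = θ (takeSequence 0# n (ρ i))
    value ρ (drop n i)  = θ (dropSequence 0# n (ρ i))

    θ-value : ∀ {v} ρ (x : Expr v) → θ (⟦ x ⟧ ρ) ≈ᴮ value ρ x
    θ-value ρ (var i)     = B.refl
    θ-value ρ 𝟎           = θ-0
    θ-value ρ 𝟙           = B.trans (θ-leading 1#) teichmüller-1
    θ-value ρ 𝛑           = θ-π
    θ-value ρ p-coords    = θ-p
    θ-value ρ (x ⊞ y)     = B.trans (θ-+ (⟦ x ⟧ ρ) (⟦ y ⟧ ρ) τ Q⁺) (B.+-cong (θ-value ρ x) (θ-value ρ y))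
    θ-value ρ (x ⊠ y)     = B.trans (θ-* (⟦ x ⟧ ρ) (⟦ y ⟧ ρ) τ Q×) (B.*-cong (θ-value ρ x) (θ-value ρ y))
    θ-value ρ (head i)    = θ-leading (ρ i 0)
    θ-value ρ (shift i)   = θ-shift (ρ i)
    θ-value ρ (head* i j) = B.trans (θ-leading (ρ i 0 * ρ j 0))
      (B.trans (RingHom.cong const (T-* N (ρ i 0) (ρ j 0))) (RingHom.*-homo const _ _))
    θ-value ρ (take n i)  = B.refl
    θ-value ρ (drop n i)  = B.refl

    -- The two parts have disjoint supports and [0] = 0, so their Teichmüller series add coefficient
    -- by coefficient, without carries.
    value-take-drop : ∀ {v} ρ n (i : Fin v) → value ρ (take n i ⊞ drop n i) ≈ᴮ value ρ (var i)
    value-take-drop ρ n i = B.trans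
      (B.sym (κ.+-homo (θ-series (takeSequence 0# n (ρ i))) (θ-series (dropSequence 0# n (ρ i)))))
      (κ.cong combine)
      where
      combine : ∀ j → T N (root (e ℕ.* j) (takeSequence 0# n (ρ i) j)) +
                      T N (root (e ℕ.* j) (dropSequence 0# n (ρ i) j)) ≈ T N (root (e ℕ.* j) (ρ i j))
      combine j with take-drop 0# n (ρ i) j
      ... | inj₁ (eq₁ , eq₂) rewrite eq₁ | eq₂ = trans (+-congˡ (T-root-0 (e ℕ.* j))) (+-identityʳ _)
      ... | inj₂ (eq₁ , eq₂) rewrite eq₁ | eq₂ = trans (+-congʳ (T-root-0 (e ℕ.* j))) (+-identityˡ _)

    private
      value-• : ∀ {v} ρ n (x : Expr v) → value ρ (n • x) ≈ᴮ n · value ρ x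
      value-• ρ zero    x = B.refl
      value-• ρ (suc n) x = B.+-congˡ (value-• ρ n x)

      -- p = π σ, and already N + 1 factors π give 0.
      p^k≈0 : ∀ {k} → N ℕ.< k → (p ℕ.^ k) · B.1# ≈ᴮ B.0#
      p^k≈0 {k} N<k with o , ≡.refl ← ℕₚ.m≤n⇒∃[o]m+o≡n N<k = begin
        (p ℕ.^ k) · B.1#                                  ≈⟨ power k ⟩
        (p · B.1#) ^⟨ B ⟩ (suc N ℕ.+ o)                   ≈⟨ ^-homo-* (p · B.1#) (suc N) o ⟩
        (p · B.1#) ^⟨ B ⟩ suc N *ᴮ (p · B.1#) ^⟨ B ⟩ o    ≈⟨ B.*-congʳ (^-congˡᴮ (suc N) p≈πσ) ⟩
        (πᴮ *ᴮ _) ^⟨ B ⟩ suc N *ᴮ (p · B.1#) ^⟨ B ⟩ o     ≈⟨ B.*-congʳ (^-distrib-* πᴮ _ (suc N)) ⟩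
        (πᴮ ^⟨ B ⟩ suc N *ᴮ _) *ᴮ (p · B.1#) ^⟨ B ⟩ o     ≈⟨ B.*-congʳ (B.*-congʳ π^N+1≈0) ⟩
        (B.0# *ᴮ _) *ᴮ (p · B.1#) ^⟨ B ⟩ o                ≈⟨ B.*-congʳ (B.zeroˡ _) ⟩
        B.0# *ᴮ (p · B.1#) ^⟨ B ⟩ o                       ≈⟨ B.zeroˡ _ ⟩
        B.0#                                              ∎
        where
        open SetoidReasoning B.setoid
        open Exp B.commutativeSemiring using (^-homo-*; ^-distrib-*) renaming (^-congˡ to ^-congˡᴮ)
        power : ∀ k → (p ℕ.^ k) · B.1# ≈ᴮ (p · B.1#) ^⟨ B ⟩ k
        power zero    = B.+-identityʳ B.1#
        power (suc k) = B.trans (×1-homo-* p (p ℕ.^ k)) (B.*-congˡ (power k))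

    value-p^k : ∀ {v} ρ {k} (x : Expr v) → N ℕ.< k → value ρ ((p ℕ.^ k) • x) ≈ᴮ B.0#
    value-p^k ρ {k} x N<k = begin
      value ρ ((p ℕ.^ k) • x)          ≈⟨ value-• ρ (p ℕ.^ k) x ⟩
      (p ℕ.^ k) · value ρ x            ≈⟨ ×-congʳ (p ℕ.^ k) (B.*-identityˡ (value ρ x)) ⟨
      (p ℕ.^ k) · (B.1# *ᴮ value ρ x)  ≈⟨ ×-assoc-* (p ℕ.^ k) B.1# (value ρ x) ⟨
      (p ℕ.^ k) · B.1# *ᴮ value ρ x    ≈⟨ B.*-congʳ (p^k≈0 N<k) ⟩
      B.0# *ᴮ value ρ x                ≈⟨ B.zeroˡ _ ⟩
      B.0#                             ∎
      where open SetoidReasoning B.setoid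

    value-neg : ∀ {v} ρ {k} (x : Expr v) → N ℕ.< k →
                value ρ (ℕ.pred (p ℕ.^ k) • x) ≈ᴮ B.- value ρ x
    value-neg ρ {k} x N<k = RingProperties.+-inverseʳ-unique B.ring _ _
      (B.trans (B.reflexive (≡.cong (λ n → value ρ (n • x)) pos)) (value-p^k ρ x N<k))
      where
      pos : suc (ℕ.pred (p ℕ.^ k)) ≡ p ℕ.^ k
      pos = ℕₚ.suc-pred (p ℕ.^ k) ⦃ ℕ.>-nonZero (prime^n>0 prime-p k) ⦄

  module ValueIn (n : ℕ) where
    open ResidueLaws p e t prime-p P w w-teich
    open Truncation n
    private
      module B = CommutativeRing truncation
      valueₙ = value n truncation projection projection-relation (projection-π ℕₚ.≤-refl)

    infix 4 _⊢_≃_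
    _⊢_≃_ : ∀ {v} → (Fin v → Sequence) → Expr v → Expr v → Set
    ρ ⊢ x ≃ y = valueₙ ρ x B.≈ valueₙ ρ y

    -- Truncation at π^(n+1) is used for coordinate n alone; every other coordinate of the same
    -- identity is obtained from its own truncation.
    coordinate : ∀ {v} ρ (x y : Expr v) → ρ ⊢ x ≃ y → ⟦ x ⟧ ρ n E.≈ ⟦ y ⟧ ρ n
    coordinate ρ x y eq = θ-injective n (⟦ x ⟧ ρ) (⟦ y ⟧ ρ)
      (B.trans {θ (⟦ x ⟧ ρ)} {valueₙ ρ x} {θ (⟦ y ⟧ ρ)} (θ-value′ ρ x)
        (B.trans {valueₙ ρ x} {valueₙ ρ y} {θ (⟦ y ⟧ ρ)} eq (B.sym {θ (⟦ y ⟧ ρ)} {valueₙ ρ y} (θ-value′ ρ y))))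
      where
      open At (ℕₚ.≤-refl {n}) using (θ)
      θ-value′ = θ-value n truncation projection projection-relation (projection-π ℕₚ.≤-refl)

-- Rings of characteristic p

module Witt (p e : ℕ) (t : ℤ) (prime-p : Prime p)
  {τ : Setup.MultiplicativeSection p e t}
  (Q⁺ : Setup.ArithmeticPolynomials p e t τ (CommutativeRing._+_ (Setup.Ĉ p e t)))
  (Q× : Setup.ArithmeticPolynomials p e t τ (CommutativeRing._*_ (Setup.Ĉ p e t)))
  where
  open Setup p e t using (q; IntegralPolynomial; module ArithmeticPolynomials)
  open ArithmeticPolynomials using (Q)
  open Evaluate p e t
  private
    module Sem {c ℓ} (K : CommutativeRing c ℓ) (w : ℕ → ∣ K ∣) = Semantics p e t K w (Q Q⁺) (Q Q×)

  module Naturality {K : CommutativeRing c ℓ} {K′ : CommutativeRing c′ ℓ′} (f : RingHom K K′)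
    (w : ℕ → ∣ K ∣) (w′ : ℕ → ∣ K′ ∣) (n : ℕ) where
    private
      module K = CommutativeRing K
      module f = RingHom f
      module L = Sem K w
      module R = Sem K′ w′
    open CommutativeRing K′ using (_≈_; trans; *-cong)

    -- Agreement is required only up to n, which is all that `Q i` with i ≤ n reads. With f the
    -- identity, naturality becomes locality of the operations.
    Maps : (ℕ → ∣ K ∣) → (ℕ → ∣ K′ ∣) → Set ℓ′
    Maps a b = ∀ i → i ℕ.≤ n → f.to (a i) ≈ b i

    private
      -- The bounds in `Interval` are irrelevant fields; decidability of ≤ recovers a usable proof.
      recompute-≤ : ∀ {l m} (i : Interval l [ m ]) → val i ℕ.≤ m
      recompute-≤ {l} {m} (index i _ i≤m) = recompute (i ℕₚ.≤? m) ([≤]-injective i≤m)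

      take-maps : ∀ k {a b} i → (∀ j → j ℕ.≤ i → f.to (a j) ≈ b j) →
        f.to (takeSequence K.0# k a i) ≈ takeSequence (CommutativeRing.0# K′) k b i
      take-maps zero    i       h = f.0#-homo
      take-maps (suc k) zero    h = h 0 z≤n
      take-maps (suc k) (suc i) h = take-maps k i (λ j j≤i → h (suc j) (s≤s j≤i))

      drop-maps : ∀ k {a b} i → (∀ j → j ℕ.≤ i → f.to (a j) ≈ b j) →
        f.to (dropSequence K.0# k a i) ≈ dropSequence (CommutativeRing.0# K′) k b i
      drop-maps zero    i       h = h i ℕₚ.≤-refl
      drop-maps (suc k) zero    h = f.0#-homo
      drop-maps (suc k) (suc i) h = drop-maps k i (λ j j≤i → h (suc j) (s≤s j≤i))

      leading-maps : ∀ {x y} → f.to x ≈ y → ∀ i → f.to (L.leading x i) ≈ R.leading y i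
      leading-maps eq zero    = eq
      leading-maps eq (suc i) = f.0#-homo

    module _ (w-maps : Maps w w′) where

      evaluate-maps : ∀ Q {a b a′ b′} → Maps a a′ → Maps b b′ →
                      Maps (evaluateℕ K w Q a b) (evaluateℕ K′ w′ Q a′ b′)
      evaluate-maps Q a-maps b-maps i i≤n = eval-natural f
        (integer-unique K′ (f ∘R integerHom K)) (λ
          { (inj₁ j)        → w-maps (val j) (ℕₚ.≤-trans (recompute-≤ j) i≤n)
          ; (inj₂ (inj₁ j)) → a-maps (val j) (ℕₚ.≤-trans (recompute-≤ j) i≤n)
          ; (inj₂ (inj₂ j)) → b-maps (val j) (ℕₚ.≤-trans (recompute-≤ j) i≤n) }) (Q i)

      expr-maps : ∀ {v} (x : Expr v) {ρ ρ′} → (∀ i → Maps (ρ i) (ρ′ i)) → Maps (L.⟦ x ⟧ ρ) (R.⟦ x ⟧ ρ′)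
      expr-maps (var i)     h = h i
      expr-maps 𝟎           h i _ = f.0#-homo
      expr-maps 𝟙           h i _ = leading-maps f.1#-homo i
      expr-maps 𝛑           h zero    _ = f.0#-homo
      expr-maps 𝛑           h (suc i) _ = leading-maps f.1#-homo i
      expr-maps p-coords    h zero    _ = f.0#-homo
      expr-maps p-coords    h (suc i) i<n = trans (f.^-homo (w (suc i)) (q ℕ.^ suc i))
        (^-congˡ (q ℕ.^ suc i) (w-maps (suc i) i<n))
        where open Exp (CommutativeRing.commutativeSemiring K′) using (^-congˡ)
      expr-maps (x ⊞ y)     h = evaluate-maps (Q Q⁺) (expr-maps x h) (expr-maps y h)
      expr-maps (x ⊠ y)     h = evaluate-maps (Q Q×) (expr-maps x h) (expr-maps y h)
      expr-maps (head j)    h i _ = leading-maps (h j 0 z≤n) i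
      expr-maps (shift j)   h zero    _ = f.0#-homo
      expr-maps (shift j)   h (suc i) i<n = trans (f.^-homo _ q) (^-congˡ q (h j i (ℕₚ.<⇒≤ i<n)))
        where open Exp (CommutativeRing.commutativeSemiring K′) using (^-congˡ)
      expr-maps (head* j k) h i _ = leading-maps (trans (f.*-homo _ _) (*-cong (h j 0 z≤n) (h k 0 z≤n))) i
      expr-maps (take m j)  h i i≤n = take-maps m i (λ k k≤i → h j k (ℕₚ.≤-trans k≤i i≤n))
      expr-maps (drop m j)  h i i≤n = drop-maps m i (λ k k≤i → h j k (ℕₚ.≤-trans k≤i i≤n))

  private
    module Reduction {A : FrobeniusLift p} {P : PerfectLift p}
      (embed : RingHom (FrobeniusLift.ring A) (PerfectLift.ring P))
      (reflects : ∀ x z → PerfectLift._≈_ P (RingHom.to embed x) (PerfectLift._*_ P z (PerfectLift.p# P)) →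
        ∃ λ y → FrobeniusLift._≈_ A x (FrobeniusLift._*_ A y (FrobeniusLift.p# A))) where
      private
        module A = FrobeniusLift A
        module P = PerfectLift P
        module embed = RingHom embed
        module M = ModuloP prime-p A.ring
        module R = Residue prime-p P
        module E = CommutativeRing R.residue

      reduction : RingHom M.residue R.residue
      reduction = factorHom {R = A.ring} {I = A._≈_ A.p#} (R.toResidue ∘R embed) λ eq →
        E.trans (RingHom.cong R.toResidue (P.trans (embed.cong (A.sym eq)) (embed.multiple-homo p))) R.p#≈0

      reduction-injective : ∀ y z → embed.to y E.≈ embed.to z → y M.≈/ z
      reduction-injective y z eq =
        let u , u≈ = R.multiple-of eq
            v , v≈ = reflects (y A.- z) u
              (P.trans (P.trans (embed.+-homo y (A.- z)) (P.+-congˡ (embed.-‿homo z))) u≈)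
        in M.resp∈ (A.sym v≈) (M.multiple∈ v (M.generator A.refl))

    -- The identity is known in E. Injectivity of ι brings it back to M, and F carries it on to K,
    -- since evaluation of terms commutes with both maps.
    descend : ∀ {v} n (l r : Expr v) {K : CommutativeRing c ℓ} {M E : CommutativeRing 0ℓ 0ℓ}
      (F : RingHom M K) (ι : RingHom M E) →
      (∀ y z → CommutativeRing._≈_ E (RingHom.to ι y) (RingHom.to ι z) → CommutativeRing._≈_ M y z) →
      (w : ℕ → ∣ K ∣) (ρ : Fin v → ℕ → ∣ K ∣) (w′ : ℕ → ∣ M ∣) (ρ′ : Fin v → ℕ → ∣ M ∣) →
      Naturality.Maps F w′ w n w′ w → (∀ i → Naturality.Maps F w′ w n (ρ′ i) (ρ i)) →
      let wᴱ = λ j → RingHom.to ι (w′ j) ; ρᴱ = λ i j → RingHom.to ι (ρ′ i j) in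
      CommutativeRing._≈_ E (Sem.⟦_⟧ E wᴱ l ρᴱ n) (Sem.⟦_⟧ E wᴱ r ρᴱ n) →
      CommutativeRing._≈_ K (Sem.⟦_⟧ K w l ρ n) (Sem.⟦_⟧ K w r ρ n)
    descend n l r {K} {M} {E} F ι injective w ρ w′ ρ′ w-maps ρ-maps law =
      K.trans (K.sym (lower l)) (K.trans (RingHom.cong F
        (injective _ _ (E.trans (raise l) (E.trans law (E.sym (raise r)))))) (lower r))
      where
      module K = CommutativeRing K
      module E = CommutativeRing E
      lower : ∀ x → RingHom.to F (Sem.⟦_⟧ M w′ x ρ′ n) K.≈ Sem.⟦_⟧ K w x ρ n
      lower x = Naturality.expr-maps F w′ w n w-maps x ρ-maps n ℕₚ.≤-refl
      raise : ∀ x → RingHom.to ι (Sem.⟦_⟧ M w′ x ρ′ n)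
        E.≈ Sem.⟦_⟧ E (λ j → RingHom.to ι (w′ j)) x (λ i j → RingHom.to ι (ρ′ i j)) n
      raise x = Naturality.expr-maps ι w′ (λ j → RingHom.to ι (w′ j)) n (λ _ _ → E.refl) x (λ _ _ _ → E.refl) n ℕₚ.≤-refl

  private
    family : ∀ {v} {K : CommutativeRing c ℓ} → (ℕ → ∣ K ∣) → (Fin v → ℕ → ∣ K ∣) → Fin (suc v) → ℕ → ∣ K ∣
    family w ρ Fin.zero    = w
    family w ρ (Fin.suc i) = ρ i

    -- Entries 0 to n of `w` and of each `ρ i`, as a single finite family: everything that
    -- coordinate n of a term can depend on.
    elements : ∀ {v} {K : CommutativeRing c ℓ} n → (ℕ → ∣ K ∣) → (Fin v → ℕ → ∣ K ∣) →
               Fin (suc v ℕ.* suc n) → ∣ K ∣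
    elements {K = K} n w ρ k = let i , j = Fin.remQuot (suc n) k in family {K = K} w ρ i (toℕ j)

  -- A record and not a function type, so that `l` and `r` can be recovered from a law by
  -- unification.
  record Law {v} (n : ℕ) (l r : Expr v) : Set₁ where
    field
      holds : ∀ P w (w-teich : ∀ j → Residue.Teichmüller prime-p P (w j)) ρ →
        CommutativeRing._≈_ (Residue.residue prime-p P)
          (Sem.⟦_⟧ (Residue.residue prime-p P) w l ρ n) (Sem.⟦_⟧ (Residue.residue prime-p P) w r ρ n)

  private
    transfer-along : ∀ {v} n (l r : Expr v) → Law n l r → (K : CommutativeRing c ℓ) →
      let open CommutativeRing K in multiple K p 1# ≈ 0# →
      ∀ w ρ → Cover prime-p K (elements {K = K} n w ρ) → Sem.⟦_⟧ K w l ρ n ≈ Sem.⟦_⟧ K w r ρ n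
    transfer-along {v = v} n l r law K p≈0 w ρ C =
      descend n l r evalHomₚ reduction reduction-injective w ρ (x Fin.zero) (λ i → x (Fin.suc i))
        (x-evaluates Fin.zero) (λ i → x-evaluates (Fin.suc i))
        (Law.holds law P (λ j → RingHom.to embed (x Fin.zero j)) teich (λ i j → RingHom.to embed (x (Fin.suc i) j)))
      where
      open CommutativeRing K
      open Cover C renaming (lift to A)
      module A = FrobeniusLift A

      -- Only entries up to n have preimages; later positions repeat the one at n.
      clip : ℕ → Fin (suc n)
      clip j = Fin.fromℕ< (s≤s (ℕₚ.m⊓n≤n j n))

      x : Fin (suc v) → ℕ → A.Carrier
      x i j = preimage (Fin.combine i (clip j))

      x-evaluates : ∀ i j → j ℕ.≤ n → RingHom.to evaluation (x i j) ≈ family {K = K} w ρ i j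
      x-evaluates i j j≤n = trans (evaluates (Fin.combine i (clip j))) (reflexive
        (≡.trans (≡.cong (λ (i , j) → family {K = K} w ρ i (toℕ j)) (Finₚ.remQuot-combine i (clip j)))
          (≡.cong (family {K = K} w ρ i) (≡.trans (Finₚ.toℕ-fromℕ< (s≤s (ℕₚ.m⊓n≤n j n))) (ℕₚ.m≤n⇒m⊓n≡m j≤n)))))

      P = Germs.perfectLift A
      embed = Germs.embed A
      open Reduction {A} {P} embed (Germs.embed-reflects A)

      evalHomₚ : RingHom (ModuloP.residue prime-p A.ring) K
      evalHomₚ = factorHom {R = A.ring} {I = A._≈_ A.p#} evaluation (λ eq → trans (RingHom.cong evaluation (A.sym eq))
        (trans (RingHom.multiple-homo evaluation p) p≈0))

      teich : ∀ j → Residue.Teichmüller prime-p P (RingHom.to embed (x Fin.zero j))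
      teich j = Germs.shift-embed A (x Fin.zero j) (φ-preimage (Fin.combine {suc v} Fin.zero (clip j)))

  -- Both sides are polynomial in finitely many elements of K, so an identity
  -- need only be checked on variables of a polynomial ring over 𝔽ₚ, which
  -- embeds into its perfection.
  transfer : ∀ {v} n (l r : Expr v) → Law n l r → (K : CommutativeRing c ℓ) →
    let open CommutativeRing K in multiple K p 1# ≈ 0# →
    ∀ w ρ → Sem.⟦_⟧ K w l ρ n ≈ Sem.⟦_⟧ K w r ρ n
  transfer n l r law K p≈0 w ρ = transfer-along n l r law K p≈0 w ρ (cover prime-p K (elements {K = K} n w ρ))

-- A ring of Witt vectors with coordinates in K, in which p = Σ_{j≥1} [wⱼ] πʲ
record WittStructure (p q : ℕ) (K : CommutativeRing c ℓ) (w : ℕ → ∣ K ∣) : Set (c ⊔ ℓ) where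
  open CommutativeRing K using (0#; 1#; _*_)
  open Sequences q K w public
  infixl 6 _⊕_
  infixl 7 _⊗_
  field
    _⊕_ _⊗_           : Op₂ Sequence
    negate            : Op₁ Sequence
    isCommutativeRing : IsCommutativeRing _≋_ _⊕_ _⊗_ negate (λ _ → 0#) (leading 1#)

  wittRing : CommutativeRing c ℓ
  wittRing = record { isCommutativeRing = isCommutativeRing }

  field
    ⊕-local     : ∀ n {a a′ b b′} → a ≈[≤ n ] a′ → b ≈[≤ n ] b′ → a ⊕ b ≈[≤ n ] a′ ⊕ b′
    ⊗-local     : ∀ n {a a′ b b′} → a ≈[≤ n ] a′ → b ≈[≤ n ] b′ → a ⊗ b ≈[≤ n ] a′ ⊗ b′
    π-shift     : ∀ a → π-sequence ⊗ a ≋ frobeniusShift a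
    take⊕drop   : ∀ k a → takeSequence 0# k a ⊕ dropSequence 0# k a ≋ a
    leading-*   : ∀ x y → leading x ⊗ leading y ≋ leading (x * y)
    p-expansion : multiple wittRing p (leading 1#) ≋ p-sequence

-- The laws of Witt vector arithmetic

module WittRing (p e : ℕ) (t : ℤ) (prime-p : Prime p)
  {τ : Setup.MultiplicativeSection p e t}
  (Q⁺ : Setup.ArithmeticPolynomials p e t τ (CommutativeRing._+_ (Setup.Ĉ p e t)))
  (Q× : Setup.ArithmeticPolynomials p e t τ (CommutativeRing._*_ (Setup.Ĉ p e t)))
  where
  open Setup p e t using (q; IntegralPolynomial; module ArithmeticPolynomials)
  open ArithmeticPolynomials using (Q)
  open Evaluate p e t
  open Witt p e t prime-p Q⁺ Q×

  private
    module Laws (P : PerfectLift p) (w : ℕ → PerfectLift.Carrier P)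
                (w-teich : ∀ j → Residue.Teichmüller prime-p P (w j)) (n : ℕ) where
      open Interpretation p e t prime-p P w w-teich Q⁺ Q× public
      open ValueIn n public
      open ResidueLaws.Truncation p e t prime-p P w w-teich n public
      module B = CommutativeRing truncation

      V : ∀ {v} (ρ : Fin v → ℕ → PerfectLift.Carrier P) (x : Expr v) → B.Carrier
      V = value n truncation projection projection-relation (projection-π ℕₚ.≤-refl)

    x₀ : ∀ {v} → Expr (suc v)
    x₀ = var Fin.zero
    x₁ : ∀ {v} → Expr (suc (suc v))
    x₁ = var (Fin.suc Fin.zero)
    x₂ : ∀ {v} → Expr (suc (suc (suc v)))
    x₂ = var (Fin.suc (Fin.suc Fin.zero))

    law-+-assoc : ∀ n → Law {3} n ((x₀ ⊞ x₁) ⊞ x₂) (x₀ ⊞ (x₁ ⊞ x₂))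
    Law.holds (law-+-assoc n) P w wt ρ = coordinate ρ ((x₀ ⊞ x₁) ⊞ x₂) (x₀ ⊞ (x₁ ⊞ x₂))
      (B.+-assoc (V ρ x₀) (V ρ x₁) (V ρ x₂))
      where open Laws P w wt n

    law-+-comm : ∀ n → Law {2} n (x₀ ⊞ x₁) (x₁ ⊞ x₀)
    Law.holds (law-+-comm n) P w wt ρ = coordinate ρ (x₀ ⊞ x₁) (x₁ ⊞ x₀) (B.+-comm (V ρ x₀) (V ρ x₁))
      where open Laws P w wt n

    law-+-identity : ∀ n → Law {1} n (𝟎 ⊞ x₀) x₀
    Law.holds (law-+-identity n) P w wt ρ = coordinate ρ (𝟎 ⊞ x₀) x₀ (B.+-identityˡ (V ρ x₀))
      where open Laws P w wt n

    law-*-assoc : ∀ n → Law {3} n ((x₀ ⊠ x₁) ⊠ x₂) (x₀ ⊠ (x₁ ⊠ x₂))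
    Law.holds (law-*-assoc n) P w wt ρ = coordinate ρ ((x₀ ⊠ x₁) ⊠ x₂) (x₀ ⊠ (x₁ ⊠ x₂))
      (B.*-assoc (V ρ x₀) (V ρ x₁) (V ρ x₂))
      where open Laws P w wt n

    law-*-comm : ∀ n → Law {2} n (x₀ ⊠ x₁) (x₁ ⊠ x₀)
    Law.holds (law-*-comm n) P w wt ρ = coordinate ρ (x₀ ⊠ x₁) (x₁ ⊠ x₀) (B.*-comm (V ρ x₀) (V ρ x₁))
      where open Laws P w wt n

    law-*-identity : ∀ n → Law {1} n (𝟙 ⊠ x₀) x₀
    Law.holds (law-*-identity n) P w wt ρ = coordinate ρ (𝟙 ⊠ x₀) x₀ (B.*-identityˡ (V ρ x₀))
      where open Laws P w wt n

    law-distrib : ∀ n → Law {3} n (x₀ ⊠ (x₁ ⊞ x₂)) (x₀ ⊠ x₁ ⊞ x₀ ⊠ x₂)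
    Law.holds (law-distrib n) P w wt ρ = coordinate ρ (x₀ ⊠ (x₁ ⊞ x₂)) (x₀ ⊠ x₁ ⊞ x₀ ⊠ x₂)
      (B.distribˡ (V ρ x₀) (V ρ x₁) (V ρ x₂))
      where open Laws P w wt n

    law-p^k : ∀ n {k} → n ℕ.< k → Law {1} n ((p ℕ.^ k) • x₀) 𝟎
    Law.holds (law-p^k n {k} n<k) P w wt ρ = coordinate ρ ((p ℕ.^ k) • x₀) 𝟎
      (value-p^k n truncation projection projection-relation (projection-π ℕₚ.≤-refl) ρ x₀ n<k)
      where open Laws P w wt n

    -- `negate` takes a different multiple at each coordinate. Any two exponents above n give the
    -- same coordinate n, as both multiples are the negative in the truncated ring.
    law-neg : ∀ n {k l} → n ℕ.< k → n ℕ.< l → Law {1} n (ℕ.pred (p ℕ.^ k) • x₀) (ℕ.pred (p ℕ.^ l) • x₀)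
    Law.holds (law-neg n {k} {l} n<k n<l) P w wt ρ = coordinate ρ (ℕ.pred (p ℕ.^ k) • x₀) (ℕ.pred (p ℕ.^ l) • x₀)
      (B.trans {V ρ (ℕ.pred (p ℕ.^ k) • x₀)} {B.- V ρ x₀} {V ρ (ℕ.pred (p ℕ.^ l) • x₀)}
        (negation n<k) (B.sym {V ρ (ℕ.pred (p ℕ.^ l) • x₀)} {B.- V ρ x₀} (negation n<l)))
      where
      open Laws P w wt n
      negation : ∀ {k} → n ℕ.< k → V ρ (ℕ.pred (p ℕ.^ k) • x₀) B.≈ B.- V ρ x₀
      negation n<k = value-neg n truncation projection projection-relation (projection-π ℕₚ.≤-refl) ρ x₀ n<k

    -- Both terms have the value π θ(a) by definition of `value`; the content is in `θ-shift`. The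
    -- law for `head*` is reflexive in the same way.
    law-π : ∀ n → Law {1} n (𝛑 ⊠ x₀) (shift Fin.zero)
    Law.holds (law-π n) P w wt ρ = coordinate ρ (𝛑 ⊠ x₀) (shift Fin.zero) (B.refl {V ρ (shift Fin.zero)})
      where open Laws P w wt n

    law-take-drop : ∀ n k → Law {1} n (take k Fin.zero ⊞ drop k Fin.zero) x₀
    Law.holds (law-take-drop n k) P w wt ρ = coordinate ρ (take k Fin.zero ⊞ drop k Fin.zero) x₀
      (value-take-drop n truncation projection projection-relation (projection-π ℕₚ.≤-refl) ρ k Fin.zero)
      where open Laws P w wt n

    law-head* : ∀ n → Law {2} n (head Fin.zero ⊠ head (Fin.suc Fin.zero)) (head* Fin.zero (Fin.suc Fin.zero))
    Law.holds (law-head* n) P w wt ρ = coordinate ρ (head Fin.zero ⊠ head (Fin.suc Fin.zero)) (head* Fin.zero (Fin.suc Fin.zero))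
      (B.refl {V ρ (head* Fin.zero (Fin.suc Fin.zero))})
      where open Laws P w wt n

    law-p : ∀ n → Law {0} n (p • 𝟙) p-coords
    Law.holds (law-p n) P w wt ρ = coordinate ρ (p • 𝟙) p-coords (multiple-𝟙 p)
      where
      open Laws P w wt n
      multiple-𝟙 : ∀ k → V ρ (k • 𝟙) B.≈ multiple truncation k B.1#
      multiple-𝟙 zero    = B.refl {B.0#}
      multiple-𝟙 (suc k) = B.+-congˡ {B.1#} {V ρ (k • 𝟙)} {multiple truncation k B.1#} (multiple-𝟙 k)

  module Over (K : CommutativeRing c ℓ) (p≈0 : Characteristic p K) (w : ℕ → ∣ K ∣) where
    open CommutativeRing K
    open Semantics p e t K w (Q Q⁺) (Q Q×) public
    private
      infixr 5 _∷_
      _∷_ : ∀ {v} → Sequence → (Fin v → Sequence) → Fin (suc v) → Sequence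
      (a ∷ ρ) Fin.zero    = a
      (a ∷ ρ) (Fin.suc i) = ρ i
      [] : Fin 0 → Sequence
      [] ()

      module N n = Naturality (idRing K) w w n

    ⊕-local : ∀ n {a a′ b b′} → a ≈[≤ n ] a′ → b ≈[≤ n ] b′ → a ⊕ b ≈[≤ n ] a′ ⊕ b′
    ⊕-local n = N.evaluate-maps n (λ _ _ → refl) (Q Q⁺)

    ⊗-local : ∀ n {a a′ b b′} → a ≈[≤ n ] a′ → b ≈[≤ n ] b′ → a ⊗ b ≈[≤ n ] a′ ⊗ b′
    ⊗-local n = N.evaluate-maps n (λ _ _ → refl) (Q Q×)

    -- pⁿ⁺¹ kills the n-th coordinate, so there -a is (pⁿ⁺¹ - 1) a.
    negate : Sequence → Sequence
    negate a n = ⟦ ℕ.pred (p ℕ.^ suc n) • x₀ ⟧ (a ∷ []) n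

    negate-local : ∀ n {a b} → a ≈[≤ n ] b → negate a ≈[≤ n ] negate b
    negate-local n eq i i≤n = N.expr-maps i (λ _ _ → refl) (ℕ.pred (p ℕ.^ suc i) • x₀ {0})
      (λ { Fin.zero j j≤i → eq j (ℕₚ.≤-trans j≤i i≤n) }) i ℕₚ.≤-refl

    private
      ⊕-inverseʳ : ∀ a → a ⊕ negate a ≋ λ _ → 0#
      ⊕-inverseʳ a n = begin
        (a ⊕ negate a) n
          -- Replaces the multiple used at each coordinate i ≤ n by the single multiple pⁿ⁺¹ - 1.
          ≈⟨ ⊕-local n (λ _ _ → refl) (λ i i≤n → transfer i _ _
               (law-neg i {suc i} {suc n} ℕₚ.≤-refl (s≤s i≤n)) K p≈0 w (a ∷ [])) n ℕₚ.≤-refl ⟩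
        ⟦ suc (ℕ.pred (p ℕ.^ suc n)) • x₀ ⟧ (a ∷ []) n
          ≡⟨ ≡.cong (λ k → ⟦ k • x₀ ⟧ (a ∷ []) n) (ℕₚ.suc-pred (p ℕ.^ suc n)
               ⦃ ℕ.>-nonZero (prime^n>0 prime-p (suc n)) ⦄) ⟩
        ⟦ (p ℕ.^ suc n) • x₀ ⟧ (a ∷ []) n
          ≈⟨ transfer n _ _ (law-p^k n {suc n} ℕₚ.≤-refl) K p≈0 w (a ∷ []) ⟩
        0# ∎
        where open SetoidReasoning setoid

      ⊕-comm : ∀ a b → a ⊕ b ≋ b ⊕ a
      ⊕-comm a b n = transfer n _ _ (law-+-comm n) K p≈0 w (a ∷ b ∷ [])

      ⊕-cong : ∀ {a a′ b b′} → a ≋ a′ → b ≋ b′ → a ⊕ b ≋ a′ ⊕ b′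
      ⊕-cong p q n = ⊕-local n (λ i _ → p i) (λ i _ → q i) n ℕₚ.≤-refl

      ⊗-cong : ∀ {a a′ b b′} → a ≋ a′ → b ≋ b′ → a ⊗ b ≋ a′ ⊗ b′
      ⊗-cong p q n = ⊗-local n (λ i _ → p i) (λ i _ → q i) n ℕₚ.≤-refl

      isCommutativeRing-⊕⊗ : IsCommutativeRing _≋_ _⊕_ _⊗_ negate (λ _ → 0#) (leading 1#)
      isCommutativeRing-⊕⊗ = IsCommutativeRingˡ.isCommutativeRing record
        { isEquivalence = record
          { refl = λ _ → refl ; sym = λ p i → sym (p i) ; trans = λ p q i → trans (p i) (q i) }
        ; +-cong      = ⊕-cong
        ; *-cong      = ⊗-cong
        ; -‿cong      = λ p n → negate-local n (λ i _ → p i) n ℕₚ.≤-refl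
        ; +-assoc     = λ a b c n → transfer n _ _ (law-+-assoc n) K p≈0 w (a ∷ b ∷ c ∷ [])
        ; +-comm      = ⊕-comm
        ; +-identityˡ = λ a n → transfer n _ _ (law-+-identity n) K p≈0 w (a ∷ [])
        ; -‿inverseˡ  = λ a i → trans (⊕-comm (negate a) a i) (⊕-inverseʳ a i)
        ; *-assoc     = λ a b c n → transfer n _ _ (law-*-assoc n) K p≈0 w (a ∷ b ∷ c ∷ [])
        ; *-comm      = λ a b n → transfer n _ _ (law-*-comm n) K p≈0 w (a ∷ b ∷ [])
        ; *-identityˡ = λ a n → transfer n _ _ (law-*-identity n) K p≈0 w (a ∷ [])
        ; distribˡ    = λ a b c n → transfer n _ _ (law-distrib n) K p≈0 w (a ∷ b ∷ c ∷ [])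
        }

    witt : WittStructure p q K w
    witt = record
      { _⊕_ = _⊕_ ; _⊗_ = _⊗_ ; negate = negate ; isCommutativeRing = isCommutativeRing-⊕⊗
      ; ⊕-local = ⊕-local ; ⊗-local = ⊗-local
      ; π-shift   = λ a n → transfer n _ _ (law-π n) K p≈0 w (a ∷ [])
      ; take⊕drop = λ k a n → transfer n _ _ (law-take-drop n k) K p≈0 w (a ∷ [])
      -- `head` reads only entry 0, so constant sequences can carry x and y.
      ; leading-* = λ x y n → transfer n _ _ (law-head* n) K p≈0 w ((λ _ → x) ∷ (λ _ → y) ∷ [])
      ; p-expansion = λ n → trans (reflexive (≡.cong (λ f → f n) (multiple-𝟙 p)))
          (transfer n _ _ (law-p n) K p≈0 w [])
      }
      where
      wittRing = record { isCommutativeRing = isCommutativeRing-⊕⊗ }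
      multiple-𝟙 : ∀ k → multiple wittRing k (leading 1#) ≡ ⟦ k • 𝟙 ⟧ []
      multiple-𝟙 zero    = ≡.refl
      multiple-𝟙 (suc k) = ≡.cong (leading 1# ⊕_) (multiple-𝟙 k)

-- Consequences of π a = (0, a₀^q, a₁^q, …)

module WittFacts (p e : ℕ) (prime-p : Prime p) (K : CommutativeRing c ℓ) (w : ℕ → ∣ K ∣)
                 (𝕎 : WittStructure p (p ℕ.^ e) K w) where
  open CommutativeRing K hiding (isCommutativeRing)
  open WittStructure 𝕎 public
  open Exp commutativeSemiring using (^-congˡ; ^-congʳ; ^-assocʳ)
  private
    module W = CommutativeRing wittRing
    q = p ℕ.^ e

    positive-q : 0 ℕ.< q
    positive-q = prime^n>0 prime-p e

    ≤-split : ∀ {i n} → i ℕ.≤ n → ∃ λ k → i ℕ.+ k ≡ n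
    ≤-split i≤n = ℕₚ.m≤n⇒∃[o]m+o≡n i≤n

    0^q : ∀ {k} → 0 ℕ.< k → ∀ {x} → x ≈ 0# → x ^⟨ K ⟩ k ≈ 0#
    0^q (s≤s _) x≈0 = trans (*-congʳ x≈0) (zeroˡ _)

  ⊕-vanishing : ∀ n {a b} → b ≈[≤ n ] (λ _ → 0#) → a ⊕ b ≈[≤ n ] a
  ⊕-vanishing n {a} b≈0 i i≤n = trans (⊕-local n {a} {a} (λ _ _ → refl) b≈0 i i≤n) (W.+-identityʳ a i)

  π⊗-zero : ∀ a → (π-sequence ⊗ a) 0 ≈ 0#
  π⊗-zero a = π-shift a 0

  π⊗-suc : ∀ a i → (π-sequence ⊗ a) (suc i) ≈ a i ^⟨ K ⟩ q
  π⊗-suc a i = π-shift a (suc i)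

  -- Multiplication by π gains one coordinate of precision, which drives the inductions on Horner
  -- sums.
  π⊗-local : ∀ n {a b} → a ≈[≤ n ] b → π-sequence ⊗ a ≈[≤ suc n ] π-sequence ⊗ b
  π⊗-local n {a} {b} a≈b zero    _         = trans (π⊗-zero a) (sym (π⊗-zero b))
  π⊗-local n {a} {b} a≈b (suc i) (s≤s i≤n) =
    trans (π⊗-suc a i) (trans (^-congˡ q (a≈b i i≤n)) (sym (π⊗-suc b i)))

  -- Coordinate 0 of a product depends only on coordinates 0, so each factor may be replaced by a
  -- Teichmüller element.
  ⊗-head : ∀ a b → (a ⊗ b) 0 ≈ a 0 * b 0
  ⊗-head a b = trans (⊗-local 0 {a} {leading (a 0)} {b} {leading (b 0)}
    (λ { zero _ → refl }) (λ { zero _ → refl }) 0 z≤n) (leading-* (a 0) (b 0) 0)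

  leading-cong : ∀ {x y} → x ≈ y → leading x ≋ leading y
  leading-cong eq zero    = eq
  leading-cong eq (suc i) = refl

  leading-^ : ∀ x n → leading x ^⟨ wittRing ⟩ n ≋ leading (x ^⟨ K ⟩ n)
  leading-^ x zero    _ = refl
  leading-^ x (suc n) = W.trans {leading x ⊗ leading x ^⟨ wittRing ⟩ n} {leading x ⊗ leading (x ^⟨ K ⟩ n)}
    (W.*-congˡ {leading x} (leading-^ x n)) (leading-* x (x ^⟨ K ⟩ n))

  leading-0 : leading 0# ≋ λ _ → 0#
  leading-0 zero    = refl
  leading-0 (suc i) = refl

  πⁿ : ℕ → Sequence
  πⁿ n = π-sequence ^⟨ wittRing ⟩ n

  ⊗πⁿ-low : ∀ n c i → i ℕ.< n → (c ⊗ πⁿ n) i ≈ 0#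
  ⊗πⁿ-low (suc n) c i i<n = trans (swap i) (low i i<n)
    where
    swap : c ⊗ πⁿ (suc n) ≋ π-sequence ⊗ (c ⊗ πⁿ n)
    swap = x∙yz≈y∙xz c π-sequence (πⁿ n)
      where open CSemigroupProperties W.*-commutativeSemigroup using (x∙yz≈y∙xz)
    low : ∀ i → i ℕ.< suc n → (π-sequence ⊗ (c ⊗ πⁿ n)) i ≈ 0#
    low zero    _         = π⊗-zero (c ⊗ πⁿ n)
    low (suc i) (s≤s i<n) = trans (π⊗-suc (c ⊗ πⁿ n) i) (0^q positive-q (⊗πⁿ-low n c i i<n))

  module SeriesMap {R : CommutativeRing 0ℓ 0ℓ} (g : RingHom R wittRing) where
    open SeriesFacts R
    open Horner g π-sequence
    private
      module g = RingHom g
      module R = CommutativeRing R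
      module S = CommutativeRing powerSeries

    private
      horner-stable : ∀ n k f → horner (suc n) f ≈[≤ n ] horner (suc n ℕ.+ k) f
      horner-stable zero    k f i i≤0 = ⊕-local 0 {g.to (f 0)} (λ _ _ → refl)
        (λ { zero _ → trans (π⊗-zero (λ _ → 0#)) (sym (π⊗-zero (horner k (tail f)))) }) i i≤0
      horner-stable (suc n) k f = ⊕-local (suc n) {g.to (f 0)} (λ _ _ → refl)
        (π⊗-local n (horner-stable n k (tail f)))

    -- Σ g(fᵢ) πⁱ converges coordinatewise: terms from π^(n+1) on do not reach coordinate n, so n +
    -- 1 terms determine it.
    seriesMap : Series → Sequence
    seriesMap f n = horner (suc n) f n

    private
      map-horner : ∀ n f → seriesMap f ≈[≤ n ] horner (suc n) f
      map-horner n f i i≤n with k , ≡.refl ← ≤-split i≤n = horner-stable i k f i ℕₚ.≤-refl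

      -- A product of truncated sums has extra terms of order at least n + 1, so equality can hold
      -- only up to coordinate n. In the induction the tail is known one coordinate less precisely,
      -- and the factor π makes up for it.
      horner-⋆ : ∀ n f h → horner (suc n) (f ⋆ h) ≈[≤ n ] horner (suc n) f ⊗ horner (suc n) h
      horner-⋆ n f h = λ i i≤n → trans (expand i) (trans
        (⊕-local n {g.to (f 0) ⊗ g.to (h 0)} {b = π-sequence ⊗ (g.to (f 0) ⊗ H ⊕ horner n (tail f ⋆ h))}
          {π-sequence ⊗ (g.to (f 0) ⊗ H ⊕ F ⊗ (g.to (h 0) ⊕ π-sequence ⊗ H))}
          (λ _ _ → refl) (step n ≡.refl) i i≤n)
        (horner-product (g.to (f 0)) (g.to (h 0)) π-sequence H F i))
        where
        H = horner n (tail h)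
        F = horner n (tail f)
        expand : horner (suc n) (f ⋆ h) ≋
          g.to (f 0) ⊗ g.to (h 0) ⊕ π-sequence ⊗ (g.to (f 0) ⊗ H ⊕ horner n (tail f ⋆ h))
        expand = W.+-cong {g.to (f 0 R.* h 0)} {g.to (f 0) ⊗ g.to (h 0)} (g.*-homo (f 0) (h 0))
          (W.*-congˡ {π-sequence} (W.trans {horner n (tail (f ⋆ h))}
            {horner n (λ i → f 0 R.* h (suc i)) ⊕ horner n (tail f ⋆ h)}
            (horner-+ n (λ i → f 0 R.* h (suc i)) (tail f ⋆ h))
            (W.+-congʳ {horner n (tail f ⋆ h)} {horner n (λ i → f 0 R.* h (suc i))} {g.to (f 0) ⊗ H}
              (horner-scale n (f 0) (tail h)))))
        step : ∀ k → k ≡ n → π-sequence ⊗ (g.to (f 0) ⊗ H ⊕ horner n (tail f ⋆ h)) ≈[≤ n ]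
                             π-sequence ⊗ (g.to (f 0) ⊗ H ⊕ F ⊗ (g.to (h 0) ⊕ π-sequence ⊗ H))
        step zero    ≡.refl zero _ = trans (π⊗-zero _) (sym (π⊗-zero _))
        step (suc k) ≡.refl = π⊗-local k (⊕-local k {g.to (f 0) ⊗ H} (λ _ _ → refl)
          (λ i i≤k → trans (horner-⋆ k (tail f) h i i≤k)
            (⊗-local k {F} {F} {horner (suc k) h} {g.to (h 0) ⊕ π-sequence ⊗ H} (λ _ _ → refl)
              (λ j j≤k → trans (horner-stable k 1 h j j≤k)
                (reflexive (≡.cong (λ l → horner (suc l) h j) (ℕₚ.+-comm k 1)))) i i≤k)))

      map-constant : ∀ x → seriesMap (constant x) ≋ g.to x
      map-constant x n = trans (W.+-congˡ {g.to x} {π-sequence ⊗ horner n (tail (constant x))} {λ _ → 0#}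
          (W.trans {π-sequence ⊗ horner n (tail (constant x))} {π-sequence ⊗ (λ _ → 0#)}
            (W.*-congˡ {π-sequence} (horner-0 n (λ _ → R.refl))) (W.zeroʳ π-sequence)) n)
        (W.+-identityʳ (g.to x) n)

    seriesHom : RingHom powerSeries wittRing
    seriesHom = makeHom {R = powerSeries} {S = wittRing} seriesMap
      (λ p n → horner-cong (suc n) p n)
      (λ f h n → trans (horner-+ (suc n) f h n) (sym
        (⊕-local n (map-horner n f) (map-horner n h) n ℕₚ.≤-refl)))
      (λ f h n → trans (horner-⋆ n f h n ℕₚ.≤-refl) (sym
        (⊗-local n (map-horner n f) (map-horner n h) n ℕₚ.≤-refl)))
      (λ n → trans (map-constant R.1# n) (g.1#-homo n))

    seriesHom-constant : ∀ x → RingHom.to seriesHom (constant x) ≋ g.to x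
    seriesHom-constant = map-constant

    seriesHom-π : RingHom.to seriesHom variable-π ≋ π-sequence
    seriesHom-π zero    = trans (⊕-local 0 {g.to R.0#} {λ _ → 0#} {π-sequence ⊗ (λ _ → 0#)} {λ _ → 0#} (λ i _ → g.0#-homo i)
      (λ { zero _ → π⊗-zero (λ _ → 0#) }) 0 z≤n)
      (W.+-identityˡ (λ _ → 0#) 0)
    seriesHom-π (suc n) = trans
      (W.+-cong {g.to R.0#} {λ _ → 0#} {π-sequence ⊗ horner (suc n) (tail variable-π)} {π-sequence ⊗ leading 1#}
        g.0#-homo (W.*-congˡ {π-sequence} one) (suc n))
      (trans (W.+-identityˡ (π-sequence ⊗ leading 1#) (suc n)) (W.*-identityʳ π-sequence (suc n)))
      where
      one : horner (suc n) (tail variable-π) ≋ leading 1#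
      one = W.trans {g.to R.1# ⊕ π-sequence ⊗ horner n (tail (tail variable-π))} {leading 1# ⊕ (λ _ → 0#)}
        (W.+-cong {g.to R.1#} {leading 1#} g.1#-homo
          (W.trans {π-sequence ⊗ horner n (tail (tail variable-π))} {π-sequence ⊗ (λ _ → 0#)}
            (W.*-congˡ {π-sequence} (horner-0 n (λ _ → R.refl))) (W.zeroʳ π-sequence)))
        (W.+-identityʳ (leading 1#))

    -- The series Σ [yᵢ] πⁱ has coordinates yᵢ^(q^i). Coordinate 0 is split off without carries by
    -- `take⊕drop`, and each multiplication by π raises the remaining ones to the power q.
    seriesHom-leading : ∀ f (y : Sequence) → (∀ i → g.to (f i) ≋ leading (y i)) →
                        RingHom.to seriesHom f ≋ λ i → y i ^⟨ K ⟩ (q ℕ.^ i)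
    seriesHom-leading f y eq n = go n f y eq n ℕₚ.≤-refl
      where
      go : ∀ n f (y : Sequence) → (∀ i → g.to (f i) ≋ leading (y i)) →
           horner (suc n) f ≈[≤ n ] λ i → y i ^⟨ K ⟩ (q ℕ.^ i)
      go n f y eq i i≤n = trans
        (⊕-local n {g.to (f 0)} {takeSequence 0# 1 Y} {π-sequence ⊗ horner n (tail f)} {dropSequence 0# 1 Y}
          first (rest n ≡.refl) i i≤n)
        (take⊕drop 1 Y i)
        where
        Y : Sequence
        Y i = y i ^⟨ K ⟩ (q ℕ.^ i)
        first : g.to (f 0) ≈[≤ n ] takeSequence 0# 1 Y
        first zero    _ = trans (eq 0 0) (sym (*-identityʳ (y 0)))
        first (suc i) _ = eq 0 (suc i)
        rest : ∀ k → k ≡ n → π-sequence ⊗ horner n (tail f) ≈[≤ n ] dropSequence 0# 1 Y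
        rest k ≡.refl zero _ = π⊗-zero (horner n (tail f))
        rest (suc k) ≡.refl (suc i) (s≤s i≤k) = begin
          (π-sequence ⊗ horner n (tail f)) (suc i)    ≈⟨ π⊗-suc (horner n (tail f)) i ⟩
          horner n (tail f) i ^⟨ K ⟩ q
            ≈⟨ ^-congˡ q (go k (tail f) (λ j → y (suc j)) (λ j → eq (suc j)) i i≤k) ⟩
          (y (suc i) ^⟨ K ⟩ (q ℕ.^ i)) ^⟨ K ⟩ q       ≈⟨ ^-assocʳ (y (suc i)) (q ℕ.^ i) q ⟩
          y (suc i) ^⟨ K ⟩ (q ℕ.^ i ℕ.* q)            ≈⟨ ^-congʳ (y (suc i)) (ℕₚ.*-comm (q ℕ.^ i) q) ⟩
          y (suc i) ^⟨ K ⟩ (q ℕ.* q ℕ.^ i)            ∎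
          where open SetoidReasoning setoid

  module PerfectCase (perfect : IsPerfect p K) where
    private
      roots : HasRoots q K
      roots = roots-pⁿ prime-p {R = K} (λ x → let y , eq = proj₂ (proj₂ perfect) x in y , eq refl) e

      injective-pⁿ : ∀ n {x y} → x ^⟨ K ⟩ (p ℕ.^ n) ≈ y ^⟨ K ⟩ (p ℕ.^ n) → x ≈ y
      injective-pⁿ zero    eq = trans (sym (*-identityʳ _)) (trans eq (*-identityʳ _))
      injective-pⁿ (suc n) {x} {y} eq = proj₁ (proj₂ perfect) (injective-pⁿ n
        (trans (^-assocʳ x p (p ℕ.^ n)) (trans eq (sym (^-assocʳ y p (p ℕ.^ n))))))

    q-injective : ∀ {x} → x ^⟨ K ⟩ q ≈ 0# → x ≈ 0#
    q-injective {x} eq = injective-pⁿ e (trans eq (sym (0^q positive-q refl)))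

    -- A sequence with a₀ = 0 is π times the sequence of q-th roots of a₁, a₂, .... Injectivity of
    -- the q-th power makes the roots vanish where a does, so the induction continues with n - 1.
    πⁿ-divides : ∀ n a → (∀ i → i ℕ.< n → a i ≈ 0#) → ∃ λ c → a ≋ c ⊗ πⁿ n
    πⁿ-divides zero    a _   = a , W.sym {a ⊗ leading 1#} {a} (W.*-identityʳ a)
    πⁿ-divides (suc n) a low =
      let c , eq = πⁿ-divides n x (λ i i<n → q-injective (trans (proj₂ (roots (a (suc i)))) (low (suc i) (s≤s i<n)))) in
      c , W.trans {a} {π-sequence ⊗ x} {c ⊗ πⁿ (suc n)} a≋πx
        (W.trans {π-sequence ⊗ x} {π-sequence ⊗ (c ⊗ πⁿ n)} (W.*-congˡ {π-sequence} eq)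
          (x∙yz≈y∙xz π-sequence c (πⁿ n)))
      where
      open CSemigroupProperties W.*-commutativeSemigroup using (x∙yz≈y∙xz)
      x : Sequence
      x i = proj₁ (roots (a (suc i)))
      a≋πx : a ≋ π-sequence ⊗ x
      a≋πx zero    = trans (low 0 (s≤s z≤n)) (sym (π⊗-zero x))
      a≋πx (suc i) = sym (trans (π⊗-suc x i) (proj₂ (roots (a (suc i)))))

-- Tuples of length m + 1

-- A surjection r with chosen preimages s whose kernel relation is a congruence, which is enough to
-- transport the ring structure to X. It serves twice: from sequences to tuples, and from tuples to
-- points of the spectrum.
record Section (W : CommutativeRing a b) (X : Setoid c ℓ) : Set (a ⊔ b ⊔ c ⊔ ℓ) where
  private module W = CommutativeRing W
  open Setoid X using (_≈_) renaming (Carrier to ∣X∣)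
  field
    r      : W.Carrier → ∣X∣
    s      : ∣X∣ → W.Carrier
    r-cong : ∀ {x y} → x W.≈ y → r x ≈ r y
    s-cong : ∀ {x y} → x ≈ y → s x W.≈ s y
    r-s    : ∀ x → r (s x) ≈ x
    r-+    : ∀ {x x′ y y′} → r x ≈ r x′ → r y ≈ r y′ → r (x W.+ y) ≈ r (x′ W.+ y′)
    r-*    : ∀ {x x′ y y′} → r x ≈ r x′ → r y ≈ r y′ → r (x W.* y) ≈ r (x′ W.* y′)

module Transport {W : CommutativeRing a b} {X : Setoid c ℓ} (section : Section W X) where
  open Section section
  open Setoid X using (_≈_; trans; sym; refl)
  private
    module W = CommutativeRing W
    module X = Setoid X

  ring : CommutativeRing c ℓ
  ring = record
    { Carrier = X.Carrier
    ; _≈_ = _≈_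
    ; _+_ = λ x y → r (s x W.+ s y)
    ; _*_ = λ x y → r (s x W.* s y)
    ; -_  = λ x → r (W.- s x)
    ; 0#  = r W.0#
    ; 1#  = r W.1#
    ; isCommutativeRing = IsCommutativeRingˡ.isCommutativeRing record
      { isEquivalence = X.isEquivalence
      ; +-cong      = λ p q → r-cong (W.+-cong (s-cong p) (s-cong q))
      ; *-cong      = λ p q → r-cong (W.*-cong (s-cong p) (s-cong q))
      ; -‿cong      = λ p → r-cong (W.-‿cong (s-cong p))
      ; +-assoc     = λ x y z → trans (r-+ (r-s _) refl)
          (trans (r-cong (W.+-assoc (s x) (s y) (s z))) (sym (r-+ refl (r-s _))))
      ; +-comm      = λ x y → r-cong (W.+-comm (s x) (s y))
      ; +-identityˡ = λ x → trans (r-+ (r-s _) refl) (trans (r-cong (W.+-identityˡ (s x))) (r-s x))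
      ; -‿inverseˡ  = λ x → trans (r-+ (r-s _) refl) (r-cong (W.-‿inverseˡ (s x)))
      ; *-assoc     = λ x y z → trans (r-* (r-s _) refl)
          (trans (r-cong (W.*-assoc (s x) (s y) (s z))) (sym (r-* refl (r-s _))))
      ; *-comm      = λ x y → r-cong (W.*-comm (s x) (s y))
      ; *-identityˡ = λ x → trans (r-* (r-s _) refl) (trans (r-cong (W.*-identityˡ (s x))) (r-s x))
      ; distribˡ    = λ x y z → trans (r-* refl (r-s _))
          (trans (r-cong (W.distribˡ (s x) (s y) (s z))) (sym (r-+ (r-s _) (r-s _))))
      }
    }

  hom : RingHom W ring
  hom = makeHom {S = ring} r r-cong
    (λ _ _ → sym (r-+ (r-s _) (r-s _))) (λ _ _ → sym (r-* (r-s _) (r-s _))) refl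

  algebraOn : ∀ {a′ b′} {S : CommutativeRing a′ b′} → RingHom S ring → AlgebraOn S X
  algebraOn f = record
    { isCommutativeRing = CommutativeRing.isCommutativeRing ring
    ; structure = RingHom.to f ; structure-isRingHom = RingHom.isRingHom f }

module TupleRing (p e : ℕ) (prime-p : Prime p) (m : ℕ ⁺) (K : CommutativeRing c ℓ) (w : ℕ → ∣ K ∣)
                 (𝕎 : WittStructure p (p ℕ.^ e) K w) where
  open CommutativeRing K hiding (isCommutativeRing; ring)
  open WittFacts p e prime-p K w 𝕎
  private module W = CommutativeRing wittRing

  Tuple : Set _
  Tuple = Interval 0 m → Carrier

  tupleSetoid : Setoid c ℓ
  tupleSetoid = record
    { Carrier = Tuple
    ; _≈_     = λ a b → ∀ i → a i ≈ b i
    ; isEquivalence = record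
      { refl  = λ _ → refl
      ; sym   = λ p i → sym (p i)
      ; trans = λ p q i → trans (p i) (q i)
      }
    }

  restrict : Sequence → Tuple
  restrict a i = a (val i)

  -- Extension by zero. Coordinates up to m of a sum or product read only coordinates up to m, so
  -- the entries added here do not influence the operations on tuples.
  fill : Tuple → Sequence
  fill x i with ≤⁺-dec ℕₚ._≤?_ [ i ] m
  ... | yes i≤m = x (index i z≤n i≤m)
  ... | no  _   = 0#

  fill-val : ∀ x i → fill x (val i) ≈ x i
  fill-val x (index i _ i≤m) with ≤⁺-dec ℕₚ._≤?_ [ i ] m
  ... | yes _   = refl
  ... | no  i≰m = ⊥-elim-irr (i≰m i≤m)

  fill-agree : ∀ n {x y} → (∀ i → val i ℕ.≤ n → x i ≈ y i) → fill x ≈[≤ n ] fill y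
  fill-agree n eq i i≤n with ≤⁺-dec ℕₚ._≤?_ [ i ] m
  ... | yes i≤m = eq (index i z≤n i≤m) i≤n
  ... | no  _   = refl

  private
    fill-cong : ∀ {x y} → (∀ i → x i ≈ y i) → fill x ≋ fill y
    fill-cong eq i = fill-agree i (λ i _ → eq i) i ℕₚ.≤-refl

    agree : ∀ {a b} → (∀ (i : Interval 0 m) → a (val i) ≈ b (val i)) →
            ∀ (i : Interval 0 m) → a ≈[≤ val i ] b
    agree eq (index i _ i≤m) j j≤i = eq (index j z≤n (≤⁺-trans ℕₚ.≤-trans [ j≤i ] i≤m))

    restriction : Section wittRing tupleSetoid
    restriction = record
      { r      = restrict
      ; s      = fill
      ; r-cong = λ p i → p (val i)
      ; s-cong = fill-cong
      ; r-s    = fill-val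
      ; r-+    = λ {x} {x′} {y} {y′} p q i →
          ⊕-local (val i) {x} {x′} {y} {y′} (agree p i) (agree q i) (val i) ℕₚ.≤-refl
      ; r-*    = λ {x} {x′} {y} {y′} p q i →
          ⊗-local (val i) {x} {x′} {y} {y′} (agree p i) (agree q i) (val i) ℕₚ.≤-refl
      }

  open Transport restriction public renaming (ring to tupleRing; hom to restrictHom)

  private module T = CommutativeRing tupleRing

  -- The divisor d is only required to equal πⁿ up to `≈`, so that the results apply to powers of
  -- the image of π as well as to that image itself.
  module Modulo (n : ℕ) (d : Tuple) (d≈πⁿ : ∀ i → d i ≈ restrict (πⁿ n) i) where
    open Principal tupleRing d

    *d-low : ∀ z i → val i ℕ.< n → (z T.* d) i ≈ 0#
    *d-low z i i<n = trans
      (T.*-congˡ {z} {d} {restrict (πⁿ n)} d≈πⁿ i)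
      (trans (T.*-congʳ {restrict (πⁿ n)} {z} {restrict (fill z)} (λ j → sym (fill-val z j)) i)
        (trans (sym (RingHom.*-homo restrictHom (fill z) (πⁿ n) i)) (⊗πⁿ-low n (fill z) (val i) i<n)))

    -- x is y plus a multiple of πⁿ, whose coordinates below n vanish, and by locality adding it
    -- leaves those coordinates of y unchanged.
    coordinates-agree : ∀ {x y} → x ≈/ y → ∀ i → val i ℕ.< n → x i ≈ y i
    coordinates-agree {x} {y} x≈y i i<n = let z , eq = ≈/⇒difference {x} {y} x≈y in begin
      x i                                    ≈⟨ eq i ⟩
      (fill y ⊕ fill (z T.* d)) (val i)
        ≈⟨ ⊕-vanishing (val i) {fill y} (λ j j≤i → trans
             (fill-agree (val i) {z T.* d} {λ _ → 0#} (λ l l≤i → *d-low z l (ℕₚ.≤-<-trans l≤i i<n)) j j≤i)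
             (fill-0 j)) (val i) ℕₚ.≤-refl ⟩
      fill y (val i)                         ≈⟨ fill-val y i ⟩
      y i                                    ∎
      where
      open SetoidReasoning setoid
      fill-0 : ∀ j → fill (λ _ → 0#) j ≈ 0#
      fill-0 j with ≤⁺-dec ℕₚ._≤?_ [ j ] m
      ... | yes _ = refl
      ... | no  _ = refl

    module _ (perfect : IsPerfect p K) where
      open PerfectCase perfect

      d-divides : ∀ x → (∀ i → val i ℕ.< n → x i ≈ 0#) → ∃ λ z → x T.≈ z T.* d
      d-divides x low =
        let c , eq = πⁿ-divides n (fill x) low′ in
        restrict c , λ i → trans (sym (fill-val x i)) (trans (eq (val i))
          (trans (RingHom.*-homo restrictHom c (πⁿ n) i)
            (T.*-congˡ {restrict c} {restrict (πⁿ n)} {d} (λ j → sym (d≈πⁿ j)) i)))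
        where
        low′ : ∀ i → i ℕ.< n → fill x i ≈ 0#
        low′ i i<n with ≤⁺-dec ℕₚ._≤?_ [ i ] m
        ... | yes i≤m = low (index i z≤n i≤m) i<n
        ... | no  _   = refl

      agree⇒≈/ : ∀ {x y} → (∀ i → val i ℕ.< n → x i ≈ y i) → x ≈/ y
      agree⇒≈/ {x} {y} eq =
        let z , eq′ = d-divides (x T.- y) λ i i<n → begin
              (x T.- y) i       ≈⟨ ⊕-local (val i) {fill x} {fill y} {fill (T.- y)} {fill (T.- y)}
                (fill-agree (val i) {x} {y} (λ j j≤i → eq j (ℕₚ.≤-<-trans j≤i i<n))) (λ _ _ → refl) (val i) ℕₚ.≤-refl ⟩
              (y T.- y) i       ≈⟨ T.-‿inverseʳ y i ⟩
              restrict W.0# i   ≡⟨⟩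
              0#                ∎
        in resp∈ {z T.* d} {x T.- y} (λ i → sym (eq′ i)) (multiple∈ z (generator {d} (λ _ → refl)))
        where open SetoidReasoning setoid

  head-index : Interval 0 m
  head-index = index 0 z≤n (zero≤ m)
    where
    zero≤ : ∀ m → [ 0 ] ≤⁺ m
    zero≤ ⊤⁺    = _ ≤⊤⁺
    zero≤ [ _ ] = [ z≤n ]

  *-head : ∀ x y → (x T.* y) head-index ≈ x head-index * y head-index
  *-head x y = trans (⊗-head (fill x) (fill y)) (*-cong (fill-val x head-index) (fill-val y head-index))

  ^-head : ∀ x n → (x ^⟨ tupleRing ⟩ n) head-index ≈ x head-index ^⟨ K ⟩ n
  ^-head x zero    = refl
  ^-head x (suc n) = trans (*-head x (x ^⟨ tupleRing ⟩ n)) (*-congˡ (^-head x n))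

-- Injectivity of the multiplication map on the tensor product

module TensorFacts {a b c d} {R : CommutativeRing a b} (π : ∣ R ∣) (B : CommAlgebra R c d) where
  private
    module R = CommutativeRing R
    module B = CommAlgebra B
    structure : RingHom R B.ring
    structure = ringHom B.structure B.structure-isRingHom
    module structure = RingHom structure
  open IdealTensor R π B

  tensorGroup : AbelianGroup _ _
  tensorGroup = record
    { Carrier = Tensor ; _≈_ = _≈⊗_ ; _∙_ = _∔_ ; ε = 𝟘 ; _⁻¹ = ∸_
    ; isAbelianGroup = record
      { isGroup = record
        { isMonoid = record
          { isSemigroup = record
            { isMagma = record
              { isEquivalence = record { refl = ≈⊗-refl ; sym = ≈⊗-sym ; trans = ≈⊗-trans }
              ; ∙-cong = ∔-cong }
            ; assoc = ∔-assoc }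
          ; identity = ∔-identityˡ , λ x → ≈⊗-trans (∔-comm _ _) (∔-identityˡ x) }
        ; inverse = ∸-inverseˡ , λ x → ≈⊗-trans (∔-comm _ _) (∸-inverseˡ x)
        ; ⁻¹-cong = ∸-cong }
      ; comm = ∔-comm }
    }
  private
    module G = AbelianGroup tensorGroup
    module GP = GroupProperties G.group

    idempotent⇒𝟘 : ∀ {x} → x ≈⊗ x ∔ x → x ≈⊗ 𝟘
    idempotent⇒𝟘 {x} eq = GP.∙-cancelˡ x x 𝟘 (G.trans (G.sym eq) (G.sym (G.identityʳ x)))

  π̂ : LeftModule.Carrierᴹ (principalIdeal R π)
  π̂ = π , R.1# , R.*-identityˡ π

  ⊗-zeroʳ : ∀ x {y} → y B.≈ B.0# → x ⊗ y ≈⊗ 𝟘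
  ⊗-zeroʳ x {y} y≈0 = idempotent⇒𝟘 (G.trans
    (⊗-cong {m = x} R.refl (B.trans y≈0 (B.sym (B.trans (B.+-cong y≈0 y≈0) (B.+-identityˡ B.0#)))))
    (⊗-additiveʳ x y y))

  ⊗-zeroˡ : ∀ x y → proj₁ x R.≈ R.0# → x ⊗ y ≈⊗ 𝟘
  ⊗-zeroˡ x y x≈0 = idempotent⇒𝟘 (G.trans
    (⊗-cong {m = x} {m′ = LeftModule._+ᴹ_ (principalIdeal R π) x x}
      (R.trans x≈0 (R.sym (R.trans (R.+-cong x≈0 x≈0) (R.+-identityˡ R.0#)))) B.refl)
    (⊗-additiveˡ x x y))

  ⊗-neg : ∀ x y → ∸ (x ⊗ y) ≈⊗ x ⊗ (B.- y)
  ⊗-neg x y = G.sym (GP.inverseʳ-unique (x ⊗ y) (x ⊗ (B.- y))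
    (G.trans (G.sym (⊗-additiveʳ x y (B.- y))) (⊗-zeroʳ x (B.-‿inverseʳ y))))

  ⊗-balanced-π : ∀ r y → (x : LeftModule.Carrierᴹ (principalIdeal R π)) → r R.* π R.≈ proj₁ x →
                 x ⊗ y ≈⊗ π̂ ⊗ (B.structure r B.* y)
  ⊗-balanced-π r y x eq = G.trans
    (⊗-cong {m = x} {m′ = LeftModule._*ₗ_ (principalIdeal R π) r π̂} (R.sym eq) B.refl)
    (⊗-balanced r π̂ y)

  -- An element of the ideal carries its r with x = r π, which balancedness moves to the right
  -- factor. Sums and negatives of tensors with the common left factor π then merge.
  normal-form : ∀ u → ∃ λ y → u ≈⊗ π̂ ⊗ y × multiply u B.≈ B.structure π B.* y
  normal-form (x@(_ , r , eq) ⊗ y) = B.structure r B.* y , ⊗-balanced-π r y x eq , (begin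
    B.structure (proj₁ x) B.* y                   ≈⟨ B.*-congʳ (structure.cong (R.trans (R.sym eq) (R.*-comm r π))) ⟩
    B.structure (π R.* r) B.* y                   ≈⟨ B.*-congʳ (structure.*-homo π r) ⟩
    (B.structure π B.* B.structure r) B.* y       ≈⟨ B.*-assoc _ _ _ ⟩
    B.structure π B.* (B.structure r B.* y)       ∎)
    where open SetoidReasoning B.setoid
  normal-form (u ∔ v) =
    let y , u≈ , mu≈ = normal-form u ; z , v≈ , mv≈ = normal-form v in
    y B.+ z , G.trans (∔-cong u≈ v≈) (G.sym (⊗-additiveʳ π̂ y z))
            , B.trans (B.+-cong mu≈ mv≈) (B.sym (B.distribˡ _ y z))
  normal-form (∸ u) = let y , u≈ , mu≈ = normal-form u in
    B.- y , G.trans (∸-cong u≈) (⊗-neg π̂ y)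
          , B.trans (B.-‿cong mu≈) (RingProperties.-‿distribʳ-* (CommutativeRing.ring B.ring) _ y)
  normal-form 𝟘 = B.0# , G.sym (⊗-zeroʳ π̂ B.refl) , B.sym (B.zeroʳ _)

  -- Every tensor is of the form π ⊗ y, so it suffices that π ⊗ y vanishes when π y does.
  multiply-injective : (∀ y → B.structure π B.* y B.≈ B.0# → π̂ ⊗ y ≈⊗ 𝟘) →
                       Injective _≈⊗_ B._≈_ multiply
  multiply-injective kills {u} {v} eq =
    let y , u≈ , mu≈ = normal-form u ; z , v≈ , mv≈ = normal-form v in
    G.trans u≈ (G.trans (GP.x∙y⁻¹≈ε⇒x≈y (π̂ ⊗ y) (π̂ ⊗ z)
      (G.trans (∔-cong ≈⊗-refl (⊗-neg π̂ z)) (G.trans (G.sym (⊗-additiveʳ π̂ y (B.- z)))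
        (kills (y B.- z) (begin
          B.structure π B.* (y B.- z)                    ≈⟨ BP.x[y-z]≈xy-xz _ y z ⟩
          B.structure π B.* y B.- B.structure π B.* z    ≈⟨ B.+-congʳ (B.trans (B.sym mu≈) (B.trans eq mv≈)) ⟩
          B.structure π B.* z B.- B.structure π B.* z    ≈⟨ B.-‿inverseʳ _ ⟩
          B.0#                                           ∎))))) (G.sym v≈))
    where
    module BP = RingProperties (CommutativeRing.ring B.ring)
    open SetoidReasoning B.setoid

-- Tuples over a perfect ring

module TupleCRP (p e : ℕ) (prime-p : Prime p) (m : ℕ ⁺) (K : CommutativeRing c ℓ) (w : ℕ → ∣ K ∣)
                (𝕎 : WittStructure p (p ℕ.^ e) K w)
                {R : CommutativeRing 0ℓ 0ℓ} (π : ∣ R ∣)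
                (nilpotent : ∀ {n} → m ≡ [ n ] →
                  CommutativeRing._≈_ R (CommutativeRing._*_ R (π ^⟨ R ⟩ n) π) (CommutativeRing.0# R))
                (f : RingHom R (TupleRing.tupleRing p e prime-p m K w 𝕎))
                (f-π : ∀ i → CommutativeRing._≈_ K (RingHom.to f π i) (WittStructure.π-sequence 𝕎 (val i)))
                (perfect : IsPerfect p K) where
  open CommutativeRing K hiding (isCommutativeRing; ring)
  open TupleRing p e prime-p m K w 𝕎
  open WittFacts p e prime-p K w 𝕎 hiding (_⊗_)
  open PerfectCase perfect
  private
    module R = CommutativeRing R
    module T = CommutativeRing tupleRing
    module f = RingHom f
    πT = f.to π

    B : CommAlgebra R _ _
    B = AlgebraOn.algebra (algebraOn f)

    πT^ : ∀ n → πT ^⟨ tupleRing ⟩ n T.≈ restrict (πⁿ n)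
    πT^ n i = trans (^-congˡᵀ n f-π i) (sym (RingHom.^-homo restrictHom π-sequence n i))
      where open Exp T.commutativeSemiring renaming (^-congˡ to ^-congˡᵀ)

    module Mod n = Modulo n (πT ^⟨ tupleRing ⟩ n) (πT^ n)

    module Residue₁ = Modulo 1 πT (λ i → trans (f-π i)
      (sym (CommutativeRing.*-identityʳ wittRing π-sequence (val i))))

    open Completion tupleRing πT

    complete : Bijective T._≈_ _≈^_ diagonal
    complete = (λ {x} {y} eq i → Mod.coordinates-agree (suc (val i)) {x} {y} (eq (suc (val i))) i ℕₚ.≤-refl)
             , λ y → limit y , λ {z} z≈ n → Mod.agree⇒≈/ n perfect {z} {seq y n}
                 (λ i i<n → trans (z≈ i) (stable y i n i<n))
      where
      -- Coordinate i is read from the entry modulo π^(i+1), the first one that determines it.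
      limit : Limit → Tuple
      limit y i = seq y (suc (val i)) i
      stable : ∀ y i n → val i ℕ.< n → limit y i ≈ seq y n i
      stable y i (suc n) (s≤s i≤n) with ℕₚ.m≤n⇒m<n∨m≡n i≤n
      ... | inj₂ ≡.refl = refl
      ... | inj₁ i<n    = trans (stable y i n i<n)
        (sym (Mod.coordinates-agree n {seq y (suc n)} {seq y n} (coherent y n) i i<n))

    residue = tupleRing /⟨ πT ⟩
    module R₀ = CommutativeRing residue

    residueHom : RingHom tupleRing residue
    residueHom = quotientHom {R = tupleRing} {I = T._≈_ πT}

    -- Together with `≈/⇒head≈` this identifies the residue ring with K through coordinate 0, and
    -- perfectness is inherited from K.
    head≈⇒≈/ : ∀ {x y} → x head-index ≈ y head-index → x R₀.≈ y
    head≈⇒≈/ {x} {y} eq = Residue₁.agree⇒≈/ perfect {x} {y}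
      λ { (index zero _ _) _ → eq ; (index (suc _) _ _) (s≤s ()) }

    ≈/⇒head≈ : ∀ {x y} → x R₀.≈ y → x head-index ≈ y head-index
    ≈/⇒head≈ {x} {y} eq = Residue₁.coordinates-agree {x} {y} eq head-index (s≤s z≤n)

    power : ∀ x → (x ^⟨ residue ⟩ p) head-index ≈ x head-index ^⟨ K ⟩ p
    power x = trans (≈/⇒head≈ {x ^⟨ residue ⟩ p} {x ^⟨ tupleRing ⟩ p}
      (R₀.sym {x ^⟨ tupleRing ⟩ p} {x ^⟨ residue ⟩ p} (RingHom.^-homo residueHom x p))) (^-head x p)

    perfect-residue : IsPerfect p residue
    perfect-residue = head≈⇒≈/ {multiple residue p R₀.1#} {R₀.0#} p-head
      , (λ {x} {y} eq → head≈⇒≈/ {x} {y} (proj₁ (proj₂ perfect) (trans (sym (power x))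
          (trans (≈/⇒head≈ {x ^⟨ residue ⟩ p} {y ^⟨ residue ⟩ p} eq) (power y)))))
      , λ y → let root , root≈ = proj₂ (proj₂ perfect) (y head-index) in
          restrict (leading root) , λ {z} z≈ → head≈⇒≈/ {z ^⟨ residue ⟩ p} {y}
            (trans (power z) (root≈ (≈/⇒head≈ {z} {restrict (leading root)} z≈)))
      where
      p-head : multiple residue p R₀.1# head-index ≈ 0#
      p-head = trans (≈/⇒head≈ {multiple residue p R₀.1#} {multiple tupleRing p T.1#}
          (R₀.sym {multiple tupleRing p T.1#} {multiple residue p R₀.1#} (RingHom.multiple-homo residueHom p)))
        (trans (sym (RingHom.multiple-homo restrictHom p head-index)) (p-expansion 0))

    π-coordinates : ∀ x i → (πT T.* x) i ≈ frobeniusShift (fill x) (val i)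
    π-coordinates x i = trans
      (T.*-cong {πT} {restrict π-sequence} {x} {restrict (fill x)} f-π (λ j → sym (fill-val x j)) i)
      (trans (sym (RingHom.*-homo restrictHom π-sequence (fill x) i)) (π-shift (fill x) (val i)))

    open TensorFacts π B
    open IdealTensor R π B using (_⊗_; _≈⊗_; 𝟘; ⊗-cong; ≈⊗-trans; ≈⊗-sym)

    -- Coordinate n + 1 of π y is yₙ^q, and the q-th power is injective on a perfect ring. The bound
    -- n + 1 ≤ m is what makes that coordinate available.
    low-coordinates : ∀ {n} y → [ suc n ] ≤⁺ m → πT T.* y T.≈ T.0# → ∀ j → val j ≡ n → y j ≈ 0#
    low-coordinates y n<m eq j@(index n _ _) ≡.refl = trans (sym (fill-val y j))
      (q-injective (trans (sym (π-coordinates y (index (suc n) z≤n n<m))) (eq (index (suc n) z≤n n<m))))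

    -- If m is infinite, π y = 0 forces y = 0. If m = n, only coordinate n of y can survive, so y =
    -- πⁿ z, and π ⊗ πⁿ z = πⁿ⁺¹ ⊗ z vanishes because πⁿ⁺¹ = 0 already in R.
    kills : ∀ y → πT T.* y T.≈ T.0# → π̂ ⊗ y ≈⊗ 𝟘
    kills y eq = go m ≡.refl
      where
      go : ∀ m′ → m ≡ m′ → π̂ ⊗ y ≈⊗ 𝟘
      go ⊤⁺ ≡.refl = ⊗-zeroʳ π̂ {y} λ j → low-coordinates y (_ ≤⊤⁺) eq j ≡.refl
      go [ n ] ≡.refl =
        let z , y≈ = Mod.d-divides n perfect y (λ i i<n → low-coordinates y [ i<n ] eq i ≡.refl) in
        ≈⊗-trans (⊗-cong {m = π̂} R.refl (T.trans {y} {z T.* πT ^⟨ tupleRing ⟩ n} {f.to (π ^⟨ R ⟩ n) T.* z} y≈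
          (T.trans {z T.* πT ^⟨ tupleRing ⟩ n} {πT ^⟨ tupleRing ⟩ n T.* z} {f.to (π ^⟨ R ⟩ n) T.* z}
            (T.*-comm z (πT ^⟨ tupleRing ⟩ n))
            (T.*-congʳ {z} {πT ^⟨ tupleRing ⟩ n} {f.to (π ^⟨ R ⟩ n)}
              (T.sym {f.to (π ^⟨ R ⟩ n)} {πT ^⟨ tupleRing ⟩ n} (f.^-homo π n))))))
          (≈⊗-trans (≈⊗-sym (⊗-balanced-π (π ^⟨ R ⟩ n) z πⁿ⁺¹ R.refl))
            (⊗-zeroˡ πⁿ⁺¹ z (nilpotent ≡.refl)))
        where
        πⁿ⁺¹ : LeftModule.Carrierᴹ (principalIdeal R π)
        πⁿ⁺¹ = π ^⟨ R ⟩ n R.* π , π ^⟨ R ⟩ n , R.refl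

  isCRP : IsCRP p R π (AlgebraOn.algebra (algebraOn f))
  isCRP = record
    { complete = complete ; perfect-residue = perfect-residue
    ; tensor-injective = λ {u} {v} → multiply-injective kills {u} {v} }

-- The structure map

module PointsOfWitt (p e : ℕ) (t : ℤ) (prime-p : Prime p) (m : ℕ ⁺) where
  open Setup p e t

  scalarHom : RingHom 𝔽ₚ (ℒ₀ m)
  scalarHom = toPerfection prime-p ∘R conHom {R = 𝔽ₚ} (λ _ _ → ⊥)

  module _ (k : CommAlgebra (ℒ₀ m) c ℓ) where
    private module k = CommAlgebra k

    structureHom : RingHom (ℒ₀ m) k.ring
    structureHom = ringHom k.structure k.structure-isRingHom

    char-k : multiple k.ring p k.1# k.≈ k.0#
    char-k = char-p (structureHom ∘R scalarHom)

    -- ω_j^{q^t}, read as 0 outside 1 ≤ j ≤ m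
    ω-values : ℕ → k.Carrier
    ω-values zero    = k.0#
    ω-values (suc j) with ≤⁺-dec ℕₚ._≤?_ [ suc j ] m
    ... | yes j≤m = k.structure (ωℒ₀-power m t (index (suc j) (s≤s z≤n) j≤m))
    ... | no  _   = k.0#

    ω-values-val : ∀ (j : Interval 1 m) → ω-values (val j) k.≈ k.structure (ωℒ₀-power m t j)
    ω-values-val (index (suc j) _ j≤m) with ≤⁺-dec ℕₚ._≤?_ [ suc j ] m
    ... | yes _   = k.refl
    ... | no  j≰m = ⊥-elim-irr (j≰m j≤m)

  module StructureMap (k : CommAlgebra (ℒ₀ m) c ℓ)
                      (𝕎 : WittStructure p q (CommAlgebra.ring k) (ω-values k)) where
    private module k = CommAlgebra k
    open TupleRing p e prime-p m k.ring (ω-values k) 𝕎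
    open WittFacts p e prime-p k.ring (ω-values k) 𝕎 renaming (leading to leadingℕ; p-expansion to p≋p-sequence)
    open ℒ-Construction m using (ω-power; p-expansion; p-relation; π^m+1)
    private
      module W = CommutativeRing wittRing
      module Z = ℤ[ω] m
      module P = CommutativeRing (ℒ₀ m)

    ω-gen : Interval 1 m × ℕ → Sequence
    ω-gen (j , n) = leadingℕ (k.structure (ωℒ₀ m j (e ℕ.* n)))

    private
      ω-gen-^ : ∀ j n → ω-gen (j , suc n) ^⟨ wittRing ⟩ q ≋ ω-gen (j , n)
      ω-gen-^ j n = W.trans {ω-gen (j , suc n) ^⟨ wittRing ⟩ q}
          {leadingℕ (k.structure (ωℒ₀ m j (e ℕ.* suc n)) ^⟨ k.ring ⟩ q)} {ω-gen (j , n)}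
        (leading-^ (k.structure (ωℒ₀ m j (e ℕ.* suc n))) q) (leading-cong (k.trans
          (k.sym (RingHom.^-homo (structureHom k) (ωℒ₀ m j (e ℕ.* suc n)) q))
          (RingHom.cong (structureHom k) (P.trans
            (P.reflexive (≡.cong (λ l → ωℒ₀ m j l ^⟨ ℒ₀ m ⟩ q) (ℕₚ.*-suc e n)))
            (perfection-rootⁿ prime-p e (e ℕ.* n) (𝔽ₚ[ω].gen j))))))

      ω-relation : ∀ {x y} → Z.RootRelation x y →
        Z.eval wittRing (integer wittRing) ω-gen x ≋ Z.eval wittRing (integer wittRing) ω-gen y
      ω-relation (Z.root j n) = W.trans
        {Z.eval wittRing (integer wittRing) ω-gen (Z.gen (j , suc n) Z.⊛^ q)}
        {ω-gen (j , suc n) ^⟨ wittRing ⟩ q} {ω-gen (j , n)}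
        (eval-^ {S = wittRing} (RingHom.1#-homo (integerHom wittRing)) (Z.gen (j , suc n)) q)
        (ω-gen-^ j n)

    ω-hom : RingHom (ℤ[ω].ring m) wittRing
    ω-hom = evalHom (integerHom wittRing) ω-gen ω-relation

    open SeriesMap ω-hom public

    private
      ω-power-leading : ∀ s j → RingHom.to ω-hom (ω-power s j) ≋ leadingℕ (k.structure (ωℒ₀-power m s j))
      ω-power-leading (+ n) j = W.trans {RingHom.to ω-hom (Z.gen (j , 0) ^⟨ Z.ring ⟩ (q ℕ.^ n))}
          {ω-gen (j , 0) ^⟨ wittRing ⟩ (q ℕ.^ n)}
          {leadingℕ (k.structure (ωℒ₀ m j 0 ^⟨ ℒ₀ m ⟩ (q ℕ.^ n)))}
        (RingHom.^-homo ω-hom (Z.gen (j , 0)) (q ℕ.^ n))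
        (W.trans {ω-gen (j , 0) ^⟨ wittRing ⟩ (q ℕ.^ n)}
          {leadingℕ (k.structure (ωℒ₀ m j (e ℕ.* 0)) ^⟨ k.ring ⟩ (q ℕ.^ n))}
          {leadingℕ (k.structure (ωℒ₀ m j 0 ^⟨ ℒ₀ m ⟩ (q ℕ.^ n)))}
          (leading-^ (k.structure (ωℒ₀ m j (e ℕ.* 0))) (q ℕ.^ n))
          (leading-cong (k.trans
            (k.reflexive (≡.cong (λ l → k.structure (ωℒ₀ m j l) ^⟨ k.ring ⟩ (q ℕ.^ n)) (ℕₚ.*-zeroʳ e)))
            (k.sym (RingHom.^-homo (structureHom k) (ωℒ₀ m j 0) (q ℕ.^ n))))))
      ω-power-leading -[1+ n ] j = W.refl {ω-gen (j , suc n)}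

      p-expansion-leading : ∀ i → RingHom.to ω-hom (p-expansion i) ≋ leadingℕ (ω-values k i)
      p-expansion-leading zero    = W.sym {leadingℕ k.0#} {λ _ → k.0#} leading-0
      p-expansion-leading (suc i) with ≤⁺-dec ℕₚ._≤?_ [ suc i ] m
      ... | yes i≤m = ω-power-leading t (index (suc i) (s≤s z≤n) i≤m)
      ... | no  _   = W.sym {leadingℕ k.0#} {λ _ → k.0#} leading-0

      open PowerSeries (ℤ[ω].ring m) using (constant; powerSeries; variable-π)
      module S = CommutativeRing powerSeries
      module σ = RingHom seriesHom

      p-expansion-value : σ.to p-expansion ≋ p-sequence
      p-expansion-value i = k.trans (seriesHom-leading p-expansion (ω-values k) p-expansion-leading i) (shape i)
        where
        shape : ∀ i → ω-values k i ^⟨ k.ring ⟩ (q ℕ.^ i) k.≈ p-sequence i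
        shape zero    = k.zeroˡ _
        shape (suc i) = k.refl

      p-value : σ.to (constant (Z.con (+ p))) ≋ p-sequence
      p-value = W.trans {σ.to (constant (Z.con (+ p)))} {multiple wittRing p (leadingℕ k.1#)} {p-sequence}
        (seriesHom-constant (Z.con (+ p))) p≋p-sequence

      -- The coordinates of p are known from the Witt structure, those of Σ ω_j^(q^t) πʲ from
      -- `seriesHom-leading`, as each power of ω_j goes to a Teichmüller element; the two sequences
      -- coincide.
      p-relation-value : σ.to p-relation ≋ λ _ → k.0#
      p-relation-value = W.trans {σ.to p-relation}
          {σ.to (constant (Z.con (+ p))) ⊕ σ.to (S.- p-expansion)} {λ _ → k.0#}
        (σ.+-homo (constant (Z.con (+ p))) (S.- p-expansion))
        (W.trans {σ.to (constant (Z.con (+ p))) ⊕ σ.to (S.- p-expansion)} {p-sequence ⊕ negate p-sequence} {λ _ → k.0#}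
          (W.+-cong {σ.to (constant (Z.con (+ p)))} {p-sequence} {σ.to (S.- p-expansion)} {negate p-sequence}
            p-value (W.trans {σ.to (S.- p-expansion)} {negate (σ.to p-expansion)} {negate p-sequence}
              (σ.-‿homo p-expansion) (W.-‿cong {σ.to p-expansion} {p-sequence} p-expansion-value)))
          (W.-‿inverseʳ p-sequence))

      π^m+1-value : ∀ m′ → m′ ≡ m → ∀ (i : Interval 0 m) → σ.to (π^m+1 m′) (val i) k.≈ k.0#
      π^m+1-value ⊤⁺    ≡.refl i = σ.0#-homo (val i)
      π^m+1-value [ n ] ≡.refl i@(index j _ j≤n) = k.trans (σ.^-homo variable-π (suc n) j) (k.trans
        (^-congˡᵂ (suc n) {σ.to variable-π} {π-sequence} seriesHom-π j)
        (k.trans (W.sym {leadingℕ k.1# ⊗ πⁿ (suc n)} {πⁿ (suc n)} (W.*-identityˡ (πⁿ (suc n))) j)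
          (⊗πⁿ-low (suc n) (leadingℕ k.1#) j (s≤s (recompute (j ℕₚ.≤? n) ([≤]-injective j≤n))))))
        where open Exp W.commutativeSemiring renaming (^-congˡ to ^-congˡᵂ)

    structureMap : RingHom (ℒ m) tupleRing
    structureMap = factorHom {S = tupleRing} (restrictHom ∘R seriesHom) λ
      { {z} (inj₁ eq) i → k.trans (RingHom.cong seriesHom {z} {p-relation} (S.sym {p-relation} {z} eq) (val i))
                                  (p-relation-value (val i))
      ; {z} (inj₂ eq) i → k.trans (RingHom.cong seriesHom {z} {π^m+1 m} (S.sym {π^m+1 m} {z} eq) (val i))
                                  (π^m+1-value m ≡.refl i) }

    structureMap-π : ∀ i → RingHom.to structureMap (πℒ m) i k.≈ restrict π-sequence i
    structureMap-π i = seriesHom-π (val i)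

    structureMap-ω : ∀ j n i → RingHom.to structureMap (ωℒ m j n) i k.≈ leading m k (k.structure (ωℒ₀ m j (e ℕ.* n))) i
    structureMap-ω j n i = k.trans (seriesHom-constant (Z.gen (j , n)) (val i)) (shape i)
      where
      shape : ∀ i → ω-gen (j , n) (val i) k.≈ leading m k (k.structure (ωℒ₀ m j (e ℕ.* n))) i
      shape (index zero _ _)    = k.refl
      shape (index (suc _) _ _) = k.refl

    structureMap-π-tuple : ∀ i → RingHom.to structureMap (πℒ m) i k.≈ π-tuple m k i
    structureMap-π-tuple i = k.trans (structureMap-π i) (shape i)
      where
      shape : ∀ i → restrict π-sequence i k.≈ π-tuple m k i
      shape (index zero _ _)          = k.refl
      shape (index (suc zero) _ _)    = k.refl
      shape (index (suc (suc _)) _ _) = k.refl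

  ℒ-nilpotent : ∀ {n} → m ≡ [ n ] → let open CommutativeRing (ℒ m) in
                πℒ m ^⟨ ℒ m ⟩ n * πℒ m ≈ 0#
  ℒ-nilpotent {n} ≡.refl = L.trans {πℒ m ^⟨ ℒ m ⟩ n L.* πℒ m} {πℒ m L.* πℒ m ^⟨ ℒ m ⟩ n} {L.0#}
    (L.*-comm (πℒ m ^⟨ ℒ m ⟩ n) (πℒ m)) (L.trans {πℒ m ^⟨ ℒ m ⟩ suc n} {πℒ m ^⟨ S ⟩ suc n} {L.0#}
      (L.sym {πℒ m ^⟨ S ⟩ suc n} {πℒ m ^⟨ ℒ m ⟩ suc n} (RingHom.^-homo (quotientHom {R = S} {I = generators}) (πℒ m) (suc n)))
      (ideal⇒≈/0 {R = S} (Quotient.generator {R = S} {S = generators} (inj₂ (CommutativeRing.refl S)))))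
    where
    module L = CommutativeRing (ℒ m)
    S = PowerSeries.powerSeries (ℤ[ω].ring m)
    open ℒ-Construction m using (p-relation; π^m+1)
    generators : PowerSeries.Series (ℤ[ω].ring m) → Set
    generators z = CommutativeRing._≈_ S p-relation z ⊎ CommutativeRing._≈_ S (π^m+1 m) z

-- Functoriality

module TupleFunctor (p e : ℕ) (t : ℤ) (prime-p : Prime p) (m : ℕ ⁺) where
  open Setup p e t
  open PointsOfWitt p e t prime-p m
  open AlgHom using (⟦_⟧)

  WittOver : CommAlgebra (ℒ₀ m) c ℓ → Set (c ⊔ ℓ)
  WittOver k = WittStructure p q (CommAlgebra.ring k) (ω-values k)

  private
    module T {c ℓ} (k : CommAlgebra (ℒ₀ m) c ℓ) (𝕎 : WittOver k) =
      TupleRing p e prime-p m (CommAlgebra.ring k) (ω-values k) 𝕎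

  tuplesOn : (k : CommAlgebra (ℒ₀ m) c ℓ) → WittOver k → AlgebraOn (ℒ m) (tuples m k)
  tuplesOn k 𝕎 = T.algebraOn k 𝕎 (StructureMap.structureMap k 𝕎)

  module _ {A B : CommAlgebra (ℒ₀ m) c ℓ} (f : AlgHom A B) where
    private
      module A = CommAlgebra A
      module B = CommAlgebra B

    algebraHom : RingHom A.ring B.ring
    algebraHom = ringHom ⟦ f ⟧ (AlgHom.isRingHomomorphism f)

    map-ω-values : ∀ j → ⟦ f ⟧ (ω-values A j) B.≈ ω-values B j
    map-ω-values zero    = RingHom.0#-homo algebraHom
    map-ω-values (suc j) with ≤⁺-dec ℕₚ._≤?_ [ suc j ] m
    ... | yes _ = AlgHom.structure-homo f _
    ... | no  _ = RingHom.0#-homo algebraHom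

    PreservesOperation : Op₂ (ℕ → A.Carrier) → Op₂ (ℕ → B.Carrier) → Set _
    PreservesOperation _∙_ _∘_ = ∀ a b n → ⟦ f ⟧ ((a ∙ b) n) B.≈ ((λ i → ⟦ f ⟧ (a i)) ∘ (λ i → ⟦ f ⟧ (b i))) n

  module Functoriality {A B : CommAlgebra (ℒ₀ m) c ℓ} (f : AlgHom A B) (𝕎A : WittOver A) (𝕎B : WittOver B)
    (f-⊕ : PreservesOperation f (WittStructure._⊕_ 𝕎A) (WittStructure._⊕_ 𝕎B))
    (f-⊗ : PreservesOperation f (WittStructure._⊗_ 𝕎A) (WittStructure._⊗_ 𝕎B))
    where
    private
      module B = CommAlgebra B
      module 𝕎A = WittStructure 𝕎A
      module 𝕎B = WittStructure 𝕎B
      module WB = CommutativeRing 𝕎B.wittRing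
      module TA = TupleRing p e prime-p m (CommAlgebra.ring A) (ω-values A) 𝕎A
      module TB = TupleRing p e prime-p m (CommAlgebra.ring B) (ω-values B) 𝕎B
      module σA = StructureMap A 𝕎A
      module σB = StructureMap B 𝕎B
      module f = RingHom (algebraHom f)

      f-leading : ∀ {x y} → ⟦ f ⟧ x B.≈ y → ∀ i → ⟦ f ⟧ (𝕎A.leading x i) B.≈ 𝕎B.leading y i
      f-leading eq zero    = eq
      f-leading eq (suc i) = f.0#-homo

      f-fill : ∀ x i → ⟦ f ⟧ (TA.fill x i) B.≈ TB.fill (λ j → ⟦ f ⟧ (x j)) i
      f-fill x i with ≤⁺-dec ℕₚ._≤?_ [ i ] m
      ... | yes _ = B.refl
      ... | no  _ = f.0#-homo

      wittHom : RingHom 𝕎A.wittRing 𝕎B.wittRing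
      wittHom = makeHom {R = 𝕎A.wittRing} {S = 𝕎B.wittRing} (λ a i → ⟦ f ⟧ (a i)) (λ p i → f.cong (p i))
        f-⊕ f-⊗ (f-leading f.1#-homo)
      module F = RingHom wittHom

      F-ω-hom : ∀ x → F.to (RingHom.to σA.ω-hom x) WB.≈ RingHom.to σB.ω-hom x
      F-ω-hom = eval-natural wittHom (integer-unique 𝕎B.wittRing (wittHom ∘R integerHom 𝕎A.wittRing))
        (λ (j , n) → f-leading (AlgHom.structure-homo f (ωℒ₀ m j (e ℕ.* n))))

      F-π : F.to 𝕎A.π-sequence WB.≈ 𝕎B.π-sequence
      F-π zero    = f.0#-homo
      F-π (suc i) = f-leading f.1#-homo i

    mapHom : RingHom TA.tupleRing TB.tupleRing
    mapHom = makeHom {R = TA.tupleRing} {S = TB.tupleRing} (λ x i → ⟦ f ⟧ (x i)) (λ p i → f.cong (p i))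
      (λ x y i → B.trans (F.+-homo (TA.fill x) (TA.fill y) (val i))
        (WB.+-cong {F.to (TA.fill x)} {TB.fill (λ j → ⟦ f ⟧ (x j))} {F.to (TA.fill y)} {TB.fill (λ j → ⟦ f ⟧ (y j))}
          (f-fill x) (f-fill y) (val i)))
      (λ x y i → B.trans (F.*-homo (TA.fill x) (TA.fill y) (val i))
        (WB.*-cong {F.to (TA.fill x)} {TB.fill (λ j → ⟦ f ⟧ (x j))} {F.to (TA.fill y)} {TB.fill (λ j → ⟦ f ⟧ (y j))}
          (f-fill x) (f-fill y) (val i)))
      (λ i → F.1#-homo (val i))

    map-structure : ∀ x i → ⟦ f ⟧ (RingHom.to σA.structureMap x i) B.≈ RingHom.to σB.structureMap x i
    map-structure x i = horner-natural wittHom σA.ω-hom 𝕎A.π-sequence σB.ω-hom 𝕎B.π-sequence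
      F-ω-hom F-π (suc (val i)) x (val i)

    map-isAlgHom : IsAlgHom (AlgebraOn.algebra (tuplesOn A 𝕎A)) (AlgebraOn.algebra (tuplesOn B 𝕎B)) (λ x i → ⟦ f ⟧ (x i))
    map-isAlgHom = record
      { isRingHomomorphism = RingHom.isRingHom mapHom ; structure-homo = map-structure }

  module Spectrum (k : CommAlgebra (ℒ₀ m) c ℓ) (𝕎 : WittOver k) where
    private
      module k = CommAlgebra k
      module P = Presentation (ℒ₀ m) (Interval 0 m)
      module TR = CommutativeRing (T.tupleRing k 𝕎)
      Tuple = Setoid.Carrier (tuples m k)

    Points : Setoid _ _
    Points = SetFunctor.obj (points {c = c} {ℓ = ℓ} (coordinateRing m)) k

    open Setoid Points using () renaming (_≈_ to _≈ᴾ_)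

    evaluation : Tuple → AlgHom (coordinateRing m) k
    evaluation x = record
      { ⟦_⟧ = P.eval k.ring k.structure x
      ; isAlgHom = record
        { isRingHomomorphism = RingHom.isRingHom (evalHom (structureHom k) x (λ ()))
        ; structure-homo     = λ _ → k.refl } }

    evaluation-cong : ∀ {x y} → x TR.≈ y → evaluation x ≈ᴾ evaluation y
    evaluation-cong eq = eval-cong {S = k.ring} (λ _ → k.refl) eq

    private
      coordinates′ : AlgHom (coordinateRing m) k → Tuple
      coordinates′ = coordinates m k

    evaluation-coordinates : ∀ φ → evaluation (coordinates′ φ) ≈ᴾ φ
    evaluation-coordinates φ = go
      where
      module φ = AlgHom φ
      go : ∀ x → P.eval k.ring k.structure (coordinates′ φ) x k.≈ ⟦ φ ⟧ x
      go (P.con x)   = k.sym (φ.structure-homo x)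
      go (P.gen x)   = k.refl
      go (x P.⊕ y)   = k.trans (k.+-cong (go x) (go y)) (k.sym (φ.+-homo x y))
      go (x P.⊛ y)   = k.trans (k.*-cong (go x) (go y)) (k.sym (φ.*-homo x y))
      go (P.⊝ x)     = k.trans (k.-‿cong (go x)) (k.sym (φ.-‿homo x))

    private
      evaluationSection : Section (T.tupleRing k 𝕎) Points
      evaluationSection = record
        { r      = evaluation
        ; s      = coordinates′
        ; r-cong = λ {x} {y} eq → evaluation-cong {x} {y} eq
        ; s-cong = λ eq i → eq (P.gen i)
        ; r-s    = evaluation-coordinates
        ; r-+    = λ {x} {x′} {y} {y′} p q → evaluation-cong {x TR.+ y} {x′ TR.+ y′}
            (TR.+-cong {x} {x′} {y} {y′} (λ i → p (P.gen i)) (λ i → q (P.gen i)))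
        ; r-*    = λ {x} {x′} {y} {y′} p q → evaluation-cong {x TR.* y} {x′ TR.* y′}
            (TR.*-cong {x} {x′} {y} {y′} (λ i → p (P.gen i)) (λ i → q (P.gen i)))
        }

    module Transported = Transport evaluationSection

    pointsOn : AlgebraOn (ℒ m) Points
    pointsOn = Transported.algebraOn (Transported.hom ∘R StructureMap.structureMap k 𝕎)

    coordinates-isAlgIso : IsAlgIso (AlgebraOn.algebra pointsOn) (AlgebraOn.algebra (tuplesOn k 𝕎)) coordinates′
    coordinates-isAlgIso = record
      { isAlgHom = record
        { isRingHomomorphism = RingHom.isRingHom (makeHom {R = Transported.ring} {S = T.tupleRing k 𝕎}
            coordinates′ (λ eq i → eq (P.gen i)) (λ _ _ _ → k.refl) (λ _ _ _ → k.refl) (λ _ → k.refl))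
        ; structure-homo     = λ _ _ → k.refl }
      ; bijective =
          (λ {φ} {ψ} eq x → k.trans (k.sym (evaluation-coordinates φ x))
            (k.trans (evaluation-cong {coordinates′ φ} {coordinates′ ψ} eq x) (evaluation-coordinates ψ x)))
        , (λ x → evaluation x , λ eq i → eq (P.gen i)) }

  module SpectrumMap {A B : CommAlgebra (ℒ₀ m) c ℓ} (f : AlgHom A B) (𝕎A : WittOver A) (𝕎B : WittOver B)
    (fᵀ : IsAlgHom (AlgebraOn.algebra (tuplesOn A 𝕎A)) (AlgebraOn.algebra (tuplesOn B 𝕎B)) (λ x i → ⟦ f ⟧ (x i)))
    where
    private
      module B = CommAlgebra B
      module SA = Spectrum A 𝕎A
      module SB = Spectrum B 𝕎B
      tupleHom : AlgHom (AlgebraOn.algebra (tuplesOn A 𝕎A)) (AlgebraOn.algebra (tuplesOn B 𝕎B))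
      tupleHom = record { isAlgHom = fᵀ }
      module fᵀ = AlgHom tupleHom

      map-evaluation : ∀ x y → (∀ i → ⟦ f ⟧ (x i) B.≈ y i) →
        ∀ u → ⟦ f ⟧ (⟦ SA.evaluation x ⟧ u) B.≈ ⟦ SB.evaluation y ⟧ u
      map-evaluation x y eq = eval-natural (algebraHom f) (AlgHom.structure-homo f) eq

      mapPoints : AlgHom (coordinateRing m) A → AlgHom (coordinateRing m) B
      mapPoints φ = f ∘Hom φ

      mapPointsHom : RingHom SA.Transported.ring SB.Transported.ring
      mapPointsHom = makeHom {R = SA.Transported.ring} {S = SB.Transported.ring} mapPoints
        (λ eq u → RingHom.cong (algebraHom f) (eq u))
        (λ φ ψ → map-evaluation _ _ (fᵀ.+-homo (coordinates m A φ) (coordinates m A ψ)))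
        (λ φ ψ → map-evaluation _ _ (fᵀ.*-homo (coordinates m A φ) (coordinates m A ψ)))
        (map-evaluation _ _ fᵀ.1#-homo)

    mapPoints-isAlgHom : IsAlgHom (AlgebraOn.algebra SA.pointsOn) (AlgebraOn.algebra SB.pointsOn) (f ∘Hom_)
    mapPoints-isAlgHom = record
      { isRingHomomorphism = RingHom.isRingHom mapPointsHom
      ; structure-homo     = λ x → map-evaluation _ _ (fᵀ.structure-homo x) }

-- The functor of Witt vectors and the algebra scheme structure on affine space

module WittAlgebras (p e : ℕ) (t : ℤ) (prime-p : Prime p) (m : ℕ ⁺)
  {τ : Setup.MultiplicativeSection p e t}
  (Q⁺ : Setup.ArithmeticPolynomials p e t τ (CommutativeRing._+_ (Setup.Ĉ p e t)))
  (Q× : Setup.ArithmeticPolynomials p e t τ (CommutativeRing._*_ (Setup.Ĉ p e t)))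
  where
  open Setup p e t
  open PointsOfWitt p e t prime-p m
  open TupleFunctor p e t prime-p m
  open ArithmeticPolynomials using (Q)

  witt : (k : CommAlgebra (ℒ₀ m) c ℓ) → WittOver k
  witt k = WittRing.Over.witt p e t prime-p Q⁺ Q× (CommAlgebra.ring k) (char-k k) (ω-values k)

  isWitt : (k : CommAlgebra (ℒ₀ m) c ℓ) → IsWittAlgebra m k Q⁺ Q× (tuplesOn k (witt k))
  isWitt k = record
    { sum         = λ a b i → evaluate≈ Q⁺′ a b i
    ; product     = λ a b i → evaluate≈ Q×′ a b i
    ; structure-ω = StructureMap.structureMap-ω k (witt k)
    ; structure-π = StructureMap.structureMap-π-tuple k (witt k)
    }
    where
    module k = CommAlgebra k
    module T = TupleRing p e prime-p m k.ring (ω-values k) (witt k)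
    open Evaluate p e t
    Q⁺′ = Q Q⁺
    Q×′ = Q Q×
    -- The two evaluations read the coefficients through ℤ and through the structure map of k. They
    -- agree since ℤ is initial, and the filled sequences are read only at indices up to m.
    evaluate≈ : ∀ Q a b i → evaluateℕ k.ring (ω-values k) Q (T.fill a) (T.fill b) (val i) k.≈ evaluate m k Q a b i
    evaluate≈ Q a b i = eval-cong {S = k.ring}
      (λ x → k.sym (integer-unique k.ring (structureHom k ∘R scalarHom ∘R quotientHom) x)) (λ
      { (inj₁ j)        → ω-values-val k (below i j)
      ; (inj₂ (inj₁ j)) → T.fill-val a (below i j)
      ; (inj₂ (inj₂ j)) → T.fill-val b (below i j) }) (Q (val i))

  map-isAlgHom : {A B : CommAlgebra (ℒ₀ m) c ℓ} (f : AlgHom A B) →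
    IsAlgHom (AlgebraOn.algebra (tuplesOn A (witt A))) (AlgebraOn.algebra (tuplesOn B (witt B)))
             (λ x i → AlgHom.⟦_⟧ f (x i))
  map-isAlgHom {A = A} {B} f = Functoriality.map-isAlgHom f (witt A) (witt B)
    (λ a b n → N.evaluate-maps n (λ i _ → map-ω-values f i) (Q Q⁺) {a} {b} (λ _ _ → B.refl) (λ _ _ → B.refl) n ℕₚ.≤-refl)
    (λ a b n → N.evaluate-maps n (λ i _ → map-ω-values f i) (Q Q×) {a} {b} (λ _ _ → B.refl) (λ _ _ → B.refl) n ℕₚ.≤-refl)
    where
    module B = CommAlgebra B
    module N n = Witt.Naturality p e t prime-p Q⁺ Q× (algebraHom f) (ω-values A) (ω-values B) n

  wittLift : AlgebraLift (affineSpace {c} {ℓ} m) (ℒ m)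
  wittLift = record { algebraOn = λ k → tuplesOn k (witt k) ; map-isAlgHom = map-isAlgHom }

  isCRP : (k : CommAlgebra (ℒ₀ m) c ℓ) → IsPerfect p (CommAlgebra.ring k) →
          IsCRP p (ℒ m) (πℒ m) (AlgebraOn.algebra (tuplesOn k (witt k)))
  isCRP k perfect = TupleCRP.isCRP p e prime-p m (CommAlgebra.ring k) (ω-values k) (witt k)
    (πℒ m) ℒ-nilpotent (StructureMap.structureMap k (witt k)) (StructureMap.structureMap-π k (witt k)) perfect

  pointsLift : AlgebraLift (points {c = c} {ℓ = ℓ} (coordinateRing m)) (ℒ m)
  pointsLift = record
    { algebraOn    = λ k → Spectrum.pointsOn k (witt k)
    ; map-isAlgHom = λ {A} {B} f → SpectrumMap.mapPoints-isAlgHom f (witt A) (witt B) (map-isAlgHom f) }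

  coordinates-isAlgIso : (k : CommAlgebra (ℒ₀ m) c ℓ) →
    IsAlgIso (AlgebraOn.algebra (Spectrum.pointsOn k (witt k))) (AlgebraOn.algebra (tuplesOn k (witt k))) (coordinates m k)
  coordinates-isAlgIso k = Spectrum.coordinates-isAlgIso k (witt k)

open import Data.Nat using (_<_; _^_)

theorem2p4 : ∀ {c ℓ} (p e : ℕ) → Prime p → 1 < p ^ e → (t : ℤ) (m : ℕ ⁺) →
    let open Setup p e t in
    (τ : MultiplicativeSection)
    (Q⁺ : ArithmeticPolynomials τ (CommutativeRing._+_ Ĉ))
    (Q× : ArithmeticPolynomials τ (CommutativeRing._*_ Ĉ)) →
    Σ[ W ∈ AlgebraLift (affineSpace {c} {ℓ} m) (ℒ m) ]
    (∀ k → IsWittAlgebra m k Q⁺ Q× (AlgebraLift.algebraOn W k))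
    × (∀ k → IsPerfect p (CommAlgebra.ring k) → IsCRP p (ℒ m) (πℒ m) (AlgebraLift.algebra W k))
    × (Σ[ 𝐀 ∈ AlgebraLift (points {c = c} {ℓ = ℓ} (coordinateRing m)) (ℒ m) ]
    (∀ k → IsAlgIso (AlgebraLift.algebra 𝐀 k) (AlgebraLift.algebra W k) (coordinates m k)))
theorem2p4 p e prime-p _ t m τ Q⁺ Q× =
  wittLift , isWitt , isCRP , pointsLift , coordinates-isAlgIso
  where open WittAlgebras p e t prime-p m Q⁺ Q×
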